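{- Let $G$ be a simple graph on vertex set $[2n+1]$, let $u,v\notin[2n+1]$, and order the vertices of the 2-suspension $G^{u,v}$ as $1<2<\cdots<2n+1<u<v$. For an orientation $\omega$ of the triples of $G^{u,v}$ the following are equivalent: (i) $\omega$ is 3-Pfaffian; (ii) with respect to $\omega$: (a) if $C$ is an even cycle of $G$ (where a single edge counts as a cycle of length two) whose complement in $G$ has a quasi-perfect matching, then all edges of $C$ are agreeing and $C$ is oddly oriented; (b) if $xyz$ is a path of length 2 in $G$ whose complement has a perfect matching, then one of the edges $xy,yz$ is agreeing and the other is opposite; (c) if $x_1x_2x_3x_4x_5$ is a path of length 4 in $G$ whose complement has a perfect matching, then $x_2\xrightarrow{u}x_3$ if and only if $x_4\xrightarrow{u}x_3$, and $x_2\xrightarrow{v}x_3$ if and only if $x_4\xrightarrow{v}x_3$.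
   Context: $G^{u,v}$ is the 3-graph on $[2n+1]\cup\{u,v\}$ with triples $\{i,j,u\},\{i,j,v\}$ for each edge $ij$ of $G$. A triple orientation assigns to each triple $\{a,b,c\}$ a cyclic order (a 3-cycle $(a\,b\,c)$ or $(b\,a\,c)$); the canonical orientation of $\{a,b,c\}$ with $a<b<c$ is $(a\,b\,c)$. An edge $ij$ of $G$ is agreeing if the triples $\{i,j,u\}$ and $\{i,j,v\}$ are either both oriented canonically or both oriented opposite to canonically, and opposite otherwise. The $u$-orientation of $G$ orients edge $ij$ with $i<j$ as $i\xrightarrow{u}j$ if $\{i,j,u\}$ has orientation $(i\,j\,u)$ and as $j\xrightarrow{u}i$ otherwise; the $v$-orientation is defined analogously with $v$. An even cycle is oddly oriented if, traversing it cyclically, an odd number of its edges point forward (for agreeing edges the $u$- and $v$-orientations coincide; a cycle of length two, i.e. a single edge, is always oddly oriented). The complement of a subgraph $G'$ is the subgraph of $G$ induced by $V(G)\setminus V(G')$. A quasi-perfect matching is a spanning subgraph whose components are single edges except exactly one path with two edges. Signs of trees: a cycle in a 3-graph is a sequence $a_0,t_1,\dots,t_\ell,a_\ell=a_0$, $\ell\ge2$, of distinct vertices and distinct triples with $a_{i-1},a_i\in t_i$; a spanning tree is a set of triples with no cycle, covering all vertices, connected via paths of triples. Identifying the vertices with $[2n+3]$ by the given order, for a spanning tree $T$ the product of the 3-cycles assigned to its triples is a $(2n+3)$-cycle $(s(1)\cdots s(2n+3))$, and the sign of $T$ is the sign of the permutation $s$ (well defined). $\omega$ is 3-Pfaffian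 if all spanning trees have the same sign. -}

module Defs where

open import Data.Nat using (ℕ; zero; suc; _+_; _*_; _<ᵇ_; _%_)
open import Data.Fin using (Fin; zero; suc; toℕ; inject₁; fromℕ; _≟_)
open import Data.Fin.Properties using ()
open import Data.Bool using (Bool; true; false; not; if_then_else_; T)
open import Data.Unit using (⊤; tt)
open import Data.List using (List; []; _∷_; foldr; map; allFin)
open import Data.Nat.ListAction using (sum)
open import Data.List.Membership.Propositional using (_∈_)
open import Data.List.Relation.Unary.Unique.Propositional using (Unique)
open import Data.Product using (Σ; _×_; _,_; ∃; ∃-syntax)
open import Data.Sum using (_⊎_)
open import Relation.Nullary using (¬_; does)
open import Relation.Binary.PropositionalEquality using (_≡_; _≢_; refl; sym; trans; subst)
open import Function using (_∘_; id; _⇔_)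
open import Function.Definitions using (Injective)

-- Basic conventions
--   The paper's vertex set [2n+1] is Fin (Nv n) = Fin (2n+1) (0-based,
--   same order).  The 2-suspension has vertex set Fin (2n+3), where the
--   vertex i of G is embedded as i, u is 2n+1 and v is 2n+2, so the
--   order 1 < ... < 2n+1 < u < v is the order of Fin.

Nv : ℕ → ℕ
Nv n = suc (2 * n)

csuc : ∀ {m} → Fin (suc m) → Fin (suc m)
csuc {zero} zero = zero
csuc {suc m} zero = suc zero
csuc {suc m} (suc k) with csuc {m} k
... | zero = zero
... | suc j = suc (suc j)

record Graph (N : ℕ) : Set where
  field
    adj    : Fin N → Fin N → Bool
    adj-sym : ∀ i j → adj i j ≡ adj j i
    irrefl : ∀ i → adj i i ≡ false
open Graph public

data Apex : Set where
  u v : Apex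

module Susp {N : ℕ} (G : Graph N) where

  V : Set
  V = Fin (suc (suc N))

  emb : Fin N → V
  emb i = inject₁ (inject₁ i)

  apexV : Apex → V
  apexV u = inject₁ (fromℕ N)
  apexV v = fromℕ (suc N)

  record Triple : Set where
    constructor mkTriple
    field
      i j : Fin N
      lt  : T (toℕ i <ᵇ toℕ j)
      edge : T (adj G i j)
      w   : Apex
  open Triple public

  -- triple orientation: true = canonical (i j w), false = opposite (j i w)
  Orientation : Set
  Orientation = Triple → Bool

  _∈ₜ_ : V → Triple → Set
  x ∈ₜ t = x ≡ emb (i t) ⊎ x ≡ emb (j t) ⊎ x ≡ apexV (w t)

  -- cycles in the 3-graph formed by a set (list) of triples:
  -- a_0, t_1, ..., t_ℓ, a_ℓ = a_0 with ℓ ≥ 2, distinct vertices, distinct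
  -- triples, a_{k-1}, a_k ∈ t_k   (here 0-indexed: a_k, a_{k+1 mod ℓ} ∈ t_k)
  HasCycle : List Triple → Set
  HasCycle Ts =
    Σ ℕ λ m → Σ (Fin (suc (suc m)) → V) λ a → Σ (Fin (suc (suc m)) → Triple) λ t →
      Injective _≡_ _≡_ a × Injective _≡_ _≡_ t ×
      (∀ k → t k ∈ Ts) × (∀ k → a k ∈ₜ t k) × (∀ k → a (csuc k) ∈ₜ t k)

  data Reach (Ts : List Triple) : V → V → Set where
    here : ∀ {x} → Reach Ts x x
    step : ∀ {x z y} (t : Triple) → t ∈ Ts → x ∈ₜ t → z ∈ₜ t → Reach Ts z y → Reach Ts x y

  SpanningTree : List Triple → Set
  SpanningTree Ts =
    Unique Ts × ¬ HasCycle Ts × (∀ x → ∃[ t ] (t ∈ Ts × x ∈ₜ t)) × (∀ x y → Reach Ts x y)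

  cyc3 : V → V → V → V → V
  cyc3 a b c x =
    if does (x ≟ a) then b else if does (x ≟ b) then c else if does (x ≟ c) then a else x

  perm : Orientation → Triple → V → V
  perm ω t with ω t
  ... | true  = cyc3 (emb (i t)) (emb (j t)) (apexV (w t))
  ... | false = cyc3 (emb (j t)) (emb (i t)) (apexV (w t))

  prod : Orientation → List Triple → V → V
  prod ω = foldr (λ t f → perm ω t ∘ f) id

  iter : (V → V) → ℕ → V → V
  iter f zero = id
  iter f (suc k) = f ∘ iter f k

  -- if the product is the (2n+3)-cycle (s(1) ... s(2n+3)), normalised
  -- with s(1) = first vertex, then s(k) = π^(k-1)(first vertex)
  cycleSeq : (V → V) → Fin (suc (suc N)) → V
  cycleSeq π k = iter π (toℕ k) zero

  inversions : ∀ {M} → (Fin M → Fin M) → ℕ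
  inversions {M} s =
    sum (map (λ a → sum (map (λ b →
      if (toℕ a <ᵇ toℕ b) then (if (toℕ (s b) <ᵇ toℕ (s a)) then 1 else 0) else 0)
      (allFin M))) (allFin M))

  sign : Orientation → List Triple → ℕ
  sign ω Ts = inversions (cycleSeq (prod ω Ts)) % 2

  ThreePfaffian : Orientation → Set
  ThreePfaffian ω = ∀ Ts Ts' → SpanningTree Ts → SpanningTree Ts' → sign ω Ts ≡ sign ω Ts'

  -- orientation bit of the triple {min(x,y), max(x,y), w} (false if xy is
  -- not an edge, irrelevant in all uses)
  edgeBit : Orientation → Apex → Fin N → Fin N → Bool
  edgeBit ω a x y with toℕ x <ᵇ toℕ y in p | adj G x y in q
  ... | true | true = ω (mkTriple x y (subst T (sym p) tt) (subst T (sym q) tt) a)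
  ... | true | false = false
  ... | false | _ with toℕ y <ᵇ toℕ x in p' | adj G y x in q'
  ... | true | true = ω (mkTriple y x (subst T (sym p') tt) (subst T (sym q') tt) a)
  ... | _ | _ = false

  Agreeing : Orientation → Fin N → Fin N → Set
  Agreeing ω x y = edgeBit ω u x y ≡ edgeBit ω v x y

  Opposite : Orientation → Fin N → Fin N → Set
  Opposite ω x y = edgeBit ω u x y ≢ edgeBit ω v x y

  arrow : Orientation → Apex → Fin N → Fin N → Bool
  arrow ω a x y = if toℕ x <ᵇ toℕ y then edgeBit ω a x y else not (edgeBit ω a x y)

  -- even cycle c_0 c_1 ... c_{ℓ-1} of G, ℓ = 2k+2 (ℓ = 2: a single edge)
  IsCycle : ∀ {m} → (Fin (suc m) → Fin N) → Set
  IsCycle c = Injective _≡_ _≡_ c × (∀ k → adj G (c k) (c (csuc k)) ≡ true)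

  forwardCount : ∀ {m} → Orientation → Apex → (Fin (suc m) → Fin N) → ℕ
  forwardCount {m} ω a c =
    sum (map (λ k → if arrow ω a (c k) (c (csuc k)) then 1 else 0) (allFin (suc m)))

  -- oddly oriented (used for cycles all of whose edges agree, so the
  -- u- and v-orientations coincide on it; we count in the u-orientation)
  OddlyOriented : ∀ {m} → Orientation → (Fin (suc m) → Fin N) → Set
  OddlyOriented ω c = forwardCount ω u c % 2 ≡ 1

  PerfectMatching : (Fin N → Set) → Set
  PerfectMatching S = Σ (Fin N → Fin N) λ μ → ∀ x → S x →
    S (μ x) × μ x ≢ x × μ (μ x) ≡ x × adj G x (μ x) ≡ true

  QuasiPerfectMatching : (Fin N → Set) → Set
  QuasiPerfectMatching S = Σ (Fin N) λ x → Σ (Fin N) λ y → Σ (Fin N) λ z →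
    S x × S y × S z × x ≢ y × y ≢ z × x ≢ z ×
    adj G x y ≡ true × adj G y z ≡ true ×
    PerfectMatching (λ a → S a × a ≢ x × a ≢ y × a ≢ z)

  Compl : ∀ {m} → (Fin m → Fin N) → Fin N → Set
  Compl f x = ∀ k → f k ≢ x

  IsPath : ∀ {m} → (Fin (suc m) → Fin N) → Set
  IsPath {m} p = Injective _≡_ _≡_ p × (∀ (k : Fin m) → adj G (p (inject₁ k)) (p (suc k)) ≡ true)

  CondA : Orientation → Set
  CondA ω = ∀ (k : ℕ) (c : Fin (suc (suc (k + k))) → Fin N) →
    IsCycle c → QuasiPerfectMatching (Compl c) →
    (∀ i → Agreeing ω (c i) (c (csuc i))) × OddlyOriented ω c

  CondB : Orientation → Set
  CondB ω = ∀ (p : Fin 3 → Fin N) → IsPath p → PerfectMatching (Compl p) →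
    let x = p zero ; y = p (suc zero) ; z = p (suc (suc zero)) in
    (Agreeing ω x y × Opposite ω y z) ⊎ (Opposite ω x y × Agreeing ω y z)

  CondC : Orientation → Set
  CondC ω = ∀ (p : Fin 5 → Fin N) → IsPath p → PerfectMatching (Compl p) →
    let x₂ = p (suc zero) ; x₃ = p (suc (suc zero)) ; x₄ = p (suc (suc (suc zero))) in
    (arrow ω u x₂ x₃ ≡ true ⇔ arrow ω u x₄ x₃ ≡ true) ×
    (arrow ω v x₂ x₃ ≡ true ⇔ arrow ω v x₄ x₃ ≡ true)

  CondII : Orientation → Set
  CondII ω = CondA ω × CondB ω × CondC ω

-- A spanning tree of the 2-suspension is a quasi-perfect matching of G, with path x y z, whose single
-- edges are assigned u or v arbitrarily and whose edges xy and yz get different apices, say u and v. The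
-- triples at u
-- multiply to a cycle (u a₁ b₁ a₂ b₂ …), those at v likewise, and triples at different apices commute
-- unless both contain y; so the product of the tree splices two such cycles at y. Hence, up to a constant,
-- the sign of the tree is the parity of the word y x z a₁ b₁ a₂ b₂ … plus one bit for each edge that is
-- not oriented along this word. Comparing these values for matchings that differ by an even cycle, by
-- exchanging the apices on the path, or by sliding the path along two further vertices gives (a), (b), (c).
-- Conversely, two quasi-perfect matchings are connected by such moves: as long as an edge xy of the path
-- is missing from the target, the target edge at x leads off the path, since (b) excludes a triangle, and
-- sliding along it gains an edge by (c). In the end the paths agree, and alternating cycles are left for (a).
module Submission where

open import Defs
open import Data.Nat using (ℕ; zero; suc; _+_; _<ᵇ_; _%_; _≤_; _<_; z≤n; s≤s)
import Data.Nat.Properties as ℕₚ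
open import Data.Nat.ListAction using (sum)
open import Data.Fin using (Fin; zero; suc; toℕ; inject₁; fromℕ; _≟_)
import Data.Fin.Properties as Finₚ
open import Data.Bool using (Bool; true; false; not; if_then_else_; T; _xor_; _∧_)
open import Data.Bool.Properties
  using (T-irrelevant; not-involutive; not-injective; ∧-comm; xor-identityʳ; xor-assoc; xor-comm; xor-same)
open import Data.Bool.Solver using (module xor-∧-Solver)
open import Data.List using (List; []; _∷_; _++_; map; allFin; tabulate; length; filter; lookup)
open import Data.List.Properties
  using (++-assoc; ++-identityʳ; length-++; length-map; map-++; map-tabulate; tabulate-cong; tabulate-lookup;
         length-tabulate; filter-++; filter-all; filter-none; ∷-injective)
open import Data.List.Membership.Propositional using (_∈_; _∉_)
open import Data.List.Membership.Propositional.Properties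
  using (∈-++⁺ˡ; ∈-++⁺ʳ; ∈-++⁻; ∈-∃++; ∈-map⁺; ∈-map⁻; ∈-filter⁺; ∈-filter⁻; ∈-allFin;
         ∈-lookup; ∈-tabulate⁺; ∈-tabulate⁻)
open import Data.List.Membership.Propositional.Properties.WithK using (unique∧set⇒bag)
import Data.List.Membership.DecPropositional as DecMembership
open import Data.List.Relation.Unary.Any using (here; there)
open import Data.List.Relation.Unary.All using (All; []; _∷_)
import Data.List.Relation.Unary.All as All
import Data.List.Relation.Unary.All.Properties as Allₚ
open import Data.List.Relation.Unary.AllPairs using (AllPairs; []; _∷_)
import Data.List.Relation.Unary.AllPairs as AllPairs
open import Data.List.Relation.Unary.Unique.Propositional using (Unique)
import Data.List.Relation.Unary.Unique.Propositional.Properties as Uniqueₚ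
open import Data.List.Relation.Unary.Unique.Propositional.Properties using (Unique[x∷xs]⇒x∉xs)
open import Data.List.Relation.Binary.BagAndSetEquality using (∼bag⇒↭)
open import Data.List.Relation.Binary.Pointwise using (Pointwise; []; _∷_)
open import Data.List.Relation.Binary.Permutation.Propositional
  using (_↭_; refl; prep; swap; ↭-refl; ↭-sym; ↭-trans; ↭-reflexive; ↭⇒↭ₛ)
open import Data.List.Relation.Binary.Permutation.Propositional.Properties
  using (drop-∷; shifts; ∈-resp-↭; All-resp-↭; ++-comm; ↭-length; ++⁺ˡ; ++⁺ʳ)
import Data.List.Relation.Binary.Permutation.Setoid.Properties as Permₛ
open import Data.Product using (_×_; _,_; ∃; proj₁; proj₂)
open import Data.Product.Properties using (≡-dec)
open import Data.Sum using (_⊎_; inj₁; inj₂)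
import Data.Sum as Sum
open import Data.Empty using (⊥; ⊥-elim)
open import Data.Unit using (⊤; tt)
open import Relation.Nullary using (¬_; Dec; yes; no; _⊎-dec_)
open import Relation.Binary.Definitions using (tri<; tri≈; tri>)
open import Relation.Binary.PropositionalEquality
  using (_≡_; _≢_; refl; sym; trans; cong; cong₂; subst; ≢-sym; setoid)
open import Function using (_∘_; id; _⇔_; mk⇔; Equivalence)

-- The product follows an arbitrary order of the triples and cycle notation may begin anywhere, so
-- the sign must not depend on either choice. Rotations are harmless because the words have odd
-- length 2n+3. The order of the list only decides which of the two path triples acts first: the
-- resulting words are `y` followed by the same two blocks in one order or the other, and both
-- blocks have even length. Parities are carried along with rearrangements by `_~[_]_`. A move
-- between matchings then contributes a rearrangement of the word and a change of edge bits, and the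
-- two contributions are compared in the Boolean ring. For the converse, the value has to be a
-- function of the matching alone. Reversing a listed edge swaps two letters and flips one bit; (a)
-- for cycles of length two allows every single edge to be read at `u`; and (b) makes the value
-- symmetric in the two ends of the path.

odd : ℕ → Bool
odd zero = false
odd (suc n) = not (odd n)

bit : Bool → ℕ
bit b = if b then 1 else 0

xor-notˡ : ∀ a b → not a xor b ≡ not (a xor b)
xor-notˡ true true = refl
xor-notˡ true false = refl
xor-notˡ false _ = refl

odd-+ : ∀ m n → odd (m + n) ≡ odd m xor odd n
odd-+ zero n = refl
odd-+ (suc m) n = trans (cong not (odd-+ m n)) (sym (xor-notˡ (odd m) (odd n)))

odd-bit : ∀ b → odd (bit b) ≡ b
odd-bit true = refl
odd-bit false = refl

%2-odd : ∀ n → n % 2 ≡ bit (odd n)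
%2-odd zero = refl
%2-odd (suc zero) = refl
%2-odd (suc (suc n)) = trans (%2-odd n) (cong bit (not-not (odd n)))
  where
  not-not : ∀ b → b ≡ not (not b)
  not-not true = refl
  not-not false = refl

bit-injective : ∀ {a b} → bit a ≡ bit b → a ≡ b
bit-injective {true} {true} _ = refl
bit-injective {false} {false} _ = refl

-- Parity of words

infix 4 _~[_]_

-- The index is the parity of the number of adjacent transpositions used.
data _~[_]_ {A : Set} : List A → Bool → List A → Set where
  ~refl  : ∀ {xs} → xs ~[ false ] xs
  ~prep  : ∀ x {xs ys b} → xs ~[ b ] ys → (x ∷ xs) ~[ b ] (x ∷ ys)
  ~swap  : ∀ x y {xs} → (x ∷ y ∷ xs) ~[ true ] (y ∷ x ∷ xs)
  ~trans : ∀ {xs ys zs b c} → xs ~[ b ] ys → ys ~[ c ] zs → xs ~[ b xor c ] zs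

module _ {A : Set} where

  ~cast : ∀ {xs ys : List A} {b c} → b ≡ c → xs ~[ b ] ys → xs ~[ c ] ys
  ~cast refl p = p

  ~reflexive : ∀ {xs ys : List A} → xs ≡ ys → xs ~[ false ] ys
  ~reflexive refl = ~refl

  ~sym : ∀ {xs ys : List A} {b} → xs ~[ b ] ys → ys ~[ b ] xs
  ~sym ~refl = ~refl
  ~sym (~prep x p) = ~prep x (~sym p)
  ~sym (~swap x y) = ~swap y x
  ~sym (~trans {b = b} {c} p q) = ~cast (xor-comm c b) (~trans (~sym q) (~sym p))

  ~⇒↭ : ∀ {xs ys : List A} {b} → xs ~[ b ] ys → xs ↭ ys
  ~⇒↭ ~refl = ↭-refl
  ~⇒↭ (~prep x p) = prep x (~⇒↭ p)
  ~⇒↭ (~swap x y) = swap x y ↭-refl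
  ~⇒↭ (~trans p q) = ↭-trans (~⇒↭ p) (~⇒↭ q)

  ~++ˡ : ∀ zs {xs ys : List A} {b} → xs ~[ b ] ys → (zs ++ xs) ~[ b ] (zs ++ ys)
  ~++ˡ [] p = p
  ~++ˡ (z ∷ zs) p = ~prep z (~++ˡ zs p)

  ~++ʳ : ∀ zs {xs ys : List A} {b} → xs ~[ b ] ys → (xs ++ zs) ~[ b ] (ys ++ zs)
  ~++ʳ zs ~refl = ~refl
  ~++ʳ zs (~prep x p) = ~prep x (~++ʳ zs p)
  ~++ʳ zs (~swap x y) = ~swap x y
  ~++ʳ zs (~trans p q) = ~trans (~++ʳ zs p) (~++ʳ zs q)

  ~shift : ∀ x (xs ys : List A) → (x ∷ xs ++ ys) ~[ odd (length xs) ] (xs ++ x ∷ ys)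
  ~shift x [] ys = ~refl
  ~shift x (z ∷ xs) ys = ~trans (~swap x z) (~prep z (~shift x xs ys))

  ~shifts : ∀ (xs ys zs : List A) →
    (xs ++ ys ++ zs) ~[ odd (length xs) ∧ odd (length ys) ] (ys ++ xs ++ zs)
  ~shifts [] ys zs = ~refl
  ~shifts (x ∷ xs) ys zs =
    ~cast (lem (odd (length xs)) (odd (length ys)))
      (~trans (~prep x (~shifts xs ys zs)) (~shift x ys (xs ++ zs)))
    where
    lem : ∀ a b → (a ∧ b) xor b ≡ not a ∧ b
    lem true true = refl
    lem true false = refl
    lem false b = refl

  ~comm : ∀ (xs ys : List A) → (xs ++ ys) ~[ odd (length xs) ∧ odd (length ys) ] (ys ++ xs)
  ~comm xs ys = subst₂' (~shifts xs ys [])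
    where
    subst₂' : ∀ {b} → (xs ++ ys ++ []) ~[ b ] (ys ++ xs ++ []) → (xs ++ ys) ~[ b ] (ys ++ xs)
    subst₂' p rewrite ++-identityʳ ys | ++-identityʳ xs = p

Unique-resp-↭ : ∀ {A : Set} {xs ys : List A} → xs ↭ ys → Unique xs → Unique ys
Unique-resp-↭ p = Permₛ.Unique-resp-↭ (setoid _) (↭⇒↭ₛ p)

-- The parity of the inversion number of a word

module _ {M : ℕ} where

  smaller : Fin M → List (Fin M) → Bool
  smaller x [] = false
  smaller x (y ∷ ys) = (toℕ y <ᵇ toℕ x) xor smaller x ys

  inv : List (Fin M) → Bool
  inv [] = false
  inv (x ∷ xs) = smaller x xs xor inv xs

  open xor-∧-Solver

  <ᵇ-total : ∀ m n → m ≢ n → (m <ᵇ n) xor (n <ᵇ m) ≡ true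
  <ᵇ-total zero zero m≢n = ⊥-elim (m≢n refl)
  <ᵇ-total zero (suc n) m≢n = refl
  <ᵇ-total (suc m) zero m≢n = refl
  <ᵇ-total (suc m) (suc n) m≢n = <ᵇ-total m n (m≢n ∘ cong suc)

  smaller-~ : ∀ x {ys zs b} → ys ~[ b ] zs → smaller x ys ≡ smaller x zs
  smaller-~ x ~refl = refl
  smaller-~ x (~prep y p) = cong ((toℕ y <ᵇ toℕ x) xor_) (smaller-~ x p)
  smaller-~ x (~swap y z) =
    solve 3 (λ a b c → a :+ (b :+ c) := b :+ (a :+ c)) refl (toℕ y <ᵇ toℕ x) (toℕ z <ᵇ toℕ x) _
  smaller-~ x (~trans p q) = trans (smaller-~ x p) (smaller-~ x q)

  -- Only an adjacent swap changes the parity, and for distinct letters it reverses exactly one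
  -- comparison. With repeated letters the index of `_~[_]_` would not be determined by the two
  -- words, whence `Unique`.
  inv-~ : ∀ {xs ys b} → Unique xs → xs ~[ b ] ys → inv ys ≡ b xor inv xs
  inv-~ _ ~refl = refl
  inv-~ (_ ∷ us) (~prep x {xs} {ys} {b} p) =
    trans (cong₂ _xor_ (sym (smaller-~ x p)) (inv-~ us p))
      (solve 3 (λ a b c → a :+ (b :+ c) := b :+ (a :+ c)) refl (smaller x xs) b (inv xs))
  inv-~ ((x≢y ∷ _) ∷ _) (~swap x y {xs}) =
    trans
      (solve 5 (λ a b c d e → (a :+ c) :+ (d :+ e) := (a :+ b) :+ ((b :+ d) :+ (c :+ e))) refl
        (toℕ x <ᵇ toℕ y) (toℕ y <ᵇ toℕ x) (smaller y xs) (smaller x xs) (inv xs))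
      (cong (_xor (inv (x ∷ y ∷ xs))) (<ᵇ-total (toℕ x) (toℕ y) (x≢y ∘ Finₚ.toℕ-injective)))
  inv-~ us (~trans {xs} {ys} {zs} {b} {c} p q) =
    trans (inv-~ (Unique-resp-↭ (~⇒↭ p) us) q)
      (trans (cong (c xor_) (inv-~ us p))
        (solve 3 (λ a b c → c :+ (b :+ a) := (b :+ c) :+ a) refl (inv xs) b c))

  inv-max : ∀ xs c → All (λ x → (toℕ c <ᵇ toℕ x) ≡ false) xs → inv (xs ++ c ∷ []) ≡ inv xs
  inv-max [] c [] = refl
  inv-max (x ∷ xs) c (c≥x ∷ c≥xs) = cong₂ _xor_ (smaller-snoc xs) (inv-max xs c c≥xs)
    where
    smaller-snoc : ∀ ys → smaller x (ys ++ c ∷ []) ≡ smaller x ys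
    smaller-snoc [] = cong (_xor false) c≥x
    smaller-snoc (y ∷ ys) = cong ((toℕ y <ᵇ toℕ x) xor_) (smaller-snoc ys)

module _ {M K : ℕ} where

  inv-map : (f : Fin M → Fin K) → (∀ x y → (toℕ (f x) <ᵇ toℕ (f y)) ≡ (toℕ x <ᵇ toℕ y)) →
    ∀ xs → inv (map f xs) ≡ inv xs
  inv-map f mono [] = refl
  inv-map f mono (x ∷ xs) = cong₂ _xor_ (smaller-map xs) (inv-map f mono xs)
    where
    smaller-map : ∀ ys → smaller (f x) (map f ys) ≡ smaller x ys
    smaller-map [] = refl
    smaller-map (y ∷ ys) = cong₂ _xor_ (mono y x) (smaller-map ys)

sum-allFin : ∀ {n} (f : Fin n → ℕ) → sum (map f (allFin n)) ≡ sum (tabulate f)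
sum-allFin f = cong sum (map-tabulate id f)

module _ where

  private
    inverted : ∀ {M K} → (Fin M → Fin K) → Fin M → Fin M → ℕ
    inverted s a b =
      if (toℕ a <ᵇ toℕ b) then (if (toℕ (s b) <ᵇ toℕ (s a)) then 1 else 0) else 0

    odd-row : ∀ {M K} (x : Fin K) (s : Fin M → Fin K) →
      odd (sum (tabulate (λ b → if toℕ (s b) <ᵇ toℕ x then 1 else 0))) ≡ smaller x (tabulate s)
    odd-row {zero} x s = refl
    odd-row {suc M} x s =
      trans (odd-+ (bit (toℕ (s zero) <ᵇ toℕ x)) _)
            (cong₂ _xor_ (odd-bit (toℕ (s zero) <ᵇ toℕ x)) (odd-row x (s ∘ suc)))

    -- Splitting off the first index leaves its row, which is `smaller`. Its column vanishes because
    -- no index lies below zero, and what remains is the same sum for the tail.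
    odd-rows : ∀ {M K} (s : Fin M → Fin K) →
      odd (sum (tabulate (λ a → sum (tabulate (inverted s a))))) ≡ inv (tabulate s)
    odd-rows {zero} s = refl
    odd-rows {suc M} s =
      trans (odd-+ (sum (tabulate (λ b → if toℕ (s (suc b)) <ᵇ toℕ (s zero) then 1 else 0))) _)
            (cong₂ _xor_ (odd-row (s zero) (s ∘ suc)) (odd-rows (s ∘ suc)))

  odd-inversions : ∀ {M K} (s : Fin M → Fin K) →
    odd (sum (map (λ a → sum (map (inverted s a) (allFin M))) (allFin M))) ≡ inv (tabulate s)
  odd-inversions {M} s =
    trans (cong odd (trans (sum-allFin (λ a → sum (map (inverted s a) (allFin M))))
                           (cong sum (tabulate-cong (λ a → sum-allFin (inverted s a))))))
          (odd-rows s)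

-- Cyclic words of permutations

module _ {A : Set} where

  ++-disjoint : ∀ {x} ys {zs : List A} → Unique (ys ++ zs) → x ∈ ys → x ∈ zs → ⊥
  ++-disjoint (y ∷ ys) (y≢ ∷ uniq) (here refl) q = All.lookup y≢ (∈-++⁺ʳ ys q) refl
  ++-disjoint (y ∷ ys) (y≢ ∷ uniq) (there p) q = ++-disjoint ys uniq p q

  Chain : (A → A) → A → List A → A → Set
  Chain f x [] z = f x ≡ z
  Chain f x (y ∷ ys) z = f x ≡ y × Chain f y ys z

  chain-++⁺ : ∀ {f x ys y zs z} → Chain f x ys y → Chain f y zs z → Chain f x (ys ++ y ∷ zs) z
  chain-++⁺ {ys = []} p q = p , q
  chain-++⁺ {ys = _ ∷ _} (p , ps) q = p , chain-++⁺ ps q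

  chain-++⁻ : ∀ {f x} ys {y zs z} → Chain f x (ys ++ y ∷ zs) z → Chain f x ys y × Chain f y zs z
  chain-++⁻ [] (p , q) = p , q
  chain-++⁻ (_ ∷ ys) (p , ps) with chain-++⁻ ys ps
  ... | q , r = (p , q) , r

  chain-∘ˡ : ∀ {f x ys z} g → (∀ a → a ∈ ys → g a ≡ a) → Chain f x ys z → Chain (g ∘ f) x ys (g z)
  chain-∘ˡ {ys = []} g fix p = cong g p
  chain-∘ˡ {ys = y ∷ ys} g fix (p , ps) =
    trans (cong g p) (fix y (here refl)) , chain-∘ˡ g (λ a → fix a ∘ there) ps

  chain-∘ʳ : ∀ {f x ys z} g → (∀ a → a ∈ x ∷ ys → g a ≡ a) → Chain f x ys z → Chain (f ∘ g) x ys z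
  chain-∘ʳ {f} {x} {[]} g fix p = trans (cong f (fix x (here refl))) p
  chain-∘ʳ {f} {x} {y ∷ ys} g fix (p , ps) =
    trans (cong f (fix x (here refl))) p , chain-∘ʳ g (λ a → fix a ∘ there) ps

  chain-cong : ∀ {f g : A → A} {x ys z} → (∀ a → f a ≡ g a) → Chain f x ys z → Chain g x ys z
  chain-cong {x = x} {[]} f≗g p = trans (sym (f≗g x)) p
  chain-cong {x = x} {y ∷ ys} f≗g (p , ps) = trans (sym (f≗g x)) p , chain-cong f≗g ps

  -- `f` is the cycle with cycle notation `x ∷ xs`. The starting letter is a parameter because two
  -- cycles are going to be spliced at a chosen common letter.
  record Cycle (f : A → A) (x : A) (xs : List A) : Set where
    constructor mkCycle
    field
      chain : Chain f x xs x
      fixed : ∀ a → a ∉ x ∷ xs → f a ≡ a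
  open Cycle public

  cycle-cong : ∀ {f g : A → A} {x xs} → (∀ a → f a ≡ g a) → Cycle f x xs → Cycle g x xs
  cycle-cong f≗g c = mkCycle (chain-cong f≗g (chain c)) (λ a a∉ → trans (sym (f≗g a)) (fixed c a a∉))

  cycle-rotate : ∀ {f x} ys y zs → Cycle f x (ys ++ y ∷ zs) → Cycle f y (zs ++ x ∷ ys)
  cycle-rotate {f} {x} ys y zs c with chain-++⁻ ys (chain c)
  ... | p , q = mkCycle (chain-++⁺ q p)
    (λ a a∉ → fixed c a (λ a∈ → a∉ (∈-resp-↭ (++-comm (x ∷ ys) (y ∷ zs)) a∈)))

  -- Rotating a word of odd length is an even permutation.
  cycle-from : ∀ {f x xs y} → odd (length (x ∷ xs)) ≡ true → Cycle f x xs → y ∈ x ∷ xs →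
    ∃ λ ys → Cycle f y ys × (y ∷ ys) ~[ false ] (x ∷ xs)
  cycle-from odd-xs c (here refl) = _ , c , ~refl
  cycle-from {x = x} odd-xs c (there y∈) with ∈-∃++ y∈
  ... | ys , zs , refl = zs ++ x ∷ ys , cycle-rotate ys _ zs c ,
    ~cast (one-even (odd (length zs)) (odd (length ys))
            (trans (cong not (trans (sym (odd-+ (length ys) _)) (cong odd (sym (length-++ ys))))) odd-xs))
      (~comm (_ ∷ zs) (x ∷ ys))
    where
    one-even : ∀ a b → not (b xor not a) ≡ true → not a ∧ not b ≡ false
    one-even true b _ = refl
    one-even false true _ = refl

  -- Since `f` fixes `a` and `b`, composing with the 3-cycle `(c a b)` only redirects the last arrow
  -- back to `c` through the two new letters.
  cycle-extend : ∀ {f c xs a b} g → Unique (c ∷ xs ++ a ∷ b ∷ []) →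
    g c ≡ a → g a ≡ b → g b ≡ c → (∀ x → x ≢ a → x ≢ b → x ≢ c → g x ≡ x) →
    Cycle f c xs → Cycle (g ∘ f) c (xs ++ a ∷ b ∷ [])
  cycle-extend {f} {c} {xs} {a} {b} g uniq gc ga gb gfix cyc =
    mkCycle
      (chain-++⁺ (subst (Chain _ _ _) gc (chain-∘ˡ g xs-fixed (chain cyc)))
        (trans (cong g (fixed cyc a a∉)) ga , trans (cong g (fixed cyc b b∉)) gb))
      (λ x x∉ → trans (cong g (fixed cyc x (x∉ ∘ ∈-++⁺ˡ {xs = c ∷ xs})))
        (gfix x (λ { refl → x∉ (∈-++⁺ʳ (c ∷ xs) (here refl)) })
                (λ { refl → x∉ (∈-++⁺ʳ (c ∷ xs) (there (here refl))) })
                (λ { refl → x∉ (here refl) })))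
    where
    a∉ : a ∉ c ∷ xs
    a∉ p = ++-disjoint (c ∷ xs) uniq p (here refl)
    b∉ : b ∉ c ∷ xs
    b∉ p = ++-disjoint (c ∷ xs) uniq p (there (here refl))
    xs-fixed : ∀ x → x ∈ xs → g x ≡ x
    xs-fixed x x∈ = gfix x (λ { refl → a∉ (there x∈) }) (λ { refl → b∉ (there x∈) })
      (λ { refl → Unique[x∷xs]⇒x∉xs uniq (∈-++⁺ˡ x∈) })

  -- The cycles meet only in `y`. The inner factor `g` runs through `ys` first; where it would
  -- return to `y`, the outer factor `f` sends `y` on to `a`. The second block is therefore that of
  -- the outer factor.
  cycle-merge : ∀ {f g y a xs ys} → Unique (y ∷ ys ++ a ∷ xs) →
    Cycle f y (a ∷ xs) → Cycle g y ys → Cycle (f ∘ g) y (ys ++ a ∷ xs)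
  cycle-merge {f} {g} {y} {a} {xs} {ys} (y≢ ∷ uniq) cf cg =
    mkCycle
      (chain-++⁺ (subst (Chain _ _ _) (proj₁ (chain cf)) (chain-∘ˡ f ys-fixed (chain cg)))
        (chain-∘ʳ g xs-fixed (proj₂ (chain cf))))
      (λ x x∉ → trans (cong f (fixed cg x (x∉ ∘ ∈-++⁺ˡ {xs = y ∷ ys})))
        (fixed cf x (λ { (here refl) → x∉ (here refl) ; (there p) → x∉ (∈-++⁺ʳ (y ∷ ys) p) })))
    where
    ys-fixed : ∀ x → x ∈ ys → f x ≡ x
    ys-fixed x x∈ = fixed cf x
      (λ { (here refl) → All.lookup y≢ (∈-++⁺ˡ x∈) refl ; (there p) → ++-disjoint ys uniq x∈ p })
    xs-fixed : ∀ x → x ∈ a ∷ xs → g x ≡ x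
    xs-fixed x x∈ = fixed cg x
      (λ { (here refl) → All.lookup y≢ (∈-++⁺ʳ ys x∈) refl ; (there p) → ++-disjoint ys uniq p x∈ })

-- The sign of a spanning tree

infix 4 _≟ₐ_
_≟ₐ_ : (a b : Apex) → Dec (a ≡ b)
u ≟ₐ u = yes refl
u ≟ₐ v = no λ ()
v ≟ₐ u = no λ ()
v ≟ₐ v = yes refl

other : Apex → Apex
other u = v
other v = u

≢⇒other : ∀ {a b} → a ≢ b → a ≡ other b
≢⇒other {u} {u} p = ⊥-elim (p refl)
≢⇒other {u} {v} p = refl
≢⇒other {v} {u} p = refl
≢⇒other {v} {v} p = ⊥-elim (p refl)

≢other : ∀ a → a ≢ other a
≢other u ()
≢other v ()

Unique-++ˡ : ∀ {A : Set} (xs : List A) {ys} → Unique (xs ++ ys) → Unique xs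
Unique-++ˡ [] _ = []
Unique-++ˡ (x ∷ xs) (p ∷ ps) = Allₚ.++⁻ˡ xs p ∷ Unique-++ˡ xs ps

flat : ∀ {A : Set} → List (A × A) → List A
flat [] = []
flat ((a , b) ∷ es) = a ∷ b ∷ flat es

odd-flat : ∀ {A : Set} (es : List (A × A)) → odd (length (flat es)) ≡ false
odd-flat [] = refl
odd-flat (_ ∷ es) = trans (not-involutive _) (odd-flat es)

<ᵇ-asym : ∀ m n → T (m <ᵇ n) → (n <ᵇ m) ≡ true → ⊥
<ᵇ-asym zero (suc n) _ ()
<ᵇ-asym (suc m) (suc n) p = <ᵇ-asym m n p

T⇒≡ : ∀ {b} → T b → b ≡ true
T⇒≡ {true} _ = refl

if-true : ∀ {A : Set} {b} {x y : A} → b ≡ true → (if b then x else y) ≡ x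
if-true refl = refl

if-false : ∀ {A : Set} {b} {x y : A} → (b ≡ true → ⊥) → (if b then x else y) ≡ y
if-false {b = true} p = ⊥-elim (p refl)
if-false {b = false} p = refl

-- Triples as 3-cycles, and the cycle of a star

module Sign {N : ℕ} (G : Graph N) (ω : Susp.Orientation G) where
  open Susp G

  private
    -- The arguments tt and t, equal only by η, keep the left sides of the
    -- equations carried by edgeBit out of reach of the with-abstraction.
    edgeBit-<′ : ∀ (x : ⊤ → Fin N) (t : ⊤) y a c → T (toℕ (x t) <ᵇ toℕ y) → T (adj G (x t) y) →
      (∀ p q → ω (mkTriple (x tt) y p q a) ≡ c) → edgeBit ω a (x t) y ≡ c
    edgeBit-<′ x t y a c p q h
      with toℕ (x t) <ᵇ toℕ y
         | id {A = (toℕ (x tt) <ᵇ toℕ y) ≡ (toℕ (x t) <ᵇ toℕ y)} refl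
         | adj G (x t) y
         | id {A = adj G (x tt) y ≡ adj G (x t) y} refl
    ... | true | _ | true | _ = h _ _

    edgeBit->′ : ∀ (x : ⊤ → Fin N) (t : ⊤) y a c → T (toℕ y <ᵇ toℕ (x t)) → T (adj G y (x t)) →
      (∀ p q → ω (mkTriple y (x tt) p q a) ≡ c) → edgeBit ω a (x t) y ≡ c
    edgeBit->′ x t y a c p q h
      with toℕ (x t) <ᵇ toℕ y
         | id {A = (toℕ (x tt) <ᵇ toℕ y) ≡ (toℕ (x t) <ᵇ toℕ y)} refl
         | adj G (x t) y
         | id {A = adj G (x tt) y ≡ adj G (x t) y} refl
    ... | true | e | _ | _ = ⊥-elim (<ᵇ-asym (toℕ y) (toℕ (x tt)) p e)
    ... | false | _ | _ | _
      with toℕ y <ᵇ toℕ (x t)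
         | id {A = (toℕ y <ᵇ toℕ (x tt)) ≡ (toℕ y <ᵇ toℕ (x t))} refl
         | adj G y (x t)
         | id {A = adj G y (x tt) ≡ adj G y (x t)} refl
    ... | true | _ | true | _ = h _ _

  edgeBit-ij : ∀ t → edgeBit ω (w t) (i t) (j t) ≡ ω t
  edgeBit-ij (mkTriple x y p q a) = edgeBit-<′ (λ _ → x) tt y a _ p q
    (λ p q → cong₂ (λ p q → ω (mkTriple x y p q a)) (T-irrelevant _ _) (T-irrelevant _ _))

  edgeBit-ji : ∀ t → edgeBit ω (w t) (j t) (i t) ≡ ω t
  edgeBit-ji (mkTriple x y p q a) = edgeBit->′ (λ _ → y) tt x a _ p q
    (λ p q → cong₂ (λ p q → ω (mkTriple x y p q a)) (T-irrelevant _ _) (T-irrelevant _ _))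

  Spans : Apex → Triple → Fin N × Fin N → Set
  Spans a t (x , y) = w t ≡ a × ((i t ≡ x × j t ≡ y) ⊎ (i t ≡ y × j t ≡ x))

  back : Apex → Fin N → Fin N → Bool
  back a x y = not (arrow ω a x y)

  back-ij : ∀ t → back (w t) (i t) (j t) ≡ not (ω t)
  back-ij t = cong not (trans (if-true (T⇒≡ (lt t))) (edgeBit-ij t))

  back-ji : ∀ t → back (w t) (j t) (i t) ≡ ω t
  back-ji t = trans (cong not (if-false (<ᵇ-asym (toℕ (i t)) (toℕ (j t)) (lt t))))
    (trans (not-involutive _) (edgeBit-ji t))

  i≢j : ∀ t → i t ≢ j t
  i≢j t e = ℕₚ.<-irrefl (cong toℕ e) (ℕₚ.<ᵇ⇒< _ _ (lt t))

  toℕ-emb : ∀ x → toℕ (emb x) ≡ toℕ x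
  toℕ-emb x = trans (Finₚ.toℕ-inject₁ _) (Finₚ.toℕ-inject₁ x)

  emb-injective : ∀ {x y} → emb x ≡ emb y → x ≡ y
  emb-injective = Finₚ.inject₁-injective ∘ Finₚ.inject₁-injective

  toℕ-apexV-u : toℕ (apexV u) ≡ N
  toℕ-apexV-u = trans (Finₚ.toℕ-inject₁ _) (Finₚ.toℕ-fromℕ N)

  toℕ-apexV-v : toℕ (apexV v) ≡ suc N
  toℕ-apexV-v = Finₚ.toℕ-fromℕ (suc N)

  emb<N : ∀ x → toℕ (emb x) < N
  emb<N x = subst (Data.Nat._< N) (sym (toℕ-emb x)) (Finₚ.toℕ<n x)

  emb≢apexV : ∀ x a → emb x ≢ apexV a
  emb≢apexV x u e = ℕₚ.<-irrefl (trans (cong toℕ e) toℕ-apexV-u) (emb<N x)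
  emb≢apexV x v e = ℕₚ.<-irrefl (trans (cong toℕ e) toℕ-apexV-v) (ℕₚ.m<n⇒m<1+n (emb<N x))

  apexV-injective : ∀ {a b} → apexV a ≡ apexV b → a ≡ b
  apexV-injective {u} {u} e = refl
  apexV-injective {u} {v} e = ⊥-elim (ℕₚ.1+n≢n (trans (sym toℕ-apexV-v) (trans (cong toℕ (sym e)) toℕ-apexV-u)))
  apexV-injective {v} {u} e = ⊥-elim (ℕₚ.1+n≢n (trans (sym toℕ-apexV-v) (trans (cong toℕ e) toℕ-apexV-u)))
  apexV-injective {v} {v} e = refl

  vertex : ∀ (x : V) → (∃ λ k → x ≡ emb k) ⊎ (∃ λ a → x ≡ apexV a)
  vertex = go N {apexV} (λ { u → refl ; v → refl })
    where
    -- `N` is fixed by the module, so the induction runs over a copy of `apexV` for every `n`. The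
    -- function `f` lets the result be stated for the original.
    apex : ∀ n → Apex → Fin (suc (suc n))
    apex n u = inject₁ (fromℕ n)
    apex n v = fromℕ (suc n)
    go : ∀ n {f : Apex → Fin (suc (suc n))} → (∀ a → apex n a ≡ f a) → (x : Fin (suc (suc n))) →
      (∃ λ k → x ≡ inject₁ (inject₁ k)) ⊎ (∃ λ a → x ≡ f a)
    go zero e zero = inj₂ (u , e u)
    go zero e (suc zero) = inj₂ (v , e v)
    go (suc n) e zero = inj₁ (zero , refl)
    go (suc n) e (suc x) with go n {apex n} (λ _ → refl) x
    ... | inj₁ (k , refl) = inj₁ (suc k , refl)
    ... | inj₂ (u , refl) = inj₂ (u , e u)
    ... | inj₂ (v , refl) = inj₂ (v , e v)

  -- With these names the 3-cycle of `t` sends `src t` to `tgt t`, then to the apex and back,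
  -- whatever `ω t` is.
  src tgt : Triple → V
  src t = if ω t then emb (i t) else emb (j t)
  tgt t = if ω t then emb (j t) else emb (i t)

  perm≗cyc3 : ∀ t x → perm ω t x ≡ cyc3 (src t) (tgt t) (apexV (w t)) x
  perm≗cyc3 t x with ω t
  ... | true = refl
  ... | false = refl

  src≢tgt : ∀ t → src t ≢ tgt t
  src≢tgt t with ω t
  ... | true = i≢j t ∘ emb-injective
  ... | false = i≢j t ∘ sym ∘ emb-injective

  src≢apexV : ∀ t a → src t ≢ apexV a
  src≢apexV t a with ω t
  ... | true = emb≢apexV (i t) a
  ... | false = emb≢apexV (j t) a

  tgt≢apexV : ∀ t a → tgt t ≢ apexV a
  tgt≢apexV t a with ω t
  ... | true = emb≢apexV (j t) a
  ... | false = emb≢apexV (i t) a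

  perm-src : ∀ t → perm ω t (src t) ≡ tgt t
  perm-src t rewrite perm≗cyc3 t (src t) with src t ≟ src t
  ... | yes _ = refl
  ... | no p = ⊥-elim (p refl)

  perm-tgt : ∀ t → perm ω t (tgt t) ≡ apexV (w t)
  perm-tgt t rewrite perm≗cyc3 t (tgt t) with tgt t ≟ src t | tgt t ≟ tgt t
  ... | yes e | _ = ⊥-elim (src≢tgt t (sym e))
  ... | no _ | yes _ = refl
  ... | no _ | no p = ⊥-elim (p refl)

  perm-apex : ∀ t → perm ω t (apexV (w t)) ≡ src t
  perm-apex t rewrite perm≗cyc3 t (apexV (w t))
    with apexV (w t) ≟ src t | apexV (w t) ≟ tgt t | apexV (w t) ≟ apexV (w t)
  ... | yes e | _ | _ = ⊥-elim (src≢apexV t (w t) (sym e))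
  ... | no _ | yes e | _ = ⊥-elim (tgt≢apexV t (w t) (sym e))
  ... | no _ | no _ | yes _ = refl
  ... | no _ | no _ | no p = ⊥-elim (p refl)

  perm-fixed : ∀ t x → x ≢ src t → x ≢ tgt t → x ≢ apexV (w t) → perm ω t x ≡ x
  perm-fixed t x p q r rewrite perm≗cyc3 t x with x ≟ src t | x ≟ tgt t | x ≟ apexV (w t)
  ... | yes e | _ | _ = ⊥-elim (p e)
  ... | no _ | yes e | _ = ⊥-elim (q e)
  ... | no _ | no _ | yes e = ⊥-elim (r e)
  ... | no _ | no _ | no _ = refl

  src∈ : ∀ t → src t ∈ₜ t
  src∈ t with ω t
  ... | true = inj₁ refl
  ... | false = inj₂ (inj₁ refl)

  tgt∈ : ∀ t → tgt t ∈ₜ t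
  tgt∈ t with ω t
  ... | true = inj₂ (inj₁ refl)
  ... | false = inj₁ refl

  perm-closed : ∀ t x → (x ∈ₜ t × perm ω t x ∈ₜ t) ⊎ perm ω t x ≡ x
  perm-closed t x with x ≟ src t | x ≟ tgt t | x ≟ apexV (w t)
  ... | yes refl | _ | _ = inj₁ (src∈ t , subst (_∈ₜ t) (sym (perm-src t)) (tgt∈ t))
  ... | no _ | yes refl | _ = inj₁ (tgt∈ t , subst (_∈ₜ t) (sym (perm-tgt t)) (inj₂ (inj₂ refl)))
  ... | no _ | no _ | yes refl =
    inj₁ (inj₂ (inj₂ refl) , subst (_∈ₜ t) (sym (perm-apex t)) (src∈ t))
  ... | no p | no q | no r = inj₂ (perm-fixed t x p q r)

  perm-outside : ∀ t x → ¬ (x ∈ₜ t) → perm ω t x ≡ x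
  perm-outside t x x∉ with perm-closed t x
  ... | inj₁ (x∈ , _) = ⊥-elim (x∉ x∈)
  ... | inj₂ e = e

  Disjointₜ : Triple → Triple → Set
  Disjointₜ t s = ∀ x → x ∈ₜ t → x ∈ₜ s → ⊥

  Commute : Triple → Triple → Set
  Commute t s = ∀ x → perm ω t (perm ω s x) ≡ perm ω s (perm ω t x)

  disjoint-commute : ∀ t s → Disjointₜ t s → Commute t s
  disjoint-commute t s disj x with perm-closed t x | perm-closed s x
  ... | inj₁ (x∈t , _) | inj₁ (x∈s , _) = ⊥-elim (disj x x∈t x∈s)
  ... | inj₁ (x∈t , tx∈t) | inj₂ sx =
    trans (cong (perm ω t) sx) (sym (perm-outside s _ (disj _ tx∈t)))
  ... | inj₂ tx | inj₁ (x∈s , sx∈s) =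
    trans (perm-outside t _ (λ p → disj _ p sx∈s)) (cong (perm ω s) (sym tx))
  ... | inj₂ tx | inj₂ sx =
    trans (cong (perm ω t) sx) (trans tx (trans (sym sx) (cong (perm ω s) (sym tx))))

  orient : List Triple → List V
  orient [] = []
  orient (t ∷ ts) = src t ∷ tgt t ∷ orient ts

  -- Triples are exchanged as blocks of two letters, so no reordering costs a sign.
  orient-↭ : ∀ {ts ss} → ts ↭ ss → orient ts ~[ false ] orient ss
  orient-↭ refl = ~refl
  orient-↭ (prep t p) = ~prep _ (~prep _ (orient-↭ p))
  orient-↭ (swap {xs = ts} t s p) =
    ~trans (~shifts (src t ∷ tgt t ∷ []) (src s ∷ tgt s ∷ []) (orient ts))
      (~prep _ (~prep _ (~prep _ (~prep _ (orient-↭ p)))))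
  orient-↭ (_↭_.trans p q) = ~trans (orient-↭ p) (orient-↭ q)

  odd-orient : ∀ ts → odd (length (orient ts)) ≡ false
  odd-orient [] = refl
  odd-orient (t ∷ ts) = trans (not-involutive _) (odd-orient ts)

  backs : Apex → List (Fin N × Fin N) → Bool
  backs a [] = false
  backs a ((x , y) ∷ es) = back a x y xor backs a es

  orient-span : ∀ {a t x y zs} → Spans a t (x , y) →
    (src t ∷ tgt t ∷ zs) ~[ back a x y ] (emb x ∷ emb y ∷ zs)
  orient-span {t = t} {zs = zs} (refl , inj₁ (refl , refl)) = ~cast (sym (back-ij t)) lem
    where
    lem : (src t ∷ tgt t ∷ zs) ~[ not (ω t) ] (emb (i t) ∷ emb (j t) ∷ zs)
    lem with ω t
    ... | true = ~refl
    ... | false = ~swap _ _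
  orient-span {t = t} {zs = zs} (refl , inj₂ (refl , refl)) = ~cast (sym (back-ji t)) lem
    where
    lem : (src t ∷ tgt t ∷ zs) ~[ ω t ] (emb (j t) ∷ emb (i t) ∷ zs)
    lem with ω t
    ... | true = ~swap _ _
    ... | false = ~refl

  orient-spans : ∀ {a ts es} → Pointwise (Spans a) ts es →
    orient ts ~[ backs a es ] map emb (flat es)
  orient-spans [] = ~refl
  orient-spans {a} {_} {(x , y) ∷ es} (p ∷ ps) =
    ~trans (orient-span p) (~prep _ (~prep _ (orient-spans ps)))

  -- The head of the list is the outermost factor of `prod`, so `cycle-extend` puts its two letters
  -- at the end. Hence this is the word of the cycle, without its apex, in reversed list order.
  star : List Triple → List V
  star [] = []
  star (t ∷ ts) = star ts ++ src t ∷ tgt t ∷ []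

  star~orient : ∀ ts → star ts ~[ false ] orient ts
  star~orient [] = ~refl
  star~orient (t ∷ ts) =
    ~trans (~cast (∧-comm (odd (length (star ts))) false) (~comm (star ts) (src t ∷ tgt t ∷ [])))
      (~prep _ (~prep _ (star~orient ts)))

  star-cycle : ∀ {a} ts → All (λ t → w t ≡ a) ts → Unique (apexV a ∷ star ts) →
    Cycle (prod ω ts) (apexV a) (star ts)
  star-cycle [] [] _ = mkCycle refl (λ _ _ → refl)
  star-cycle (t ∷ ts) (refl ∷ ps) uniq =
    cycle-extend (perm ω t) uniq (perm-apex t) (perm-src t) (perm-tgt t) (perm-fixed t)
      (star-cycle ts ps (Unique-++ˡ (_ ∷ star ts) uniq))

  star-reorder : ∀ {a ts t ts′ x y} → ts ↭ t ∷ ts′ → Spans a t (y , x) →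
    (apexV a ∷ star ts) ~[ back a y x ] (emb y ∷ emb x ∷ apexV a ∷ orient ts′)
  star-reorder {a} {ts} {t} {ts′} ts↭ sp =
    ~trans (~prep _ (~trans (star~orient ts) (orient-↭ ts↭)))
      (~trans (~shift (apexV a) (src t ∷ tgt t ∷ []) (orient ts′)) (orient-span sp))

  -- Restarts the cycle of a star at `y`, where it is going to meet the other star. The word
  -- consists of the apex and pairs, so its length is odd and the rotation is free.
  star-cycle-from : ∀ {a ts t ts′ x y} → All (λ t → w t ≡ a) ts → Unique (apexV a ∷ orient ts) →
    ts ↭ t ∷ ts′ → Spans a t (y , x) →
    ∃ λ R → Cycle (prod ω ts) (emb y) R ×
            (emb y ∷ R) ~[ back a y x ] (emb y ∷ emb x ∷ apexV a ∷ orient ts′)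
  star-cycle-from {a} {ts} {t} {ts′} {x} {y} ps uniq ts↭ sp =
    let (R , c , p) = cycle-from odd-star
          (star-cycle ts ps (Unique-resp-↭ (↭-sym (~⇒↭ (~prep (apexV a) (star~orient ts)))) uniq))
          (∈-resp-↭ (↭-sym (~⇒↭ (star-reorder ts↭ sp))) (here refl))
    in R , c , ~trans p (star-reorder ts↭ sp)
    where
    odd-star : not (odd (length (star ts))) ≡ true
    odd-star = cong not (trans (cong odd (↭-length (~⇒↭ (star~orient ts)))) (odd-orient ts))

-- The sign of a tree as the parity of one word

module SignFormula {N : ℕ} (G : Graph N) (ω : Susp.Orientation G) where
  open Susp G
  open Sign G ω

  _≟ₜ_ : (t s : Triple) → Dec (t ≡ s)
  mkTriple x y p q a ≟ₜ mkTriple x′ y′ p′ q′ a′ with x ≟ x′ | y ≟ y′ | a ≟ₐ a′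
  ... | yes refl | yes refl | yes refl =
    yes (cong₂ (λ p q → mkTriple x y p q a) (T-irrelevant p p′) (T-irrelevant q q′))
  ... | no ¬e | _ | _ = no λ { refl → ¬e refl }
  ... | yes _ | no ¬e | _ = no λ { refl → ¬e refl }
  ... | yes _ | yes _ | no ¬e = no λ { refl → ¬e refl }

  _at_ : List Triple → Apex → List Triple
  ts at a = filter (λ t → w t ≟ₐ a) ts

  at-apex : ∀ a ts → All (λ t → w t ≡ a) (ts at a)
  at-apex a ts = Allₚ.all-filter (λ t → w t ≟ₐ a) ts

  -- With `t` ahead of `s` in the list, these are just the commutations that allow the triples at
  -- `a` to be collected in front of all others.
  Before : Apex → Triple → Triple → Set
  Before a t s = w t ≢ a → w s ≡ a → Commute t s

  prod-commute : ∀ t ts → All (Commute t) ts → ∀ x →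
    perm ω t (prod ω ts x) ≡ prod ω ts (perm ω t x)
  prod-commute t [] [] x = refl
  prod-commute t (s ∷ ts) (c ∷ cs) x =
    trans (c (prod ω ts x)) (cong (perm ω s) (prod-commute t ts cs x))

  prod-split : ∀ a ts → AllPairs (Before a) ts → ∀ x →
    prod ω ts x ≡ prod ω (ts at a) (prod ω (ts at other a) x)
  prod-split a [] [] x = refl
  prod-split a (t ∷ ts) (p ∷ ps) x with w t ≟ₐ a | w t ≟ₐ other a
  ... | yes refl | yes e = ⊥-elim (≢other (w t) e)
  ... | yes e | no _ = cong (perm ω t) (prod-split a ts ps x)
  ... | no ¬e | no ¬e′ = ⊥-elim (¬e′ (≢⇒other ¬e))
  ... | no ¬e | yes _ =
    trans (cong (perm ω t) (prod-split a ts ps x)) (prod-commute t (ts at a) commutes _)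
    where
    commutes : All (Commute t) (ts at a)
    commutes = All.tabulate λ s∈ →
      let s∈ts , ws = ∈-filter⁻ (λ t → w t ≟ₐ a) {xs = ts} s∈ in All.lookup p s∈ts ¬e ws

  pairs-of-all : ∀ {A : Set} {R : A → A → Set} ts → (∀ {t s} → t ∈ ts → s ∈ ts → R t s) → AllPairs R ts
  pairs-of-all [] r = []
  pairs-of-all (t ∷ ts) r =
    All.tabulate (λ s∈ → r (here refl) (there s∈)) ∷ pairs-of-all ts (λ p q → r (there p) (there q))

  -- Only one pair of triples fails to commute, and it occurs in one of the two orders.
  before-either : ∀ ts {t₁ t₂} → Unique ts → w t₁ ≡ u → w t₂ ≡ v →
    (∀ {t s} → t ∈ ts → s ∈ ts → w t ≡ u → w s ≡ v → ¬ (t ≡ t₁ × s ≡ t₂) → Commute t s) →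
    AllPairs (Before u) ts ⊎ AllPairs (Before v) ts
  before-either [] _ _ _ _ = inj₁ []
  before-either (t ∷ ts) {t₁} {t₂} uniq@(_ ∷ uniq′) e₁ e₂ comm with t ≟ₜ t₁ | t ≟ₜ t₂
  ... | yes refl | _ = inj₁ (All.tabulate (λ _ ne → ⊥-elim (ne e₁)) ∷ pairs-of-all ts λ t∈ s∈ ne e x →
          sym (comm (there s∈) (there t∈) e (≢⇒other ne)
            (λ { (refl , _) → Unique[x∷xs]⇒x∉xs uniq s∈ }) x))
  ... | no _ | yes refl = inj₂ (All.tabulate (λ _ ne → ⊥-elim (ne e₂)) ∷ pairs-of-all ts λ t∈ s∈ ne e →
          comm (there t∈) (there s∈) (≢⇒other ne) e (λ { (_ , refl) → Unique[x∷xs]⇒x∉xs uniq s∈ }))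
  ... | no ne₁ | no ne₂ with before-either ts uniq′ e₁ e₂ (λ t∈ s∈ → comm (there t∈) (there s∈))
  ... | inj₁ ps = inj₁ (All.tabulate (λ s∈ ne e x →
          sym (comm (there s∈) (here refl) e (≢⇒other ne) (λ { (_ , e′) → ne₂ e′ }) x)) ∷ ps)
  ... | inj₂ ps = inj₂ (All.tabulate (λ s∈ ne e →
          comm (here refl) (there s∈) (≢⇒other ne) e (λ { (e′ , _) → ne₁ e′ })) ∷ ps)

  iter-suc : ∀ (f : V → V) k x → iter f k (f x) ≡ f (iter f k x)
  iter-suc f zero x = refl
  iter-suc f (suc k) x = cong f (iter-suc f k x)

  chain-iter : ∀ {f x xs y} m → length xs ≡ m → Chain f x xs y →
    tabulate {n = suc m} (λ k → iter f (toℕ k) x) ≡ x ∷ xs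
  chain-iter {xs = []} zero refl p = refl
  chain-iter {f} {x} {y ∷ xs} (suc m) e (refl , ps) = cong (x ∷_)
    (trans (tabulate-cong (λ k → sym (iter-suc f (toℕ k) x))) (chain-iter m (ℕₚ.suc-injective e) ps))

  -- Since V has odd cardinality, the word of a cycle may start anywhere.
  sign-cycle : ∀ {ts x xs} → Cycle (prod ω ts) x xs → length (x ∷ xs) ≡ suc (suc N) →
    odd N ≡ true → Unique (x ∷ xs) → zero ∈ x ∷ xs → sign ω ts ≡ bit (inv (x ∷ xs))
  sign-cycle {ts} {x} {xs} c len odd-N uniq z∈ =
    let R , c′ , p = cycle-from (trans (cong odd len) (trans (not-involutive _) odd-N)) c z∈ in
    trans (%2-odd (inversions (cycleSeq (prod ω ts))))
      (cong bit (trans (odd-inversions (cycleSeq (prod ω ts)))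
        (trans (cong inv (chain-iter (suc N) (ℕₚ.suc-injective (trans (↭-length (~⇒↭ p)) len)) (chain c′)))
          (inv-~ uniq (~sym p)))))

  Covering : Fin N → Fin N → Fin N → List (Fin N × Fin N) → List (Fin N × Fin N) → Set
  Covering x y z us vs = y ∷ x ∷ z ∷ flat us ++ flat vs ↭ allFin N

  -- Splicing the cycle of the v-star into that of the u-star at y gives the word
  -- y z v … x u …, up to the orientations; val moves u and v to its end.
  val : Fin N → Fin N → Fin N → List (Fin N × Fin N) → List (Fin N × Fin N) → Bool
  val x y z us vs = inv (y ∷ x ∷ z ∷ flat us ++ flat vs) xor
    (back u y x xor (back v y z xor (backs u us xor backs v vs)))

  -- The path x y z carries u on xy and v on yz; otherwise exchange x and z.
  record Tree (Ts : List Triple) (x y z : Fin N) (us vs : List (Fin N × Fin N)) : Set where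
    field
      uniqueₜ  : Unique Ts
      tx tz    : Triple
      Us Vs    : List Triple
      u-star   : Ts at u ↭ tx ∷ Us
      v-star   : Ts at v ↭ tz ∷ Vs
      tx-spans : Spans u tx (y , x)
      tz-spans : Spans v tz (y , z)
      Us-span  : Pointwise (Spans u) Us us
      Vs-span  : Pointwise (Spans v) Vs vs
      covering : Covering x y z us vs

  <ᵇ-false : ∀ {m n} → m ≤ n → (n <ᵇ m) ≡ false
  <ᵇ-false {m} {n} m≤n with n <ᵇ m in e
  ... | true = ⊥-elim (ℕₚ.<⇒≱ (ℕₚ.<ᵇ⇒< n m (subst T (sym e) tt)) m≤n)
  ... | false = refl

  spread : List (Fin N) → List V
  spread L = map emb L ++ apexV u ∷ apexV v ∷ []

  -- The prescribed order enters here: `u` and `v` lie above all vertices of `G` and stand at the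
  -- end in increasing order, so they take part in no inversion.
  inv-spread : ∀ L → inv (spread L) ≡ inv L
  inv-spread L = trans (cong inv (sym (++-assoc (map emb L) (apexV u ∷ []) (apexV v ∷ []))))
    (trans (inv-max (map emb L ++ apexV u ∷ []) (apexV v)
               (Allₚ.++⁺ (below v (λ {m} p → subst (m ≤_) (sym toℕ-apexV-v) (ℕₚ.m≤n⇒m≤1+n p)))
                 (<ᵇ-false (ℕₚ.≤-trans (ℕₚ.≤-reflexive toℕ-apexV-u)
                   (ℕₚ.≤-trans (ℕₚ.n≤1+n N) (ℕₚ.≤-reflexive (sym toℕ-apexV-v)))) ∷ [])))
      (trans (inv-max (map emb L) (apexV u) (below u (λ {m} → subst (m ≤_) (sym toℕ-apexV-u))))
        (inv-map emb (λ x y → cong₂ _<ᵇ_ (toℕ-emb x) (toℕ-emb y)) L)))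
    where
    below : ∀ a → (∀ {m} → m ≤ N → m ≤ toℕ (apexV a)) →
      All (λ x → (toℕ (apexV a) <ᵇ toℕ x) ≡ false) (map emb L)
    below a h = Allₚ.map⁺ (All.tabulate (λ {x} _ → <ᵇ-false (h (ℕₚ.<⇒≤ (emb<N x)))))

  u≢v : u ≢ v
  u≢v ()

  unique-spread : ∀ {L} → Unique L → Unique (spread L)
  unique-spread {L} uniq = Uniqueₚ.++⁺ (Uniqueₚ.map⁺ emb-injective uniq)
    (((u≢v ∘ apexV-injective) ∷ []) ∷ [] ∷ [])
    (λ { (p , here refl) → let x , _ , e = ∈-map⁻ emb p in emb≢apexV x u (sym e)
       ; (p , there (here refl)) → let x , _ , e = ∈-map⁻ emb p in emb≢apexV x v (sym e) })

  ∈-spread : ∀ {L} → (∀ x → x ∈ L) → ∀ x → x ∈ spread L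
  ∈-spread {L} all x with vertex x
  ... | inj₁ (k , refl) = ∈-++⁺ˡ (∈-map⁺ emb (all k))
  ... | inj₂ (u , refl) = ∈-++⁺ʳ (map emb L) (here refl)
  ... | inj₂ (v , refl) = ∈-++⁺ʳ (map emb L) (there (here refl))

  odd-map-flat : ∀ (es : List (Fin N × Fin N)) → odd (length (map emb (flat es))) ≡ false
  odd-map-flat es = trans (cong odd (length-map emb (flat es))) (odd-flat es)

  -- Every move passes a block of even length or shifts one, except the exchange of the two apices.
  -- In the spliced word `v` comes before `u`, and this single odd step is the origin of the `not`
  -- in `sign-tree`.
  splice-~ : ∀ (y x z cu cv : V) EU EV → odd (length EU) ≡ false → odd (length EV) ≡ false →
    (y ∷ z ∷ cv ∷ EV ++ x ∷ cu ∷ EU) ~[ true ] (y ∷ x ∷ z ∷ EU ++ EV ++ cu ∷ cv ∷ [])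
  splice-~ y x z cu cv EU EV even-U even-V =
    ~cast (lem (odd (length EU)) (odd (length EV)) even-U even-V)
      (~prep y (~trans (~sym (~shift x (z ∷ cv ∷ EV) (cu ∷ EU)))
        (~prep x (~prep z (~trans (~shift cv EV (cu ∷ EU))
          (~trans (~++ˡ EV (~swap cv cu))
            (~trans (~++ˡ EV (~comm (cu ∷ cv ∷ []) EU)) (~shifts EV EU _))))))))
    where
    lem : ∀ a b → a ≡ false → b ≡ false →
      not (not b) xor (b xor (true xor (false xor (b ∧ a)))) ≡ true
    lem false false refl refl = refl

  apex∈ : ∀ t a → apexV a ∈ₜ t → w t ≡ a
  apex∈ t a (inj₁ e) = ⊥-elim (emb≢apexV _ a (sym e))
  apex∈ t a (inj₂ (inj₁ e)) = ⊥-elim (emb≢apexV _ a (sym e))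
  apex∈ t a (inj₂ (inj₂ e)) = sym (apexV-injective e)

  in-star : ∀ {a ts t es x} → Pointwise (Spans a) ts es → t ∈ ts → emb x ∈ₜ t → x ∈ flat es
  in-star ((_ , inj₁ (refl , refl)) ∷ _) (here refl) (inj₁ e) = here (emb-injective e)
  in-star ((_ , inj₁ (refl , refl)) ∷ _) (here refl) (inj₂ (inj₁ e)) = there (here (emb-injective e))
  in-star ((_ , inj₂ (refl , refl)) ∷ _) (here refl) (inj₁ e) = there (here (emb-injective e))
  in-star ((_ , inj₂ (refl , refl)) ∷ _) (here refl) (inj₂ (inj₁ e)) = here (emb-injective e)
  in-star {t = t} (_ ∷ _) (here refl) (inj₂ (inj₂ e)) = ⊥-elim (emb≢apexV _ (w t) e)
  in-star (_ ∷ ps) (there t∈) x∈ = there (there (in-star ps t∈ x∈))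

  module _ {Ts x y z us vs} (T : Tree Ts x y z us vs) where
    open Tree T

    L : List (Fin N)
    L = y ∷ x ∷ z ∷ flat us ++ flat vs
    EU = map emb (flat us)
    EV = map emb (flat vs)
    bu = back u y x
    bv = back v y z
    bU = backs u us
    bV = backs v vs

    unique-L : Unique L
    unique-L = Unique-resp-↭ (↭-sym covering) (Uniqueₚ.allFin⁺ N)

    spread-L : spread L ≡ emb y ∷ emb x ∷ emb z ∷ EU ++ EV ++ apexV u ∷ apexV v ∷ []
    spread-L = cong (λ l → emb y ∷ emb x ∷ emb z ∷ l)
      (trans (cong (_++ _) (map-++ emb (flat us) (flat vs))) (++-assoc EU EV _))

    word-U : (apexV u ∷ orient (Ts at u)) ~[ bu xor bU ] (emb y ∷ emb x ∷ apexV u ∷ EU)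
    word-U = ~trans (~trans (~prep (apexV u) (orient-↭ u-star))
        (~trans (~shift (apexV u) (src tx ∷ tgt tx ∷ []) (orient Us)) (orient-span tx-spans)))
      (~prep _ (~prep _ (~prep _ (orient-spans Us-span))))

    word-V : (apexV v ∷ orient (Ts at v)) ~[ bv xor bV ] (emb y ∷ emb z ∷ apexV v ∷ EV)
    word-V = ~trans (~trans (~prep (apexV v) (orient-↭ v-star))
        (~trans (~shift (apexV v) (src tz ∷ tgt tz ∷ []) (orient Vs)) (orient-span tz-spans)))
      (~prep _ (~prep _ (~prep _ (orient-spans Vs-span))))

    -- Distinctness is known from `covering` for the full word; the two star words inherit it as
    -- parts of this rearrangement.
    unique-splice : Unique (emb y ∷ emb z ∷ apexV v ∷ EV ++ emb x ∷ apexV u ∷ EU)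
    unique-splice = Unique-resp-↭
      (~⇒↭ (~sym (splice-~ _ _ _ _ _ EU EV (odd-map-flat us) (odd-map-flat vs))))
      (subst Unique spread-L (unique-spread unique-L))

    unique-U : Unique (apexV u ∷ orient (Ts at u))
    unique-U = Unique-resp-↭ (~⇒↭ (~sym word-U)) (Unique-++ˡ (emb y ∷ emb x ∷ apexV u ∷ EU)
      (Unique-resp-↭ (prep (emb y) (++-comm (emb z ∷ apexV v ∷ EV) (emb x ∷ apexV u ∷ EU))) unique-splice))

    unique-V : Unique (apexV v ∷ orient (Ts at v))
    unique-V = Unique-resp-↭ (~⇒↭ (~sym word-V)) (Unique-++ˡ (emb y ∷ emb z ∷ apexV v ∷ EV) unique-splice)

    -- `y` is the first letter of both star words. It is moved behind `RV` to rewrite the u-part and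
    -- back to the front to rewrite the v-part; the two costs cancel whatever the length of `RV` is.
    splice : ∀ {RU RV} → (emb y ∷ RU) ~[ bu ] (emb y ∷ emb x ∷ apexV u ∷ orient Us) →
      (emb y ∷ RV) ~[ bv ] (emb y ∷ emb z ∷ apexV v ∷ orient Vs) →
      (emb y ∷ RV ++ RU) ~[ not (bu xor (bv xor (bU xor bV))) ] spread L
    splice {RU} {RV} pU pV = ~cast parity
      (~trans (~shift (emb y) RV RU)
      (~trans (~++ˡ RV (~trans pU (~prep _ (~prep _ (~prep _ (orient-spans Us-span))))))
      (~trans (~sym (~shift (emb y) RV _))
      (~trans (~++ʳ _ (~trans pV (~prep _ (~prep _ (~prep _ (orient-spans Vs-span))))))
      (~trans (splice-~ _ _ _ _ _ EU EV (odd-map-flat us) (odd-map-flat vs))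
        (~reflexive (sym spread-L)))))))
      where
      open xor-∧-Solver
      parity : odd (length RV) xor ((bu xor bU) xor (odd (length RV) xor ((bv xor bV) xor true))) ≡
        not (bu xor (bv xor (bU xor bV)))
      parity = solve 5 (λ r a b c d → r :+ ((a :+ c) :+ (r :+ ((b :+ d) :+ con true))) :=
        con true :+ (a :+ (b :+ (c :+ d)))) refl (odd (length RV)) bu bv bU bV

    odd-N : odd N ≡ true
    odd-N = trans (cong odd (trans (sym (length-tabulate {n = N} id)) (sym (↭-length covering))))
      (cong not (trans (not-involutive _) (trans (cong odd (length-++ (flat us)))
        (trans (odd-+ (length (flat us)) _) (cong₂ _xor_ (odd-flat us) (odd-flat vs))))))

    length-spread : length (spread L) ≡ suc (suc N)
    length-spread = trans (length-++ (map emb L)) (trans (ℕₚ.+-comm _ 2)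
      (cong (2 +_) (trans (length-map emb L) (trans (↭-length covering) (length-tabulate id)))))

    sign-word : ∀ {R} → Cycle (prod ω Ts) (emb y) R →
      (emb y ∷ R) ~[ not (bu xor (bv xor (bU xor bV))) ] spread L →
      sign ω Ts ≡ bit (not (val x y z us vs))
    sign-word c p = trans
      (sign-cycle {Ts} c (trans (↭-length (~⇒↭ p)) length-spread) odd-N
        (Unique-resp-↭ (↭-sym (~⇒↭ p)) (unique-spread unique-L))
        (∈-resp-↭ (↭-sym (~⇒↭ p)) (∈-spread (λ k → ∈-resp-↭ (↭-sym covering) (∈-allFin k)) zero)))
      (cong bit (trans (inv-~ (unique-spread unique-L) (~sym p))
        (trans (cong (not (bu xor (bv xor (bU xor bV))) xor_) (inv-spread L))
          (solve 2 (λ a b → (con true :+ a) :+ b := con true :+ (b :+ a)) refl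
            (bu xor (bv xor (bU xor bV))) (inv L)))))
      where open xor-∧-Solver

    us∌ : ∀ {k} → k ∈ flat us → k ∉ y ∷ z ∷ flat vs
    us∌ p (here refl) = Unique[x∷xs]⇒x∉xs unique-L (there (there (∈-++⁺ˡ p)))
    us∌ p (there (here refl)) = Unique[x∷xs]⇒x∉xs (AllPairs.tail (AllPairs.tail unique-L)) (∈-++⁺ˡ p)
    us∌ p (there (there q)) =
      ++-disjoint (flat us) (AllPairs.tail (AllPairs.tail (AllPairs.tail unique-L))) p q

    meet : ∀ {t s k} → t ∈ Ts → s ∈ Ts → w t ≡ u → w s ≡ v → emb k ∈ₜ t → emb k ∈ₜ s →
      t ≡ tx × s ≡ tz
    meet {t} {s} {k} t∈ s∈ wt ws k∈t k∈s
      with ∈-resp-↭ u-star (∈-filter⁺ (λ t → w t ≟ₐ u) t∈ wt)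
         | ∈-resp-↭ v-star (∈-filter⁺ (λ t → w t ≟ₐ v) s∈ ws)
    ... | here refl | here refl = refl , refl
    ... | here refl | there q = ⊥-elim (++-disjoint (y ∷ x ∷ z ∷ flat us) unique-L
            (∈-++⁺ˡ (in-star {ts = tx ∷ []} (tx-spans ∷ []) (here refl) k∈t)) (in-star Vs-span q k∈s))
    ... | there p | q = ⊥-elim (us∌ (in-star Us-span p k∈t) (in-star (tz-spans ∷ Vs-span) q k∈s))

    commutes : ∀ {t s} → t ∈ Ts → s ∈ Ts → w t ≡ u → w s ≡ v → ¬ (t ≡ tx × s ≡ tz) → Commute t s
    commutes {t} {s} t∈ s∈ wt ws ne = disjoint-commute t s disjoint
      where
      disjoint : Disjointₜ t s
      disjoint k k∈t k∈s with vertex k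
      ... | inj₁ (k , refl) = ne (meet t∈ s∈ wt ws k∈t k∈s)
      ... | inj₂ (a , refl) =
        u≢v (trans (sym wt) (trans (apex∈ t a k∈t) (trans (sym (apex∈ s a k∈s)) ws)))

  -- The order of `Ts` decides only which star product is the outer factor. Either way the two
  -- cycles are spliced at `y`, the inner one first, and the two words differ by exchanging blocks
  -- of which `RU` has even length.
  sign-tree : ∀ {Ts x y z us vs} → Tree Ts x y z us vs → sign ω Ts ≡ bit (not (val x y z us vs))
  sign-tree {Ts} {x} {y} {z} {us} {vs} T
    with before-either Ts uniqueₜ (proj₁ tx-spans) (proj₁ tz-spans) (commutes T)
       | star-cycle-from (at-apex u Ts) (unique-U T) u-star tx-spans
       | star-cycle-from (at-apex v Ts) (unique-V T) v-star tz-spans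
    where open Tree T
  -- `p` compares the word with one that has at least two letters after `y`, so the block is
  -- nonempty, as the form of `cycle-merge` requires.
  ... | _ | [] , _ , p | _ = ⊥-elim (0≢ (↭-length (~⇒↭ p)))
    where
    0≢ : ∀ {n} → 1 ≡ suc (suc n) → ⊥
    0≢ ()
  ... | _ | _ | [] , _ , q = ⊥-elim (0≢ (↭-length (~⇒↭ q)))
    where
    0≢ : ∀ {n} → 1 ≡ suc (suc n) → ⊥
    0≢ ()
  ... | inj₁ ps | a ∷ RU , cU , p | RV@(_ ∷ _) , cV , q = sign-word T
    (cycle-cong (λ x → sym (prod-split u Ts ps x)) (cycle-merge unique-W cU cV)) (splice T p q)
    where
    unique-W : Unique (emb y ∷ RV ++ a ∷ RU)
    unique-W = Unique-resp-↭ (↭-sym (~⇒↭ (splice T p q))) (unique-spread (unique-L T))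
  ... | inj₂ ps | RU@(_ ∷ _) , cU , p | b ∷ RV , cV , q = sign-word T
    (cycle-cong (λ x → sym (prod-split v Ts ps x)) (cycle-merge unique-W cV cU)) word
    where
    word : (emb y ∷ RU ++ b ∷ RV) ~[ not (back u y x xor (back v y z xor (backs u us xor backs v vs))) ]
             spread (L T)
    word = ~cast (even-comm (odd-rest p)) (~trans (~prep (emb y) (~comm RU (b ∷ RV))) (splice T p q))
      where
      even-comm : ∀ {a b c} → a ≡ false → (a ∧ b) xor c ≡ c
      even-comm refl = refl
      odd-rest : ∀ {R c e d} → (emb y ∷ R) ~[ d ] (emb y ∷ e ∷ c ∷ orient (Tree.Us T)) → odd (length R) ≡ false
      odd-rest p = trans (cong odd (ℕₚ.suc-injective (↭-length (~⇒↭ p))))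
        (trans (not-involutive _) (odd-orient (Tree.Us T)))
    unique-W : Unique (emb y ∷ RU ++ b ∷ RV)
    unique-W = Unique-resp-↭ (↭-sym (~⇒↭ word)) (unique-spread (unique-L T))

csuc≢ : ∀ {m} (k : Fin (suc (suc m))) → csuc k ≢ k
csuc≢ zero ()
csuc≢ {m} (suc k) e with csuc k in f
csuc≢ {suc m} (suc k) e | suc j = csuc≢ k (trans f (Finₚ.suc-injective e))
csuc≢ {zero} (suc zero) e | suc ()

lookup-injective : ∀ {A : Set} {xs : List A} → Unique xs → ∀ {k l} → lookup xs k ≡ lookup xs l → k ≡ l
lookup-injective (_ ∷ _) {zero} {zero} e = refl
lookup-injective {xs = _ ∷ xs} (p ∷ _) {zero} {suc l} e = ⊥-elim (All.lookup p (∈-lookup {xs = xs} l) e)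
lookup-injective {xs = _ ∷ xs} (p ∷ _) {suc k} {zero} e = ⊥-elim (All.lookup p (∈-lookup {xs = xs} k) (sym e))
lookup-injective (_ ∷ uniq) {suc k} {suc l} e = cong suc (lookup-injective uniq e)

unique-set-↭ : ∀ {A : Set} {xs ys : List A} → Unique xs → Unique ys →
  (∀ {x} → x ∈ xs → x ∈ ys) → (∀ {x} → x ∈ ys → x ∈ xs) → xs ↭ ys
unique-set-↭ p q f g = ∼bag⇒↭ (unique∧set⇒bag p q (mk⇔ f g))

-- Matchings as lists of pairs

flat-++ : ∀ {A : Set} (xs ys : List (A × A)) → flat (xs ++ ys) ≡ flat xs ++ flat ys
flat-++ [] ys = refl
flat-++ ((a , b) ∷ xs) ys = cong (λ l → a ∷ b ∷ l) (flat-++ xs ys)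

unflat : ∀ {A : Set} k (xs : List A) → length xs ≡ k + k → ∃ λ es → flat es ≡ xs
unflat zero [] refl = [] , refl
unflat (suc k) (a ∷ []) e rewrite ℕₚ.+-suc k k with e
... | ()
unflat (suc k) (a ∷ b ∷ xs) e rewrite ℕₚ.+-suc k k
  with unflat k xs (ℕₚ.suc-injective (ℕₚ.suc-injective e))
... | es , refl = (a , b) ∷ es , refl

links : ∀ {A : Set} → A → List A → A → List (A × A)
links x [] z = (x , z) ∷ []
links x (y ∷ ys) z = (x , y) ∷ links y ys z

-- If es are the alternate edges (c₀,c₁), (c₂,c₃), … of a closed walk c, with (c₀,c₁) removed, then
-- rematch c₁ es c₀ are the other edges (c₁,c₂), (c₃,c₄), …
rematch : ∀ {A : Set} → A → List (A × A) → A → List (A × A)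
rematch x [] z = (x , z) ∷ []
rematch x ((a , b) ∷ es) z = (x , a) ∷ rematch b es z

flat-rematch : ∀ {A : Set} (x : A) es z → flat (rematch x es z) ≡ x ∷ flat es ++ z ∷ []
flat-rematch x [] z = refl
flat-rematch x ((a , b) ∷ es) z = cong (λ l → x ∷ a ∷ l) (flat-rematch b es z)

-- Read along the cycle, its other edges give the same word rotated by one letter. The word has even
-- length, so this rotation is odd; it is the sign for which (a) has to compensate.
rematch-~ : ∀ {A : Set} (x y : A) es → flat ((x , y) ∷ es) ~[ true ] flat (rematch y es x)
rematch-~ x y es =
  ~cast (trans (xor-identityʳ _) (cong not (odd-flat es)))
    (~trans (~reflexive (cong (λ l → x ∷ y ∷ l) (sym (++-identityʳ (flat es)))))
      (~trans (~shift x (y ∷ flat es) []) (~reflexive (sym (flat-rematch y es x)))))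

links-↭ : ∀ {A : Set} (x : A) es z → links x (flat es) z ↭ es ++ rematch x es z
links-↭ x [] z = ↭-refl
links-↭ x ((a , b) ∷ es) z = ↭-trans (swap _ _ (links-↭ b es z)) (prep (a , b) (~⇒↭ (~shift (x , a) es _)))

module _ {A : Set} where

  private
    -- `csuc` wraps around to index zero, and `next e g` reads `e` there. This frees the end of the
    -- walk from its start, so that induction on the length applies.
    next : ∀ {m} → A → (Fin (suc m) → A) → Fin (suc m) → A
    next e g zero = e
    next e g (suc k) = g (suc k)

    next-csuc : ∀ {m} e (g : Fin (suc (suc m)) → A) k → next e g (csuc (suc k)) ≡ next e (g ∘ suc) (csuc k)
    next-csuc e g k with csuc k
    ... | zero = refl
    ... | suc _ = refl

    next-self : ∀ {m} (g : Fin (suc m) → A) k → next (g zero) g k ≡ g k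
    next-self g zero = refl
    next-self g (suc k) = refl

    tabulate-next : ∀ {m} e (g : Fin (suc m) → A) →
      tabulate (λ k → g k , next e g (csuc k)) ≡ links (g zero) (tabulate (g ∘ suc)) e
    tabulate-next {zero} e g = refl
    tabulate-next {suc m} e g = cong ((g zero , g (suc zero)) ∷_)
      (trans (tabulate-cong (λ k → cong (g (suc k) ,_) (next-csuc e g k))) (tabulate-next e (g ∘ suc)))

  tabulate-links : ∀ {m} (c : Fin (suc m) → A) →
    tabulate (λ k → c k , c (csuc k)) ≡ links (c zero) (tabulate (c ∘ suc)) (c zero)
  tabulate-links c =
    trans (tabulate-cong (λ k → cong (c k ,_) (sym (next-self c (csuc k))))) (tabulate-next (c zero) c)

  -- `lookup` alone has domain `Fin (length xs)`; here the domain is the index `n` that the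
  -- conditions prescribe.
  tabulate-surjective : ∀ n (xs : List A) → length xs ≡ n → ∃ λ (f : Fin n → A) → tabulate f ≡ xs
  tabulate-surjective n xs refl = lookup xs , tabulate-lookup xs

  tabulate-injective : ∀ {n} (f : Fin n → A) → Unique (tabulate f) → ∀ {k l} → f k ≡ f l → k ≡ l
  tabulate-injective f (p ∷ _) {zero} {zero} e = refl
  tabulate-injective f (p ∷ _) {zero} {suc l} e = ⊥-elim (Allₚ.tabulate⁻ p l e)
  tabulate-injective f (p ∷ _) {suc k} {zero} e = ⊥-elim (Allₚ.tabulate⁻ p k (sym e))
  tabulate-injective f (_ ∷ uniq) {suc k} {suc l} e = cong suc (tabulate-injective (f ∘ suc) uniq e)

  infix 4 _≃_

  -- Equality of the underlying multisets of unordered pairs.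
  data _≃_ : List (A × A) → List (A × A) → Set where
    ≃refl  : ∀ {es} → es ≃ es
    ≃prep  : ∀ e {es fs} → es ≃ fs → e ∷ es ≃ e ∷ fs
    ≃swap  : ∀ e f {es} → e ∷ f ∷ es ≃ f ∷ e ∷ es
    ≃flip  : ∀ a b {es} → (a , b) ∷ es ≃ (b , a) ∷ es
    ≃trans : ∀ {es fs gs} → es ≃ fs → fs ≃ gs → es ≃ gs

  ≃⇒↭ : ∀ {es fs} → es ≃ fs → flat es ↭ flat fs
  ≃⇒↭ ≃refl = ↭-refl
  ≃⇒↭ (≃prep (a , b) p) = prep a (prep b (≃⇒↭ p))
  ≃⇒↭ (≃swap (a , b) (c , d) {es}) = ~⇒↭ (~shifts (a ∷ b ∷ []) (c ∷ d ∷ []) (flat es))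
  ≃⇒↭ (≃flip a b) = swap a b ↭-refl
  ≃⇒↭ (≃trans p q) = ↭-trans (≃⇒↭ p) (≃⇒↭ q)

  ≃-++ˡ : ∀ gs {es fs} → es ≃ fs → gs ++ es ≃ gs ++ fs
  ≃-++ˡ [] p = p
  ≃-++ˡ (g ∷ gs) p = ≃prep g (≃-++ˡ gs p)

  ≃-All : ∀ {P : A × A → Set} → (∀ {a b} → P (a , b) → P (b , a)) → ∀ {es fs} → es ≃ fs → All P es → All P fs
  ≃-All sy ≃refl ps = ps
  ≃-All sy (≃prep e r) (p ∷ ps) = p ∷ ≃-All sy r ps
  ≃-All sy (≃swap e f) (p ∷ q ∷ ps) = q ∷ p ∷ ps
  ≃-All sy (≃flip a b) (p ∷ ps) = sy p ∷ ps
  ≃-All sy (≃trans r q) ps = ≃-All sy q (≃-All sy r ps)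

  find-pair : ∀ {a} es → a ∈ flat es → ∃ λ b → ∃ λ fs → es ≃ (a , b) ∷ fs
  find-pair ((a , b) ∷ es) (here refl) = b , es , ≃refl
  find-pair ((a , b) ∷ es) (there (here refl)) = a , es , ≃flip a b
  find-pair ((c , d) ∷ es) (there (there a∈)) with find-pair es a∈
  ... | b , fs , p = b , (c , d) ∷ fs , ≃trans (≃prep (c , d) p) (≃swap (c , d) _)

xor-cancelˡ : ∀ a {b c} → a xor b ≡ a xor c → b ≡ c
xor-cancelˡ false e = e
xor-cancelˡ true e = not-injective e

xor⇒≡ : ∀ {a b} → a xor b ≡ false → a ≡ b
xor⇒≡ {true} {true} _ = refl
xor⇒≡ {false} {false} _ = refl

≡⇒xor : ∀ {a b : Bool} → a ≡ b → a xor b ≡ false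
≡⇒xor {a} refl = xor-same a

⇔-≡ : ∀ {a b} → a ≡ b → (a ≡ true) ⇔ (b ≡ true)
⇔-≡ e = mk⇔ (trans (sym e)) (trans e)

↭⇒≃ : ∀ {A : Set} {es fs : List (A × A)} → es ↭ fs → es ≃ fs
↭⇒≃ refl = ≃refl
↭⇒≃ (prep e p) = ≃prep e (↭⇒≃ p)
↭⇒≃ (swap e f p) = ≃trans (≃swap e f) (≃prep f (≃prep e (↭⇒≃ p)))
↭⇒≃ (_↭_.trans p q) = ≃trans (↭⇒≃ p) (↭⇒≃ q)

to-front : ∀ {A : Set} {x : A} {xs} → x ∈ xs → ∃ λ ys → xs ↭ x ∷ ys
to-front {x = x} x∈ with ∈-∃++ x∈
... | ys , zs , refl = ys ++ zs , ↭-sym (~⇒↭ (~shift x ys zs))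

-- Perfect matchings as involutions and as lists of pairs

module Matchings {N : ℕ} (G : Graph N) where
  open Susp G

  adjacent-≢ : ∀ {x y} → adj G x y ≡ true → x ≢ y
  adjacent-≢ {x} xy refl with trans (sym xy) (irrefl G x)
  ... | ()

  Adj : Fin N × Fin N → Set
  Adj (x , y) = adj G x y ≡ true

  adj-flip : ∀ {x y} → adj G x y ≡ true → adj G y x ≡ true
  adj-flip {x} {y} = trans (adj-sym G y x)

  -- The length `n` drives the recursion, since removing `a` and `μ a` does not leave a structural
  -- sublist. What is left stays closed under `μ`: by involutivity, a vertex sent to one of the two
  -- removed ones is the other.
  pair-up : ∀ (μ : Fin N → Fin N) n R → length R ≡ n → Unique R →
    (∀ {a} → a ∈ R → μ a ∈ R × μ a ≢ a × μ (μ a) ≡ a × adj G a (μ a) ≡ true) →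
    ∃ λ es → flat es ↭ R × All Adj es
  pair-up μ n [] _ _ _ = [] , ↭-refl , []
  pair-up μ (suc n) (a ∷ R) len uniq@(_ ∷ uniq-R) closed with closed (here refl)
  ... | here e , ne , _ = ⊥-elim (ne e)
  ... | there μa∈ , ne , μμa , a-μa with to-front μa∈
  pair-up μ (suc zero) (a ∷ R) len uniq closed | there μa∈ , ne , μμa , a-μa | R′ , R↭
    with trans (sym (↭-length R↭)) (ℕₚ.suc-injective len)
  ... | ()
  pair-up μ (suc (suc n)) (a ∷ R) len uniq@(_ ∷ uniq-R) closed | there μa∈ , ne , μμa , a-μa | R′ , R↭ =
    let es , p , q = pair-up μ n R′
          (ℕₚ.suc-injective (trans (sym (↭-length R↭)) (ℕₚ.suc-injective len)))
          (AllPairs.tail uniq-R′) closed′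
    in (a , μ a) ∷ es , prep a (↭-trans (prep (μ a) p) (↭-sym R↭)) , a-μa ∷ q
    where
    uniq-R′ : Unique (μ a ∷ R′)
    uniq-R′ = Unique-resp-↭ R↭ uniq-R
    R′⊆ : ∀ {b} → b ∈ R′ → b ∈ R
    R′⊆ b∈ = ∈-resp-↭ (↭-sym R↭) (there b∈)
    closed′ : ∀ {b} → b ∈ R′ → μ b ∈ R′ × μ b ≢ b × μ (μ b) ≡ b × adj G b (μ b) ≡ true
    closed′ {b} b∈ with closed (there (R′⊆ b∈))
    ... | here μb≡a , _ , μμb , _ = ⊥-elim (Unique[x∷xs]⇒x∉xs uniq-R′
            (subst (_∈ R′) (trans (sym μμb) (cong μ μb≡a)) b∈))
    ... | there μb∈ , rest with ∈-resp-↭ R↭ μb∈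
    ... | there μb∈′ = μb∈′ , rest
    ... | here μb≡μa = ⊥-elim (Unique[x∷xs]⇒x∉xs uniq
            (subst (_∈ R) (trans (sym (proj₁ (proj₂ rest))) (trans (cong μ μb≡μa) μμa)) (R′⊆ b∈)))

  open DecMembership (_≟_ {N}) using (_∈?_; _∉?_)

  matching-list : ∀ L (S : Fin N → Set) → Unique L → (∀ {a} → S a → a ∉ L) → (∀ {a} → a ∉ L → S a) →
    PerfectMatching S → ∃ λ es → L ++ flat es ↭ allFin N × All Adj es
  matching-list L S uniq S⇒ ⇒S (μ , pm) =
    let es , p , q = pair-up μ _ R refl uniq-R closed
    in es , ↭-trans (++⁺ˡ L p) whole , q
    where
    R : List (Fin N)
    R = filter (_∉? L) (allFin N)
    R⇒ : ∀ {a} → a ∈ R → S a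
    R⇒ a∈ = ⇒S (proj₂ (∈-filter⁻ (_∉? L) {xs = allFin N} a∈))
    ⇒R : ∀ {a} → S a → a ∈ R
    ⇒R s = ∈-filter⁺ (_∉? L) (∈-allFin _) (S⇒ s)
    uniq-R : Unique R
    uniq-R = Uniqueₚ.filter⁺ (_∉? L) (Uniqueₚ.allFin⁺ N)
    closed : ∀ {a} → a ∈ R → μ a ∈ R × μ a ≢ a × μ (μ a) ≡ a × adj G a (μ a) ≡ true
    closed {a} a∈ = let p , q = pm a (R⇒ a∈) in ⇒R p , q
    whole : L ++ R ↭ allFin N
    whole = unique-set-↭ (Uniqueₚ.++⁺ uniq uniq-R (λ { (p , q) → S⇒ (R⇒ q) p })) (Uniqueₚ.allFin⁺ N)
      (λ _ → ∈-allFin _) (λ {a} _ → every a)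
      where
      every : ∀ a → a ∈ L ++ R
      every a with a ∈? L
      ... | yes p = ∈-++⁺ˡ p
      ... | no p = ∈-++⁺ʳ L (⇒R (⇒S p))

  partner : List (Fin N × Fin N) → Fin N → Fin N
  partner [] a = a
  partner ((x , y) ∷ es) a with a ≟ x | a ≟ y
  ... | yes _ | _ = y
  ... | no _ | yes _ = x
  ... | no _ | no _ = partner es a

  partner-fst : ∀ x y es → partner ((x , y) ∷ es) x ≡ y
  partner-fst x y es with x ≟ x
  ... | yes _ = refl
  ... | no p = ⊥-elim (p refl)

  partner-snd : ∀ x y es → x ≢ y → partner ((x , y) ∷ es) y ≡ x
  partner-snd x y es x≢y with y ≟ x | y ≟ y
  ... | yes e | _ = ⊥-elim (x≢y (sym e))
  ... | no _ | yes _ = refl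
  ... | no _ | no p = ⊥-elim (p refl)

  partner-skip : ∀ {a x y} es → a ≢ x → a ≢ y → partner ((x , y) ∷ es) a ≡ partner es a
  partner-skip {a} {x} {y} es p q with a ≟ x | a ≟ y
  ... | yes e | _ = ⊥-elim (p e)
  ... | no _ | yes e = ⊥-elim (q e)
  ... | no _ | no _ = refl

  ++-apart : ∀ {A : Set} xs {ys : List A} {b c} → Unique (xs ++ ys) → b ∈ xs → c ∈ ys → c ≢ b
  ++-apart xs uniq b∈ c∈ refl = ++-disjoint xs uniq b∈ c∈

  partner-spec : ∀ {es a} → Unique (flat es) → All Adj es → a ∈ flat es →
    partner es a ∈ flat es × partner es a ≢ a × partner es (partner es a) ≡ a × adj G a (partner es a) ≡ true
  partner-spec {(x , y) ∷ es} uniq (xy ∷ _) (here refl) rewrite partner-fst x y es =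
    there (here refl) , ≢-sym (adjacent-≢ xy) , partner-snd x y es (adjacent-≢ xy) , xy
  partner-spec {(x , y) ∷ es} uniq (xy ∷ _) (there (here refl)) rewrite partner-snd x y es (adjacent-≢ xy) =
    here refl , adjacent-≢ xy , partner-fst x y es , adj-flip xy
  partner-spec {(x , y) ∷ es} {a} uniq@(_ ∷ _ ∷ uniq′) (_ ∷ adjs) (there (there a∈))
    rewrite partner-skip es (++-apart (x ∷ y ∷ []) uniq (here refl) a∈)
              (++-apart (x ∷ y ∷ []) uniq (there (here refl)) a∈)
    with partner-spec uniq′ adjs a∈
  ... | p∈ , ne , invol , ad = there (there p∈) , ne ,
    trans (partner-skip es (++-apart (x ∷ y ∷ []) uniq (here refl) p∈)
                             (++-apart (x ∷ y ∷ []) uniq (there (here refl)) p∈)) invol , ad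

  list-matching : ∀ L {es} (S : Fin N → Set) → L ++ flat es ↭ allFin N → All Adj es →
    (∀ {a} → S a → a ∉ L) → (∀ {a} → a ∉ L → S a) → PerfectMatching S
  list-matching L {es} S whole adjs S⇒ ⇒S = partner es , λ a s →
    let p , q = partner-spec (AllPairs-++ʳ L uniq) adjs (in-es (S⇒ s))
    in ⇒S (λ r → ++-disjoint L uniq r p) , q
    where
    uniq : Unique (L ++ flat es)
    uniq = Unique-resp-↭ (↭-sym whole) (Uniqueₚ.allFin⁺ N)
    AllPairs-++ʳ : ∀ (xs : List (Fin N)) {ys} → Unique (xs ++ ys) → Unique ys
    AllPairs-++ʳ [] p = p
    AllPairs-++ʳ (_ ∷ xs) (_ ∷ p) = AllPairs-++ʳ xs p
    in-es : ∀ {a} → a ∉ L → a ∈ flat es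
    in-es {a} a∉ with ∈-++⁻ L (∈-resp-↭ (↭-sym whole) (∈-allFin a))
    ... | inj₁ p = ⊥-elim (a∉ p)
    ... | inj₂ p = p

-- Spanning trees and quasi-perfect matchings

module Trees {N : ℕ} (G : Graph N) (ω : Susp.Orientation G) where
  open Susp G
  open Sign G ω
  open SignFormula G ω
  open Matchings G using (Adj; adjacent-≢)

  star-in : ∀ {a ts es k} → Pointwise (Spans a) ts es → k ∈ flat es → ∃ λ t → t ∈ ts × emb k ∈ₜ t
  star-in {es = _ ∷ _} ((_ , inj₁ (refl , refl)) ∷ _) (here refl) = _ , here refl , inj₁ refl
  star-in {es = _ ∷ _} ((_ , inj₂ (refl , refl)) ∷ _) (here refl) = _ , here refl , inj₂ (inj₁ refl)
  star-in {es = _ ∷ _} ((_ , inj₁ (refl , refl)) ∷ _) (there (here refl)) = _ , here refl , inj₂ (inj₁ refl)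
  star-in {es = _ ∷ _} ((_ , inj₂ (refl , refl)) ∷ _) (there (here refl)) = _ , here refl , inj₁ refl
  star-in {es = _ ∷ _} (_ ∷ ps) (there (there k∈)) =
    let t , t∈ , k∈t = star-in ps k∈ in t , there t∈ , k∈t

  star-unique : ∀ {a ts es t s k} → Pointwise (Spans a) ts es → Unique (flat es) →
    t ∈ ts → s ∈ ts → emb k ∈ₜ t → emb k ∈ₜ s → t ≡ s
  star-unique _ _ (here refl) (here refl) _ _ = refl
  star-unique {ts = t ∷ _} {es = (x , y) ∷ es} (p ∷ ps) uniq (here refl) (there s∈) k∈t k∈s =
    ⊥-elim (++-disjoint (x ∷ y ∷ []) uniq (in-star {ts = t ∷ []} (p ∷ []) (here refl) k∈t) (in-star ps s∈ k∈s))
  star-unique {ts = t ∷ _} {es = (x , y) ∷ es} (p ∷ ps) uniq (there t∈) (here refl) k∈t k∈s =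
    ⊥-elim (++-disjoint (x ∷ y ∷ []) uniq (in-star {ts = t ∷ []} (p ∷ []) (here refl) k∈s) (in-star ps t∈ k∈t))
  star-unique (_ ∷ ps) (_ ∷ _ ∷ uniq) (there t∈) (there s∈) k∈t k∈s = star-unique ps uniq t∈ s∈ k∈t k∈s

  -- Quasi-perfect matchings give spanning trees

  module _ {Ts x y z us vs} (T : Tree Ts x y z us vs) where
    open Tree T

    unique-us : Unique (flat ((y , x) ∷ us))
    unique-us = Unique-++ˡ (y ∷ x ∷ flat us)
      (Unique-resp-↭ (prep y (prep x (~⇒↭ (~shift z (flat us) (flat vs))))) (unique-L T))

    unique-vs : Unique (flat ((y , z) ∷ vs))
    unique-vs = Unique-++ˡ (y ∷ z ∷ flat vs)
      (Unique-resp-↭ (prep y (↭-trans (prep x (~⇒↭ (~shift z (flat us) (flat vs))))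
        (++-comm (x ∷ flat us) (z ∷ flat vs)))) (unique-L T))

    star-triple : ∀ {t} → t ∈ Ts → (w t ≡ u × t ∈ tx ∷ Us) ⊎ (w t ≡ v × t ∈ tz ∷ Vs)
    star-triple {t} t∈ with w t ≟ₐ u
    ... | yes e = inj₁ (e , ∈-resp-↭ u-star (∈-filter⁺ (λ t → w t ≟ₐ u) t∈ e))
    ... | no ne = inj₂ (≢⇒other ne , ∈-resp-↭ v-star (∈-filter⁺ (λ t → w t ≟ₐ v) t∈ (≢⇒other ne)))

    same-apex : ∀ {t s k} → t ∈ Ts → s ∈ Ts → w t ≡ w s → emb k ∈ₜ t → emb k ∈ₜ s → t ≡ s
    same-apex t∈ s∈ e k∈t k∈s with star-triple t∈ | star-triple s∈
    ... | inj₁ (_ , p) | inj₁ (_ , q) = star-unique (tx-spans ∷ Us-span) unique-us p q k∈t k∈s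
    ... | inj₂ (_ , p) | inj₂ (_ , q) = star-unique (tz-spans ∷ Vs-span) unique-vs p q k∈t k∈s
    ... | inj₁ (e₁ , _) | inj₂ (e₂ , _) = ⊥-elim (u≢v (trans (sym e₁) (trans e e₂)))
    ... | inj₂ (e₁ , _) | inj₁ (e₂ , _) = ⊥-elim (u≢v (trans (sym e₂) (trans (sym e) e₁)))

    meet-y : ∀ {t s k} → t ∈ Ts → s ∈ Ts → w t ≡ u → w s ≡ v → emb k ∈ₜ t → emb k ∈ₜ s → k ≡ y
    meet-y t∈ s∈ wt ws k∈t k∈s with meet T t∈ s∈ wt ws k∈t k∈s
    ... | refl , refl with in-star {ts = tx ∷ []} (tx-spans ∷ []) (here refl) k∈t
                         | in-star {ts = tz ∷ []} (tz-spans ∷ []) (here refl) k∈s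
    ... | here e | _ = e
    ... | _ | here e = e
    ... | there (here refl) | there (here refl) =
      ⊥-elim (Unique[x∷xs]⇒x∉xs (AllPairs.tail (unique-L T)) (here refl))

    Joint : V → Set
    Joint x = x ≡ emb y ⊎ ∃ λ a → x ≡ apexV a

    joint : ∀ {t s x} → t ∈ Ts → s ∈ Ts → t ≢ s → x ∈ₜ t → x ∈ₜ s → Joint x
    joint {t} {s} {x} t∈ s∈ t≢s x∈t x∈s with vertex x
    ... | inj₂ p = inj₂ p
    ... | inj₁ (k , refl) with w t ≟ₐ w s
    ... | yes e = ⊥-elim (t≢s (same-apex t∈ s∈ e x∈t x∈s))
    ... | no ne with star-triple t∈ | star-triple s∈
    ... | inj₁ (e₁ , _) | inj₁ (e₂ , _) = ⊥-elim (ne (trans e₁ (sym e₂)))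
    ... | inj₂ (e₁ , _) | inj₂ (e₂ , _) = ⊥-elim (ne (trans e₁ (sym e₂)))
    ... | inj₁ (e₁ , _) | inj₂ (e₂ , _) = inj₁ (cong emb (meet-y t∈ s∈ e₁ e₂ x∈t x∈s))
    ... | inj₂ (e₁ , _) | inj₁ (e₂ , _) = inj₁ (cong emb (meet-y s∈ t∈ e₂ e₁ x∈s x∈t))

    -- Only u, v and y lie in two triples, so a cycle would have to alternate between y and the
    -- apices; two consecutive triples of it would then share both y and an apex.
    acyclic : ¬ HasCycle Ts
    acyclic (m , a , t , a-inj , t-inj , t∈ , a∈ , a∈′) = start
      where
      a≢ : ∀ k → a (csuc k) ≢ a k
      a≢ k e = csuc≢ k (a-inj e)
      t≢ : ∀ k → t k ≢ t (csuc k)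
      t≢ k e = csuc≢ k (sym (t-inj e))
      joint-a : ∀ k → Joint (a (csuc k))
      joint-a k = joint (t∈ k) (t∈ (csuc k)) (t≢ k) (a∈′ k) (a∈ (csuc k))
      one-apex : ∀ k b c → a k ≡ apexV b → a (csuc k) ≡ apexV c → ⊥
      one-apex k b c e f = a≢ k (trans f (trans (cong apexV
        (trans (sym (apex∈ (t k) c (subst (_∈ₜ t k) f (a∈′ k)))) (apex∈ (t k) b (subst (_∈ₜ t k) e (a∈ k)))))
        (sym e)))
      not-y : ∀ k → a (csuc k) ≡ emb y → ⊥
      not-y k e with joint-a (csuc k)
      ... | inj₁ f = a≢ (csuc k) (trans f (sym e))
      ... | inj₂ (b , f) with joint-a (csuc (csuc k))
      ... | inj₂ (c , g) = one-apex (csuc (csuc k)) b c f g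
      ... | inj₁ g = t≢ (csuc k) (same-apex (t∈ _) (t∈ _)
        (trans (apex∈ (t (csuc k)) b (subst (_∈ₜ t (csuc k)) f (a∈′ _)))
          (sym (apex∈ (t (csuc (csuc k))) b (subst (_∈ₜ t (csuc (csuc k))) f (a∈ _)))))
        (subst (_∈ₜ t (csuc k)) e (a∈ _)) (subst (_∈ₜ t (csuc (csuc k))) g (a∈′ _)))
      start : ⊥
      start with joint-a zero
      ... | inj₁ e = not-y zero e
      ... | inj₂ (b , e) with joint-a (csuc zero)
      ... | inj₁ f = not-y (csuc zero) f
      ... | inj₂ (c , f) = one-apex (csuc zero) b c e f

    tx∈ : tx ∈ Ts
    tx∈ = proj₁ (∈-filter⁻ (λ t → w t ≟ₐ u) {xs = Ts} (∈-resp-↭ (↭-sym u-star) (here refl)))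

    tz∈ : tz ∈ Ts
    tz∈ = proj₁ (∈-filter⁻ (λ t → w t ≟ₐ v) {xs = Ts} (∈-resp-↭ (↭-sym v-star) (here refl)))

    y∈tx : emb y ∈ₜ tx
    y∈tx with star-in {ts = tx ∷ []} (tx-spans ∷ []) (here refl)
    ... | _ , here refl , p = p

    y∈tz : emb y ∈ₜ tz
    y∈tz with star-in {ts = tz ∷ []} (tz-spans ∷ []) (here refl)
    ... | _ , here refl , p = p

    star∈ : ∀ a {ts t} → Ts at a ↭ ts → t ∈ ts → t ∈ Ts
    star∈ a p t∈ = proj₁ (∈-filter⁻ (λ t → w t ≟ₐ a) {xs = Ts} (∈-resp-↭ (↭-sym p) t∈))

    covers : ∀ x → ∃ λ t → t ∈ Ts × x ∈ₜ t
    covers x with vertex x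
    ... | inj₂ (u , refl) = tx , tx∈ , inj₂ (inj₂ (cong apexV (sym (proj₁ tx-spans))))
    ... | inj₂ (v , refl) = tz , tz∈ , inj₂ (inj₂ (cong apexV (sym (proj₁ tz-spans))))
    ... | inj₁ (k , refl) with ∈-++⁻ (flat ((y , _) ∷ us)) (∈-resp-↭
            (↭-trans (↭-sym covering) (prep y (prep _ (~⇒↭ (~shift z (flat us) (flat vs)))))) (∈-allFin k))
    ... | inj₁ p = let t , t∈ , k∈t = star-in (tx-spans ∷ Us-span) p in t , star∈ u u-star t∈ , k∈t
    ... | inj₂ p = let t , t∈ , k∈t = star-in {es = (y , z) ∷ vs} (tz-spans ∷ Vs-span) (there p)
                   in t , star∈ v v-star t∈ , k∈t

    reach-trans : ∀ {x z y} → Reach Ts x z → Reach Ts z y → Reach Ts x y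
    reach-trans here q = q
    reach-trans (step t t∈ x∈ z∈ p) q = step t t∈ x∈ z∈ (reach-trans p q)

    apex-to-y : ∀ t → t ∈ Ts → Reach Ts (apexV (w t)) (emb y) × Reach Ts (emb y) (apexV (w t))
    apex-to-y t t∈ with w t
    ... | u = step tx tx∈ u∈tx y∈tx here , step tx tx∈ y∈tx u∈tx here
      where u∈tx = inj₂ (inj₂ (cong apexV (sym (proj₁ tx-spans))))
    ... | v = step tz tz∈ v∈tz y∈tz here , step tz tz∈ y∈tz v∈tz here
      where v∈tz = inj₂ (inj₂ (cong apexV (sym (proj₁ tz-spans))))

    connected : ∀ x y → Reach Ts x y
    connected x₁ x₂ =
      let t₁ , t₁∈ , p₁ = covers x₁ ; t₂ , t₂∈ , p₂ = covers x₂ in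
      step t₁ t₁∈ p₁ (inj₂ (inj₂ refl)) (reach-trans (proj₁ (apex-to-y t₁ t₁∈))
        (reach-trans (proj₂ (apex-to-y t₂ t₂∈)) (step t₂ t₂∈ (inj₂ (inj₂ refl)) p₂ here)))

    tree-spanning : SpanningTree Ts
    tree-spanning = uniqueₜ , acyclic , covers , connected

  ends : Triple → Fin N × Fin N
  ends t = i t , j t

  spans-ends : ∀ {a ts} → All (λ t → w t ≡ a) ts → Pointwise (Spans a) ts (map ends ts)
  spans-ends [] = []
  spans-ends (e ∷ es) = (e , inj₁ (refl , refl)) ∷ spans-ends es

  other-end : ∀ {t k} → emb k ∈ₜ t → ∃ λ x → Spans (w t) t (k , x)
  other-end {t} (inj₁ e) = j t , refl , inj₁ (sym (emb-injective e) , refl)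
  other-end {t} (inj₂ (inj₁ e)) = i t , refl , inj₂ (refl , sym (emb-injective e))
  other-end {t} (inj₂ (inj₂ e)) = ⊥-elim (emb≢apexV _ (w t) e)

  spans-≢ : ∀ {a t x y} → Spans a t (x , y) → x ≢ y
  spans-≢ {t = t} (_ , inj₁ (refl , refl)) = i≢j t
  spans-≢ {t = t} (_ , inj₂ (refl , refl)) = ≢-sym (i≢j t)

  spans∋ : ∀ {a t x y} → Spans a t (x , y) → emb x ∈ₜ t × emb y ∈ₜ t
  spans∋ (_ , inj₁ (refl , refl)) = inj₁ refl , inj₂ (inj₁ refl)
  spans∋ (_ , inj₂ (refl , refl)) = inj₂ (inj₁ refl) , inj₁ refl

  unique-flat : ∀ {a ts es} → Pointwise (Spans a) ts es → Unique ts →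
    (∀ {t s k} → t ∈ ts → s ∈ ts → emb k ∈ₜ t → emb k ∈ₜ s → t ≡ s) → Unique (flat es)
  unique-flat [] _ _ = []
  unique-flat {a} {t ∷ ts} {(x , y) ∷ es} (p ∷ ps) uniq@(_ ∷ uniq′) same =
    (spans-≢ {a} {t} {x} {y} p ∷ All.tabulate (λ { k∈ refl → absent (proj₁ (spans∋ {a} {t} {x} {y} p)) k∈ })) ∷
    All.tabulate (λ { k∈ refl → absent (proj₂ (spans∋ {a} {t} {x} {y} p)) k∈ }) ∷
    unique-flat ps uniq′ (λ t∈ s∈ → same (there t∈) (there s∈))
    where
    absent : ∀ {k} → emb k ∈ₜ t → k ∉ flat es
    absent k∈t k∈ with star-in ps k∈
    ... | s , s∈ , k∈s = Unique[x∷xs]⇒x∉xs uniq (subst (_∈ ts) (sym (same (here refl) (there s∈) k∈t k∈s)) s∈)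

  apart : ∀ {t s} → w t ≡ u → w s ≡ v → t ≢ s
  apart e f refl = u≢v (trans (sym e) f)

  -- Spanning trees come from quasi-perfect matchings

  module _ {Ts : List Triple} (tree : SpanningTree Ts) where

    private
      uniq = proj₁ tree
      no-cycle = proj₁ (proj₂ tree)
      cover = proj₁ (proj₂ (proj₂ tree))
      reach = proj₂ (proj₂ (proj₂ tree))

    no-2-cycle : ∀ {t s x y} → t ∈ Ts → s ∈ Ts → x ≢ y → t ≢ s → x ∈ₜ t → y ∈ₜ t → x ∈ₜ s → y ∈ₜ s → ⊥
    no-2-cycle {t} {s} {x} {y} t∈ s∈ x≢y t≢s x∈t y∈t x∈s y∈s =
      no-cycle (0 , lookup (x ∷ y ∷ []) , lookup (t ∷ s ∷ []) ,
        lookup-injective ((x≢y ∷ []) ∷ [] ∷ []) , lookup-injective ((t≢s ∷ []) ∷ [] ∷ []) ,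
        (λ { zero → t∈ ; (suc zero) → s∈ }) ,
        (λ { zero → x∈t ; (suc zero) → y∈s }) ,
        (λ { zero → y∈t ; (suc zero) → x∈s }))

    -- Two triples at one apex with a further common vertex form a cycle of length two. Hence the
    -- edges at one apex form a matching.
    star-edge-unique : ∀ {t s k} → t ∈ Ts → s ∈ Ts → w t ≡ w s → emb k ∈ₜ t → emb k ∈ₜ s → t ≡ s
    star-edge-unique {t} {s} t∈ s∈ e k∈t k∈s with t ≟ₜ s
    ... | yes e′ = e′
    ... | no ne = ⊥-elim (no-2-cycle t∈ s∈ (emb≢apexV _ (w t)) ne k∈t (inj₂ (inj₂ refl)) k∈s
            (inj₂ (inj₂ (cong apexV e))))

    Shared : Set
    Shared = ∃ λ k → ∃ λ t → ∃ λ s → t ∈ Ts × s ∈ Ts × w t ≡ u × w s ≡ v × emb k ∈ₜ t × emb k ∈ₜ s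

    UStar : V → Set
    UStar x = ∃ λ t → t ∈ Ts × w t ≡ u × x ∈ₜ t

    -- On a path of triples that starts at `u`, the first triple at `v` is entered through a vertex
    -- of a triple at `u`. That vertex cannot be an apex, so it is a vertex of `G` lying in both
    -- stars.
    reach-shared : ∀ {x y} → UStar x → Reach Ts x y → UStar y ⊎ Shared
    reach-shared p here = inj₁ p
    reach-shared {x} (s , s∈ , ws , x∈s) (step t t∈ x∈t z∈t r) with w t ≟ₐ u
    ... | yes wt = reach-shared (t , t∈ , wt , z∈t) r
    ... | no ne with vertex x
    ... | inj₁ (k , refl) = inj₂ (k , s , t , s∈ , t∈ , ws , ≢⇒other ne , x∈s , x∈t)
    ... | inj₂ (a , refl) = ⊥-elim (ne (trans (apex∈ t a x∈t) (trans (sym (apex∈ s a x∈s)) ws)))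

    shared : Shared
    shared with cover (apexV u)
    ... | t , t∈ , u∈t with reach-shared (t , t∈ , apex∈ t u u∈t , u∈t) (reach (apexV u) (apexV v))
    ... | inj₂ p = p
    ... | inj₁ (s , _ , ws , v∈s) = ⊥-elim (u≢v (trans (sym ws) (apex∈ s v v∈s)))

    -- A second vertex k common to both stars closes a cycle through k, u, y, v, shortened when
    -- some of the four triples coincide.
    shared-unique : ∀ {k t s y tx tz} → t ∈ Ts → s ∈ Ts → w t ≡ u → w s ≡ v → emb k ∈ₜ t → emb k ∈ₜ s →
      tx ∈ Ts → tz ∈ Ts → w tx ≡ u → w tz ≡ v → emb y ∈ₜ tx → emb y ∈ₜ tz → k ≡ y
    shared-unique {k} {t} {s} {y} {tx} {tz} t∈ s∈ wt ws k∈t k∈s tx∈ tz∈ wx wz y∈x y∈z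
      with k ≟ y | t ≟ₜ tx | s ≟ₜ tz
    ... | yes e | _ | _ = e
    ... | no k≢y | yes refl | yes refl =
      ⊥-elim (no-2-cycle t∈ s∈ (k≢y ∘ emb-injective) (apart wt ws) k∈t y∈x k∈s y∈z)
    ... | no k≢y | yes refl | no s≢tz =
      ⊥-elim (no-cycle (1 , lookup (emb k ∷ emb y ∷ apexV v ∷ []) , lookup (t ∷ tz ∷ s ∷ []) ,
        lookup-injective ((k≢y ∘ emb-injective ∷ emb≢apexV k v ∷ []) ∷ (emb≢apexV y v ∷ []) ∷ [] ∷ []) ,
        lookup-injective ((apart wt wz ∷ apart wt ws ∷ []) ∷ (≢-sym s≢tz ∷ []) ∷ [] ∷ []) ,
        (λ { zero → t∈ ; (suc zero) → tz∈ ; (suc (suc zero)) → s∈ }) ,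
        (λ { zero → k∈t ; (suc zero) → y∈z ; (suc (suc zero)) → inj₂ (inj₂ (cong apexV (sym ws))) }) ,
        (λ { zero → y∈x ; (suc zero) → inj₂ (inj₂ (cong apexV (sym wz))) ; (suc (suc zero)) → k∈s })))
    ... | no k≢y | no t≢tx | yes refl =
      ⊥-elim (no-cycle (1 , lookup (emb k ∷ apexV u ∷ emb y ∷ []) , lookup (t ∷ tx ∷ s ∷ []) ,
        lookup-injective ((emb≢apexV k u ∷ k≢y ∘ emb-injective ∷ []) ∷ (≢-sym (emb≢apexV y u) ∷ []) ∷ [] ∷ []) ,
        lookup-injective ((t≢tx ∷ apart wt ws ∷ []) ∷ (apart wx ws ∷ []) ∷ [] ∷ []) ,
        (λ { zero → t∈ ; (suc zero) → tx∈ ; (suc (suc zero)) → s∈ }) ,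
        (λ { zero → k∈t ; (suc zero) → inj₂ (inj₂ (cong apexV (sym wx))) ; (suc (suc zero)) → y∈z }) ,
        (λ { zero → inj₂ (inj₂ (cong apexV (sym wt))) ; (suc zero) → y∈x ; (suc (suc zero)) → k∈s })))
    ... | no k≢y | no t≢tx | no s≢tz =
      ⊥-elim (no-cycle (2 , lookup (emb k ∷ apexV u ∷ emb y ∷ apexV v ∷ []) , lookup (t ∷ tx ∷ tz ∷ s ∷ []) ,
        lookup-injective ((emb≢apexV k u ∷ k≢y ∘ emb-injective ∷ emb≢apexV k v ∷ []) ∷
          (≢-sym (emb≢apexV y u) ∷ u≢v ∘ apexV-injective ∷ []) ∷ (emb≢apexV y v ∷ []) ∷ [] ∷ []) ,
        lookup-injective ((t≢tx ∷ apart wt wz ∷ apart wt ws ∷ []) ∷ (apart wx wz ∷ apart wx ws ∷ []) ∷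
          (≢-sym s≢tz ∷ []) ∷ [] ∷ []) ,
        (λ { zero → t∈ ; (suc zero) → tx∈ ; (suc (suc zero)) → tz∈ ; (suc (suc (suc zero))) → s∈ }) ,
        (λ { zero → k∈t ; (suc zero) → inj₂ (inj₂ (cong apexV (sym wx))) ; (suc (suc zero)) → y∈z
           ; (suc (suc (suc zero))) → inj₂ (inj₂ (cong apexV (sym ws))) }) ,
        (λ { zero → inj₂ (inj₂ (cong apexV (sym wt))) ; (suc zero) → y∈x
           ; (suc (suc zero)) → inj₂ (inj₂ (cong apexV (sym wz))) ; (suc (suc (suc zero))) → k∈s })))

    -- Connectedness supplies a vertex common to both stars; acyclicity gives its uniqueness and the
    -- disjointness of the edges at one apex. As every vertex is covered, `y` has one edge at each
    -- apex and every other vertex has exactly one edge.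
    spanning-tree : ∃ λ x → ∃ λ y → ∃ λ z → ∃ λ us → ∃ λ vs → Tree Ts x y z us vs
    spanning-tree with shared
    ... | y , tx , tz , tx∈ , tz∈ , wx , wz , y∈x , y∈z
      with other-end {tx} y∈x | other-end {tz} y∈z
         | to-front (∈-filter⁺ (λ t → w t ≟ₐ u) tx∈ wx) | to-front (∈-filter⁺ (λ t → w t ≟ₐ v) tz∈ wz)
    ... | x , x-spans | z , z-spans | Us , Us↭ | Vs , Vs↭ = x , y , z , map ends Us , map ends Vs , record
      { uniqueₜ = uniq ; u-star = Us↭ ; v-star = Vs↭
      ; tx-spans = wx , proj₂ x-spans ; tz-spans = wz , proj₂ z-spans
      ; Us-span = spans-ends (All.tail all-u) ; Vs-span = spans-ends (All.tail all-v)
      ; covering = unique-set-↭ unique-all (Uniqueₚ.allFin⁺ N) (λ _ → ∈-allFin _) (λ {k} _ → all k) }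
      where
      us = map ends Us
      vs = map ends Vs
      all-u : All (λ t → w t ≡ u) (tx ∷ Us)
      all-u = All-resp-↭ Us↭ (at-apex u Ts)
      all-v : All (λ t → w t ≡ v) (tz ∷ Vs)
      all-v = All-resp-↭ Vs↭ (at-apex v Ts)
      span-u : Pointwise (Spans u) (tx ∷ Us) ((y , x) ∷ us)
      span-u = (wx , proj₂ x-spans) ∷ spans-ends (All.tail all-u)
      span-v : Pointwise (Spans v) (tz ∷ Vs) ((y , z) ∷ vs)
      span-v = (wz , proj₂ z-spans) ∷ spans-ends (All.tail all-v)
      u∈ : ∀ {t} → t ∈ tx ∷ Us → t ∈ Ts
      u∈ t∈ = proj₁ (∈-filter⁻ (λ t → w t ≟ₐ u) {xs = Ts} (∈-resp-↭ (↭-sym Us↭) t∈))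
      v∈ : ∀ {t} → t ∈ tz ∷ Vs → t ∈ Ts
      v∈ t∈ = proj₁ (∈-filter⁻ (λ t → w t ≟ₐ v) {xs = Ts} (∈-resp-↭ (↭-sym Vs↭) t∈))
      unique-u : Unique (y ∷ x ∷ flat us)
      unique-u = unique-flat span-u (Unique-resp-↭ Us↭ (Uniqueₚ.filter⁺ (λ t → w t ≟ₐ u) uniq))
        (λ t∈ s∈ → star-edge-unique (u∈ t∈) (u∈ s∈) (trans (All.lookup all-u t∈) (sym (All.lookup all-u s∈))))
      unique-v : Unique (y ∷ z ∷ flat vs)
      unique-v = unique-flat span-v (Unique-resp-↭ Vs↭ (Uniqueₚ.filter⁺ (λ t → w t ≟ₐ v) uniq))
        (λ t∈ s∈ → star-edge-unique (v∈ t∈) (v∈ s∈) (trans (All.lookup all-v t∈) (sym (All.lookup all-v s∈))))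
      disjoint : ∀ {k} → k ∈ y ∷ x ∷ flat us × k ∈ z ∷ flat vs → ⊥
      disjoint (p , q) =
        let t , t∈ , k∈t = star-in span-u p ; s , s∈ , k∈s = star-in {es = (y , z) ∷ vs} span-v (there q) in
        Unique[x∷xs]⇒x∉xs unique-v (subst (_∈ z ∷ flat vs)
          (shared-unique (u∈ t∈) (v∈ s∈) (All.lookup all-u t∈) (All.lookup all-v s∈) k∈t k∈s
            tx∈ tz∈ wx wz y∈x y∈z) q)
      unshift : (y ∷ x ∷ flat us) ++ z ∷ flat vs ↭ y ∷ x ∷ z ∷ flat us ++ flat vs
      unshift = prep y (prep x (↭-sym (~⇒↭ (~shift z (flat us) (flat vs)))))
      unique-all : Unique (y ∷ x ∷ z ∷ flat us ++ flat vs)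
      unique-all = Unique-resp-↭ unshift (Uniqueₚ.++⁺ unique-u (AllPairs.tail unique-v) disjoint)
      all : ∀ k → k ∈ y ∷ x ∷ z ∷ flat us ++ flat vs
      all k with cover (emb k)
      ... | t , t∈ , k∈t with w t ≟ₐ u
      ... | yes e = ∈-resp-↭ unshift (∈-++⁺ˡ
              (in-star span-u (∈-resp-↭ Us↭ (∈-filter⁺ (λ t → w t ≟ₐ u) t∈ e)) k∈t))
      ... | no ne with in-star span-v (∈-resp-↭ Vs↭ (∈-filter⁺ (λ t → w t ≟ₐ v) t∈ (≢⇒other ne))) k∈t
      ... | here refl = here refl
      ... | there q = ∈-resp-↭ unshift (∈-++⁺ʳ (y ∷ x ∷ flat us) q)

  spans-adjacent : ∀ {a t x y} → Spans a t (x , y) → adj G x y ≡ true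
  spans-adjacent {t = t} (_ , inj₁ (refl , refl)) = T⇒≡ (edge t)
  spans-adjacent {t = t} (_ , inj₂ (refl , refl)) = trans (adj-sym G _ _) (T⇒≡ (edge t))

  star-adjacent : ∀ {a ts es} → Pointwise (Spans a) ts es → All Adj es
  star-adjacent [] = []
  star-adjacent {a} {t ∷ _} {(x , y) ∷ _} (p ∷ ps) = spans-adjacent {a} {t} {x} {y} p ∷ star-adjacent ps

  ≡⇒T : ∀ {b} → b ≡ true → T b
  ≡⇒T refl = tt

  triple : ∀ a x y → adj G x y ≡ true → ∃ λ t → Spans a t (x , y)
  triple a x y xy with ℕₚ.<-cmp (toℕ x) (toℕ y)
  ... | tri< x<y _ _ = mkTriple x y (ℕₚ.<⇒<ᵇ x<y) (≡⇒T xy) a , refl , inj₁ (refl , refl)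
  ... | tri> _ _ y<x =
    mkTriple y x (ℕₚ.<⇒<ᵇ y<x) (≡⇒T (trans (adj-sym G y x) xy)) a , refl , inj₂ (refl , refl)
  ... | tri≈ _ e _ = ⊥-elim (adjacent-≢ xy (Finₚ.toℕ-injective e))

  triples : ∀ a es → All Adj es → ∃ λ ts → Pointwise (Spans a) ts es
  triples a [] [] = [] , []
  triples a ((x , y) ∷ es) (p ∷ ps) =
    let t , q = triple a x y p ; ts , qs = triples a es ps in t ∷ ts , q ∷ qs

  spans-apex : ∀ {a ts es} → Pointwise (Spans a) ts es → All (λ t → w t ≡ a) ts
  spans-apex [] = []
  spans-apex (p ∷ ps) = proj₁ p ∷ spans-apex ps

  unique-star : ∀ {a ts es} → Pointwise (Spans a) ts es → Unique (flat es) → Unique ts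
  unique-star [] _ = []
  unique-star {ts = t ∷ ts} {(x , y) ∷ es} (p ∷ ps) uniq@(_ ∷ _ ∷ uniq′) =
    All.tabulate (λ { s∈ refl → ++-disjoint (x ∷ y ∷ []) uniq
      (in-star {ts = t ∷ []} (p ∷ []) (here refl) (inj₁ refl)) (in-star ps s∈ (inj₁ refl)) }) ∷
    unique-star ps uniq′

  at-all : ∀ a b {us vs} → All (λ t → w t ≡ a) us → All (λ t → w t ≡ b) vs → a ≢ b →
    ((us ++ vs) at a ≡ us) × ((us ++ vs) at b ≡ vs)
  at-all a b {us} {vs} pu pv a≢b =
    trans (filter-++ (λ t → w t ≟ₐ a) us vs) (trans (cong₂ _++_
      (filter-all (λ t → w t ≟ₐ a) pu)
      (filter-none (λ t → w t ≟ₐ a) (All.map (λ e f → a≢b (trans (sym f) e)) pv))) (++-identityʳ us)) ,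
    trans (filter-++ (λ t → w t ≟ₐ b) us vs) (cong₂ _++_
      (filter-none (λ t → w t ≟ₐ b) (All.map (λ e f → a≢b (trans (sym e) f)) pu))
      (filter-all (λ t → w t ≟ₐ b) pv))

  covering-tree : ∀ {x y z us vs} → Covering x y z us vs → adj G y x ≡ true → adj G y z ≡ true →
    All Adj us → All Adj vs → ∃ λ Ts → Tree Ts x y z us vs
  covering-tree {x} {y} {z} {us} {vs} cov yx yz au av =
    let tx , px = triple u y x yx
        tz , pz = triple v y z yz
        Us , pU = triples u us au
        Vs , pV = triples v vs av
        eu , ev = at-all u v (spans-apex (_∷_ {y = y , x} px pU)) (spans-apex (_∷_ {y = y , z} pz pV)) u≢v
        uniq = Unique-resp-↭ (↭-sym cov) (Uniqueₚ.allFin⁺ N)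
        uniq-u = Unique-++ˡ (y ∷ x ∷ flat us)
          (Unique-resp-↭ (prep y (prep x (~⇒↭ (~shift z (flat us) (flat vs))))) uniq)
        uniq-v = Unique-++ˡ (y ∷ z ∷ flat vs)
          (Unique-resp-↭ (prep y (↭-trans (prep x (~⇒↭ (~shift z (flat us) (flat vs))))
            (++-comm (x ∷ flat us) (z ∷ flat vs)))) uniq)
    in (tx ∷ Us) ++ (tz ∷ Vs) , record
      { uniqueₜ = Uniqueₚ.++⁺ (unique-star {es = (y , x) ∷ us} (px ∷ pU) uniq-u)
          (unique-star {es = (y , z) ∷ vs} (pz ∷ pV) uniq-v)
          (λ { {t} (p , q) → apart {t} {t} (All.lookup (spans-apex (_∷_ {y = y , x} px pU)) p)
                           (All.lookup (spans-apex (_∷_ {y = y , z} pz pV)) q) refl })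
      ; u-star = ↭-reflexive eu ; v-star = ↭-reflexive ev
      ; tx-spans = px ; tz-spans = pz ; Us-span = pU ; Vs-span = pV ; covering = cov }

-- Values of quasi-perfect matchings

module Values {N : ℕ} (G : Graph N) (ω : Susp.Orientation G) where
  open Susp G
  open Sign G ω
  open SignFormula G ω
  open Trees G ω using (triple; covering-tree; tree-spanning; spanning-tree; spans-adjacent; star-adjacent)
  open Matchings G
  open xor-∧-Solver

  back-flip : ∀ a {x y} → adj G x y ≡ true → back a y x ≡ not (back a x y)
  back-flip a {x} {y} xy with triple a x y xy
  ... | t , refl , inj₁ (refl , refl) =
    trans (back-ji t) (trans (sym (not-involutive (ω t))) (cong not (sym (back-ij t))))
  ... | t , refl , inj₂ (refl , refl) = trans (back-ij t) (cong not (sym (back-ji t)))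

  -- Reversing a listed edge swaps two adjacent letters and flips its bit at either apex, while
  -- exchanging two edges costs nothing. The same `b` measures both changes, which therefore cancel
  -- in the value.
  ≃-backs : ∀ {es fs} → es ≃ fs → All Adj es →
    ∃ λ b → flat es ~[ b ] flat fs × (∀ a → backs a fs ≡ b xor backs a es)
  ≃-backs ≃refl _ = false , ~refl , λ _ → refl
  ≃-backs (≃prep (x , y) {es} p) (_ ∷ adjs) with ≃-backs p adjs
  ... | b , q , r = b , ~prep x (~prep y q) , λ a → trans (cong (back a x y xor_) (r a))
    (solve 3 (λ e b c → e :+ (b :+ c) := b :+ (e :+ c)) refl (back a x y) b (backs a es))
  ≃-backs (≃swap (x , y) (z , t) {es}) _ = false , ~shifts (x ∷ y ∷ []) (z ∷ t ∷ []) (flat es) , λ a →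
    solve 3 (λ e b c → e :+ (b :+ c) := b :+ (e :+ c)) refl (back a z t) (back a x y) (backs a es)
  ≃-backs (≃flip x y {es}) (xy ∷ _) = true , ~swap x y , λ a →
    trans (cong (_xor backs a es) (back-flip a xy)) (xor-notˡ (back a x y) (backs a es))
  ≃-backs (≃trans {es} p q) adjs with ≃-backs p adjs | ≃-backs q (≃-All adj-flip p adjs)
  ... | b , p₁ , p₂ | c , q₁ , q₂ = b xor c , ~trans p₁ q₁ , λ a →
    trans (q₂ a) (trans (cong (c xor_) (p₂ a))
      (solve 3 (λ b c e → c :+ (b :+ e) := (b :+ c) :+ e) refl b c (backs a es)))

  backs-++ : ∀ a es fs → backs a (es ++ fs) ≡ backs a es xor backs a fs
  backs-++ a [] fs = refl
  backs-++ a ((x , y) ∷ es) fs =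
    trans (cong (back a x y xor_) (backs-++ a es fs)) (sym (xor-assoc (back a x y) _ _))

  -- A quasi-perfect matching before any apex is chosen, with path `x y z` and single edges `es`. In
  -- `Constant` the choice for the single edges is the split of the list into `us` and `vs`.
  record Config (x y z : Fin N) (es : List (Fin N × Fin N)) : Set where
    constructor mkConfig
    field
      word : y ∷ x ∷ z ∷ flat es ↭ allFin N
      yx   : adj G y x ≡ true
      yz   : adj G y z ≡ true
      adjs : All Adj es

  Constant : Set
  Constant = ∀ {x y z x′ y′ z′} us vs us′ vs′ →
    Config x y z (us ++ vs) → Config x′ y′ z′ (us′ ++ vs′) → val x y z us vs ≡ val x′ y′ z′ us′ vs′

  config-tree : ∀ {x y z} us vs → Config x y z (us ++ vs) → ∃ λ Ts → Tree Ts x y z us vs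
  config-tree {x} {y} {z} us vs (mkConfig word yx yz adjs) =
    covering-tree (subst (λ l → y ∷ x ∷ z ∷ l ↭ allFin N) (flat-++ us vs) word) yx yz
      (Allₚ.++⁻ˡ us adjs) (Allₚ.++⁻ʳ us adjs)

  tree-config : ∀ {Ts x y z us vs} → Tree Ts x y z us vs → Config x y z (us ++ vs)
  tree-config {x = x} {y} {z} {us} {vs} T = mkConfig
    (subst (λ l → y ∷ x ∷ z ∷ l ↭ allFin N) (sym (flat-++ us vs)) covering)
    (spans-adjacent {u} {tx} {y} {x} tx-spans) (spans-adjacent {v} {tz} {y} {z} tz-spans)
    (Allₚ.++⁺ (star-adjacent Us-span) (star-adjacent Vs-span))
    where open Tree T

  pfaffian⇒constant : ThreePfaffian ω → Constant
  pfaffian⇒constant pf us vs us′ vs′ c c′ =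
    let Ts , T = config-tree us vs c ; Ts′ , T′ = config-tree us′ vs′ c′ in
    not-injective (bit-injective (trans (sym (sign-tree T))
      (trans (pf Ts Ts′ (tree-spanning T) (tree-spanning T′)) (sign-tree T′))))

  constant⇒pfaffian : Constant → ThreePfaffian ω
  constant⇒pfaffian const Ts Ts′ t t′ =
    let x , y , z , us , vs , T = spanning-tree t ; x′ , y′ , z′ , us′ , vs′ , T′ = spanning-tree t′ in
    trans (sign-tree T) (trans (cong (bit ∘ not) (const us vs us′ vs′ (tree-config T) (tree-config T′)))
      (sym (sign-tree T′)))

  -- The value when all single edges are assigned u.
  uval : Fin N → Fin N → Fin N → List (Fin N × Fin N) → Bool
  uval x y z es = inv (y ∷ x ∷ z ∷ flat es) xor (back u y x xor (back v y z xor backs u es))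

  val-uval : ∀ x y z es → val x y z es [] ≡ uval x y z es
  val-uval x y z es = cong₂ _xor_ (cong (λ l → inv (y ∷ x ∷ z ∷ l)) (++-identityʳ (flat es)))
    (cong (λ b → back u y x xor (back v y z xor b)) (xor-identityʳ (backs u es)))

  config-unique : ∀ {x y z es} → Config x y z es → Unique (y ∷ x ∷ z ∷ flat es)
  config-unique c = Unique-resp-↭ (↭-sym (Config.word c)) (Uniqueₚ.allFin⁺ N)

  config-≃ : ∀ {x y z es fs} → Config x y z es → es ≃ fs → Config x y z fs
  config-≃ {x} {y} {z} (mkConfig word yx yz adjs) p =
    mkConfig (↭-trans (prep y (prep x (prep z (↭-sym (≃⇒↭ p))))) word) yx yz (≃-All adj-flip p adjs)

  -- The words for the two sides of condition (c), and for its v-version.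
  path-word : ∀ (x₁ x₂ x₃ x₄ x₅ : Fin N) L →
    (x₄ ∷ x₃ ∷ x₅ ∷ x₁ ∷ x₂ ∷ L) ~[ true ] (x₂ ∷ x₃ ∷ x₁ ∷ x₄ ∷ x₅ ∷ L)
  path-word x₁ x₂ x₃ x₄ x₅ L =
    ~trans (~sym (~shift x₂ (x₄ ∷ x₃ ∷ x₅ ∷ x₁ ∷ []) L))
      (~prep x₂ (~trans (~swap x₄ x₃) (~prep x₃ (~sym (~shift x₁ (x₄ ∷ x₅ ∷ []) L)))))

  path-word′ : ∀ (x₁ x₂ x₃ x₄ x₅ : Fin N) L →
    (x₄ ∷ x₅ ∷ x₃ ∷ x₁ ∷ x₂ ∷ L) ~[ true ] (x₂ ∷ x₁ ∷ x₃ ∷ x₄ ∷ x₅ ∷ L)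
  path-word′ x₁ x₂ x₃ x₄ x₅ L =
    ~trans (~sym (~shift x₂ (x₄ ∷ x₅ ∷ x₃ ∷ x₁ ∷ []) L))
      (~prep x₂ (~trans (~sym (~shift x₁ (x₄ ∷ x₅ ∷ x₃ ∷ []) L))
        (~prep x₁ (~sym (~shift x₃ (x₄ ∷ x₅ ∷ []) L)))))

  orientation-bits : ∀ c e f → not (if c then e else not e) ≡ not (if c then f else not f) → e ≡ f
  orientation-bits true e f p = not-injective p
  orientation-bits false e f p = not-injective (not-injective p)

  agree : ∀ {x y} → back u x y ≡ back v x y → Agreeing ω x y
  agree {x} {y} = orientation-bits (toℕ x <ᵇ toℕ y) _ _

  agree⁻ : ∀ {x y} → Agreeing ω x y → back u x y ≡ back v x y
  agree⁻ {x} {y} = cong (λ e → not (if toℕ x <ᵇ toℕ y then e else not e))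

  arrows : Apex → List (Fin N × Fin N) → Bool
  arrows a [] = false
  arrows a ((x , y) ∷ es) = arrow ω a x y xor arrows a es

  arrows-backs : ∀ a es → arrows a es ≡ odd (length es) xor backs a es
  arrows-backs a [] = refl
  arrows-backs a ((x , y) ∷ es) = trans (cong₂ _xor_ (sym (not-involutive (arrow ω a x y))) (arrows-backs a es))
    (solve 3 (λ e l b → (con true :+ e) :+ (l :+ b) := (con true :+ l) :+ (e :+ b)) refl
      (back a x y) (odd (length es)) (backs a es))

  odd-arrows : ∀ a {n} (f : Fin n → Fin N × Fin N) →
    odd (sum (tabulate (λ k → if arrow ω a (proj₁ (f k)) (proj₂ (f k)) then 1 else 0))) ≡ arrows a (tabulate f)
  odd-arrows a {zero} f = refl
  odd-arrows a {suc n} f = trans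
    (odd-+ (bit (arrow ω a (proj₁ (f zero)) (proj₂ (f zero)))) _)
    (cong₂ _xor_ (odd-bit (arrow ω a (proj₁ (f zero)) (proj₂ (f zero)))) (odd-arrows a (f ∘ suc)))

  odd-forward : ∀ a {m} (c : Fin (suc m) → Fin N) →
    odd (forwardCount ω a c) ≡ arrows a (links (c zero) (tabulate (c ∘ suc)) (c zero))
  odd-forward a c = trans
    (cong odd (sum-allFin (λ k → if arrow ω a (c k) (c (csuc k)) then 1 else 0)))
    (trans (odd-arrows a (λ k → c k , c (csuc k))) (cong (arrows a) (tabulate-links c)))

  length-links : ∀ {A : Set} (x : A) ys z → length (links x ys z) ≡ suc (length ys)
  length-links x [] z = refl
  length-links x (y ∷ ys) z = cong suc (length-links y ys z)

  backs-links : ∀ a x y T → backs a (links x (y ∷ flat T) x) ≡ backs a ((x , y) ∷ T) xor backs a (rematch y T x)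
  backs-links a x y T = trans (cong (back a x y xor_) (go y T x)) (sym (xor-assoc (back a x y) _ _))
    where
    go : ∀ d T e → backs a (links d (flat T) e) ≡ backs a T xor backs a (rematch d T e)
    go d [] e = refl
    go d ((x , y) ∷ T) e = trans (cong (λ b → back a d x xor (back a x y xor b)) (go y T e))
      (solve 4 (λ p q r s → p :+ (q :+ (r :+ s)) := (q :+ r) :+ (p :+ s)) refl
        (back a d x) (back a x y) (backs a T) (backs a (rematch y T e)))

  -- A cycle of even length has as many forward as backward edges modulo two. The backward ones are
  -- counted separately on its two alternating matchings.
  odd-forward-rematch : ∀ a x y T → arrows a (links x (y ∷ flat T) x) ≡
    backs a ((x , y) ∷ T) xor backs a (rematch y T x)
  odd-forward-rematch a x y T = trans (arrows-backs a (links x (y ∷ flat T) x))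
    (trans (cong (_xor backs a (links x (y ∷ flat T) x))
      (trans (cong odd (length-links x (y ∷ flat T) x)) (trans (not-involutive _) (odd-flat T))))
      (backs-links a x y T))

-- Pfaffian orientations satisfy (a), (b), (c)

module Necessity {N : ℕ} (G : Graph N) (ω : Susp.Orientation G) (const : Values.Constant G ω) where
  open Susp G
  open Sign G ω
  open SignFormula G ω
  open Matchings G
  open Values G ω
  open xor-∧-Solver

  xor-cancelʳ : ∀ {a b} c → a xor c ≡ b xor c → a ≡ b
  xor-cancelʳ {a} {b} c e = xor-cancelˡ c (trans (xor-comm c a) (trans e (xor-comm b c)))

  -- Moving a single edge from `u` to `v` changes neither the word nor the bit of any other edge.
  agree-edge : ∀ {x y z es a b} → Config x y z es → (a , b) ∈ es → back u a b ≡ back v a b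
  agree-edge {x} {y} {z} {a = a} {b} c e∈ =
    let fs , p = to-front e∈
        c′ = config-≃ c (↭⇒≃ p)
    in trans (sym (xor-identityʳ (back u a b))) (xor-cancelʳ (backs v fs)
         (xor-cancelˡ (back v y z) (xor-cancelˡ (back u y x)
         (xor-cancelˡ (inv (y ∷ x ∷ z ∷ a ∷ b ∷ flat fs)) (const ((a , b) ∷ []) fs [] ((a , b) ∷ fs) c′ c′)))))

  uval-constant : ∀ {x y z es x′ y′ z′ es′} → Config x y z es → Config x′ y′ z′ es′ →
    uval x y z es ≡ uval x′ y′ z′ es′
  uval-constant {x} {y} {z} {es} {x′} {y′} {z′} {es′} c c′ =
    trans (sym (val-uval x y z es)) (trans
      (const es [] es′ [] (subst (Config x y z) (sym (++-identityʳ es)) c)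
        (subst (Config x′ y′ z′) (sym (++-identityʳ es′)) c′))
      (val-uval x′ y′ z′ es′))

  -- Each of the two alternating matchings `P` and `R` of the cycle extends the given quasi-perfect
  -- matching to all of `G`. So every edge of the cycle is a single edge in one of the two and
  -- agrees by `agree-edge`. The words of `P` and `R` differ by an odd rotation, hence so do their
  -- bits, which is odd orientation.
  cond-A : CondA ω
  cond-A k c (c-inj , c-adj) (x , y , z , Sx , Sy , Sz , x≢y , y≢z , x≢z , xy , yz , pm) =
    (λ i → agree {c i} {c (csuc i)} (Allₚ.tabulate⁻ {f = λ k → c k , c (csuc k)}
      (subst (All Agree) (sym (tabulate-links c)) agree-links) i)) ,
    trans (%2-odd (forwardCount ω u c)) (cong bit odd-count)
    where
    c₀ c₁ : Fin N
    c₀ = c zero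
    c₁ = c (suc zero)
    rest : ∃ λ Q → flat Q ≡ tabulate (λ i → c (suc (suc i)))
    rest = unflat k (tabulate (λ i → c (suc (suc i)))) (length-tabulate _)
    Q = proj₁ rest
    S : Fin N → Set
    S a = Compl c a × a ≢ x × a ≢ y × a ≢ z
    W : List (Fin N)
    W = y ∷ x ∷ z ∷ tabulate c
    S⇒∉ : ∀ {a} → S a → a ∉ W
    S⇒∉ (_ , _ , p , _) (here e) = p e
    S⇒∉ (_ , p , _ , _) (there (here e)) = p e
    S⇒∉ (_ , _ , _ , p) (there (there (here e))) = p e
    S⇒∉ (p , _) (there (there (there q))) = let i , e = ∈-tabulate⁻ {f = c} q in p i (sym e)
    ∉⇒S : ∀ {a} → a ∉ W → S a
    ∉⇒S a∉ = (λ { i refl → a∉ (there (there (there (∈-tabulate⁺ {f = c} i)))) }) ,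
      (λ e → a∉ (there (here e))) , (λ e → a∉ (here e)) , (λ e → a∉ (there (there (here e))))
    off : ∀ {a} → Compl c a → All (a ≢_) (tabulate c)
    off p = Allₚ.tabulate⁺ (λ i e → p i (sym e))
    unique-W : Unique W
    unique-W = (≢-sym x≢y ∷ y≢z ∷ off Sy) ∷ (x≢z ∷ off Sx) ∷ off Sz ∷ Uniqueₚ.tabulate⁺ c-inj
    matched = matching-list W S unique-W S⇒∉ ∉⇒S pm
    es = proj₁ matched
    P R : List (Fin N × Fin N)
    P = (c₀ , c₁) ∷ Q
    R = rematch c₁ Q c₀
    adj-links : All Adj (links c₀ (c₁ ∷ flat Q) c₀)
    adj-links = subst (λ l → All Adj (links c₀ (c₁ ∷ l) c₀)) (sym (proj₂ rest))
      (subst (All Adj) (tabulate-links c) (Allₚ.tabulate⁺ c-adj))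
    links-↭′ : links c₀ (c₁ ∷ flat Q) c₀ ↭ P ++ R
    links-↭′ = prep (c₀ , c₁) (links-↭ c₁ Q c₀)
    adj-PR : All Adj (P ++ R)
    adj-PR = All-resp-↭ links-↭′ adj-links
    word-P : y ∷ x ∷ z ∷ flat P ++ flat es ↭ allFin N
    word-P = subst (λ l → y ∷ x ∷ z ∷ (c₀ ∷ c₁ ∷ l) ++ flat es ↭ allFin N) (sym (proj₂ rest)) (proj₁ (proj₂ matched))
    config-P : Config x y z (P ++ es)
    config-P = mkConfig (subst (λ l → y ∷ x ∷ z ∷ l ↭ allFin N) (sym (flat-++ P es)) word-P)
      (adj-flip xy) yz (Allₚ.++⁺ {xs = P} (Allₚ.++⁻ˡ P {R} adj-PR) (proj₂ (proj₂ matched)))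
    P~R : (y ∷ x ∷ z ∷ flat (P ++ es)) ~[ true ] (y ∷ x ∷ z ∷ flat (R ++ es))
    P~R = ~prep y (~prep x (~prep z (~trans (~reflexive (flat-++ P es))
      (~trans (~++ʳ (flat es) (rematch-~ c₀ c₁ Q)) (~reflexive (sym (flat-++ R es)))))))
    config-R : Config x y z (R ++ es)
    config-R = mkConfig (↭-trans (↭-sym (~⇒↭ P~R)) (Config.word config-P))
      (adj-flip xy) yz (Allₚ.++⁺ {xs = R} (Allₚ.++⁻ʳ P {R} adj-PR) (proj₂ (proj₂ matched)))
    Agree : Fin N × Fin N → Set
    Agree (a , b) = back u a b ≡ back v a b
    agree-links : All Agree (links c₀ (tabulate (λ i → c (suc i))) c₀)
    agree-links = subst (λ l → All Agree (links c₀ (c₁ ∷ l) c₀)) (proj₂ rest)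
      (All-resp-↭ (↭-sym links-↭′) (Allₚ.++⁺ {xs = P} {ys = R}
        (All.tabulate (λ e∈ → agree-edge config-P (∈-++⁺ˡ e∈)))
        (All.tabulate (λ e∈ → agree-edge config-R (∈-++⁺ˡ e∈)))))
    odd-count : odd (forwardCount ω u c) ≡ true
    odd-count = trans (odd-forward u c) (trans
      (cong (λ l → arrows u (links c₀ (c₁ ∷ l) c₀)) (sym (proj₂ rest)))
      (trans (odd-forward-rematch u c₀ c₁ Q)
        (trans (solve 6 (λ i p q r s e → r :+ s :=
            con true :+ ((i :+ (p :+ (q :+ (r :+ e)))) :+ ((con true :+ i) :+ (p :+ (q :+ (s :+ e))))))
            refl I (back u y x) (back v y z) (backs u P) (backs u R) (backs u es))
          (cong not (≡⇒xor same)))))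
      where
      I = inv (y ∷ x ∷ z ∷ flat (P ++ es))
      same : I xor (back u y x xor (back v y z xor (backs u P xor backs u es))) ≡
        not I xor (back u y x xor (back v y z xor (backs u R xor backs u es)))
      same = trans (cong (λ b → I xor (back u y x xor (back v y z xor b))) (sym (backs-++ u P es)))
        (trans (uval-constant config-P config-R)
          (cong₂ (λ i b → i xor (back u y x xor (back v y z xor b)))
            (inv-~ (config-unique config-P) P~R) (backs-++ u R es)))

  matching-config : ∀ {m} (p : Fin (suc m) → Fin N) → IsPath p → PerfectMatching (Compl p) →
    ∃ λ es → tabulate p ++ flat es ↭ allFin N × All Adj es
  matching-config p (p-inj , _) = matching-list (tabulate p) (Compl p) (Uniqueₚ.tabulate⁺ p-inj)
    (λ s q → let i , e = ∈-tabulate⁻ {f = p} q in s i (sym e))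
    (λ a∉ i e → a∉ (subst (_∈ tabulate p) e (∈-tabulate⁺ {f = p} i)))

  -- `Config z y x es` is the same matching with the apices on its path exchanged. The word changes
  -- by one transposition, so the two bits on the path must change in total by one.
  differ : ∀ {x y z es} → Config x y z es → Config z y x es →
    (back u y x xor back v y x) xor (back u y z xor back v y z) ≡ true
  differ {x} {y} {z} {es} c c′ = trans
    (solve 6 (λ i p q p′ q′ e → (p :+ q′) :+ (p′ :+ q) :=
      con true :+ ((i :+ (p :+ (q :+ e))) :+ ((con true :+ i) :+ (p′ :+ (q′ :+ e)))))
      refl (inv (y ∷ x ∷ z ∷ flat es)) (back u y x) (back v y z) (back u y z) (back v y x) (backs u es))
    (cong not (≡⇒xor (trans (uval-constant c c′) (cong (_xor (back u y z xor (back v y x xor backs u es)))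
      (inv-~ (config-unique c) (~prep y (~swap x z)))))))

  xor-true : ∀ a b c d → (a xor b) xor (c xor d) ≡ true → (a ≡ b × c ≢ d) ⊎ (a ≢ b × c ≡ d)
  xor-true true true true false _ = inj₁ (refl , λ ())
  xor-true true true false true _ = inj₁ (refl , λ ())
  xor-true false false true false _ = inj₁ (refl , λ ())
  xor-true false false false true _ = inj₁ (refl , λ ())
  xor-true true false true true _ = inj₂ ((λ ()) , refl)
  xor-true true false false false _ = inj₂ ((λ ()) , refl)
  xor-true false true true true _ = inj₂ ((λ ()) , refl)
  xor-true false true false false _ = inj₂ ((λ ()) , refl)
  xor-true true true true true ()
  xor-true true true false false ()
  xor-true false false true true ()
  xor-true false false false false ()
  xor-true true false true false ()
  xor-true true false false true ()
  xor-true false true true false ()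
  xor-true false true false true ()

  cond-B : CondB ω
  cond-B p path@(_ , p-adj) pm =
    let es , whole , adjs = matching-config p path pm
        xy = p-adj zero ; yz = p-adj (suc zero)
        yx = adj-flip xy
        c  = mkConfig (↭-trans (swap y x ↭-refl) whole) yx yz adjs
        c′ = mkConfig (↭-trans (prep y (swap z x ↭-refl)) (Config.word c)) yz yx adjs
        flipped = differ c c′
    in Sum.map (λ (e , ne) → agree {x} {y} e , ne ∘ agree⁻ {y} {z})
      (λ (ne , e) → ne ∘ agree⁻ {x} {y} , agree {y} {z} e)
      (xor-true (back u x y) (back v x y) (back u y z) (back v y z)
        (trans (solve 3 (λ a b c → (a :+ b) :+ c := ((con true :+ a) :+ (con true :+ b)) :+ c) refl
            (back u x y) (back v x y) (back u y z xor back v y z))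
          (trans (cong (_xor (back u y z xor back v y z))
            (sym (cong₂ _xor_ (back-flip u xy) (back-flip v xy)))) flipped)))
    where
    x = p zero
    y = p (suc zero)
    z = p (suc (suc zero))

  -- The path `x₃ x₄ x₅` with single edge `x₁ x₂` is compared with the path `x₁ x₂ x₃` with single
  -- edge `x₄ x₅`. The apices are chosen such that every edge kept retains its own: for the
  -- u-statement only the edges at `x₃` carry `u`, the others `v`, and conversely for the
  -- v-statement. The odd change of the word is undone by the reversal of `x₁ x₂`, which leaves the
  -- equality of the two bits at `x₃`.
  cond-C : CondC ω
  cond-C p path@(_ , p-adj) pm = ⇔-≡ (sym arrows-u) , ⇔-≡ (sym arrows-v)
    where
    x₁ = p zero
    x₂ = p (suc zero)
    x₃ = p (suc (suc zero))
    x₄ = p (suc (suc (suc zero)))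
    x₅ = p (suc (suc (suc (suc zero))))
    x₁x₂ = p-adj zero
    x₂x₃ = p-adj (suc zero)
    x₃x₄ = p-adj (suc (suc zero))
    x₄x₅ = p-adj (suc (suc (suc zero)))
    matched = matching-config p path pm
    es = proj₁ matched
    F = flat es
    adjs = proj₂ (proj₂ matched)
    base : x₁ ∷ x₂ ∷ x₃ ∷ x₄ ∷ x₅ ∷ F ↭ allFin N
    base = proj₁ (proj₂ matched)
    w₁ : x₂ ∷ x₁ ∷ x₃ ∷ x₄ ∷ x₅ ∷ F ↭ allFin N
    w₁ = ↭-trans (swap x₂ x₁ ↭-refl) base
    w₂ : x₂ ∷ x₃ ∷ x₁ ∷ x₄ ∷ x₅ ∷ F ↭ allFin N
    w₂ = ↭-trans (prep x₂ (swap x₃ x₁ ↭-refl)) w₁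
    c₁ : Config x₃ x₄ x₅ ((x₁ , x₂) ∷ es)
    c₁ = mkConfig (↭-trans (~⇒↭ (path-word x₁ x₂ x₃ x₄ x₅ F)) w₂) (adj-flip x₃x₄) x₄x₅ (x₁x₂ ∷ adjs)
    c₂ : Config x₃ x₂ x₁ ((x₄ , x₅) ∷ es)
    c₂ = mkConfig w₂ x₂x₃ (adj-flip x₁x₂) (x₄x₅ ∷ adjs)
    c₃ : Config x₅ x₄ x₃ ((x₁ , x₂) ∷ es)
    c₃ = mkConfig (↭-trans (~⇒↭ (path-word′ x₁ x₂ x₃ x₄ x₅ F)) w₁) x₄x₅ (adj-flip x₃x₄) (x₁x₂ ∷ adjs)
    c₄ : Config x₁ x₂ x₃ ((x₄ , x₅) ∷ es)
    c₄ = mkConfig w₁ (adj-flip x₁x₂) x₂x₃ (x₄x₅ ∷ adjs)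
    arrows-u : arrow ω u x₄ x₃ ≡ arrow ω u x₂ x₃
    arrows-u = not-injective (xor⇒≡ (trans
      (solve 6 (λ i a b p q r → a :+ b :=
        (i :+ (a :+ (q :+ (p :+ r)))) :+ ((con true :+ i) :+ (b :+ ((con true :+ p) :+ (q :+ r))))) refl
        (inv (x₄ ∷ x₃ ∷ x₅ ∷ x₁ ∷ x₂ ∷ F)) (back u x₄ x₃) (back u x₂ x₃)
        (back v x₁ x₂) (back v x₄ x₅) (backs v es))
      (≡⇒xor (trans (const [] ((x₁ , x₂) ∷ es) [] ((x₄ , x₅) ∷ es) c₁ c₂)
        (cong₂ (λ i b → i xor (back u x₂ x₃ xor (b xor (back v x₄ x₅ xor backs v es))))
          (inv-~ (config-unique c₁) (path-word x₁ x₂ x₃ x₄ x₅ F)) (back-flip v x₁x₂))))))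
    arrows-v : arrow ω v x₄ x₃ ≡ arrow ω v x₂ x₃
    arrows-v = not-injective (xor⇒≡ (trans
      (solve 6 (λ i a b p q r → a :+ b :=
        (i :+ (q :+ (a :+ (p :+ r)))) :+ ((con true :+ i) :+ ((con true :+ p) :+ (b :+ (q :+ r))))) refl
        (inv (x₄ ∷ x₅ ∷ x₃ ∷ x₁ ∷ x₂ ∷ F)) (back v x₄ x₃) (back v x₂ x₃)
        (back u x₁ x₂) (back u x₄ x₅) (backs u es))
      (≡⇒xor (trans (uval-constant c₃ c₄)
        (cong₂ (λ i b → i xor (b xor (back v x₂ x₃ xor (back u x₄ x₅ xor backs u es))))
          (inv-~ (config-unique c₃) (path-word′ x₁ x₂ x₃ x₄ x₅ F)) (back-flip u x₁x₂))))))

-- Conditions (a), (b), (c) suffice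

≃-length : ∀ {A : Set} {es fs : List (A × A)} → es ≃ fs → length es ≡ length fs
≃-length ≃refl = refl
≃-length (≃prep e p) = cong suc (≃-length p)
≃-length (≃swap e f) = refl
≃-length (≃flip a b) = refl
≃-length (≃trans p q) = trans (≃-length p) (≃-length q)

≃-sym : ∀ {A : Set} {es fs : List (A × A)} → es ≃ fs → fs ≃ es
≃-sym ≃refl = ≃refl
≃-sym (≃prep e p) = ≃prep e (≃-sym p)
≃-sym (≃swap e f) = ≃swap f e
≃-sym (≃flip a b) = ≃flip b a
≃-sym (≃trans p q) = ≃trans (≃-sym q) (≃-sym p)

-- Follows the alternating path c, d, e, f, … with de in the second matching and ef in the first
-- until it returns to c.
alternating-walk : ∀ {A : Set} n (c d : A) es fs → length es ≤ n → flat fs ↭ c ∷ d ∷ flat es →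
  ∃ λ Q → ∃ λ es′ → ∃ λ fs′ → es ≃ Q ++ es′ × fs ≃ rematch d Q c ++ fs′ × flat es′ ↭ flat fs′
alternating-walk n c d es fs len p with find-pair {a = d} fs (∈-resp-↭ (↭-sym p) (there (here refl)))
... | e , fs₁ , fs≃ with drop-∷ {x = d} (↭-trans (↭-sym (≃⇒↭ fs≃)) (↭-trans p (swap c d ↭-refl)))
... | q with ∈-resp-↭ q (here refl)
... | here refl = [] , es , fs₁ , ≃refl , fs≃ , ↭-sym (drop-∷ q)
... | there e∈ with find-pair es e∈
alternating-walk zero c d [] fs len p | e , fs₁ , fs≃ | q | there () | _
alternating-walk zero c d (_ ∷ _) fs () p | e , fs₁ , fs≃ | q | there e∈ | _
alternating-walk (suc n) c d es fs len p | e , fs₁ , fs≃ | q | there e∈ | f , es₁ , es≃ =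
  let Q , es′ , fs′ , es≃′ , fs≃′ , r = alternating-walk n c f es₁ fs₁
        (ℕₚ.≤-pred (subst (Data.Nat._≤ suc n) (≃-length es≃) len))
        (drop-∷ (↭-trans q (↭-trans (prep c (≃⇒↭ es≃)) (swap c e ↭-refl))))
  in (e , f) ∷ Q , es′ , fs′ , ≃trans es≃ (≃prep (e , f) es≃′) , ≃trans fs≃ (≃prep (d , e) fs≃′) , r

module Sufficiency {N : ℕ} (G : Graph N) (ω : Susp.Orientation G) (cond : Susp.CondII G ω) where
  open Susp G
  open Sign G ω
  open SignFormula G ω
  open Matchings G
  open Values G ω
  open xor-∧-Solver

  private
    cond-A = proj₁ cond
    cond-B = proj₁ (proj₂ cond)
    cond-C = proj₂ (proj₂ cond)

  Agree : Fin N × Fin N → Set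
  Agree (a , b) = back u a b ≡ back v a b

  -- Condition (a) for cycles given as lists

  module _ {x y z a b Q es} (config : Config x y z (((a , b) ∷ Q) ++ es)) (adj-R : All Adj (rematch b Q a)) where
    open Config config

    private
      C W : List (Fin N)
      C = a ∷ b ∷ flat Q
      W = y ∷ x ∷ z ∷ C

      k : ℕ
      k = length Q

      length-flat : ∀ {A : Set} (es : List (A × A)) → length (flat es) ≡ length es + length es
      length-flat [] = refl
      length-flat (e ∷ es) = cong suc (trans (cong suc (length-flat es)) (sym (ℕₚ.+-suc (length es) (length es))))

      function = tabulate-surjective (suc (suc (k + k))) C (cong (2 +_) (length-flat Q))
      c = proj₁ function
      c≡ : tabulate c ≡ C
      c≡ = proj₂ function

      whole : W ++ flat es ↭ allFin N
      whole = subst (λ l → y ∷ x ∷ z ∷ l ↭ allFin N) (flat-++ ((a , b) ∷ Q) es) word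

      unique-W : Unique W
      unique-W = Unique-++ˡ W (Unique-resp-↭ (↭-sym whole) (Uniqueₚ.allFin⁺ N))

      c∈ : ∀ i → c i ∈ C
      c∈ i = subst (c i ∈_) c≡ (∈-tabulate⁺ {f = c} i)

      links≡ : links (c zero) (tabulate (λ i → c (suc i))) (c zero) ≡ links a (b ∷ flat Q) a
      links≡ = cong₂ (λ h t → links h t h) (proj₁ (∷-injective c≡)) (proj₂ (∷-injective c≡))

      links-↭′ : links a (b ∷ flat Q) a ↭ ((a , b) ∷ Q) ++ rematch b Q a
      links-↭′ = prep (a , b) (links-↭ b Q a)

      is-cycle : IsCycle c
      is-cycle = tabulate-injective c (subst Unique (sym c≡) (AllPairs.tail (AllPairs.tail (AllPairs.tail unique-W)))) ,
        Allₚ.tabulate⁻ {f = λ i → c i , c (csuc i)} (subst (All Adj) (sym (trans (tabulate-links c) links≡))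
          (All-resp-↭ (↭-sym links-↭′) (Allₚ.++⁺ {xs = (a , b) ∷ Q} (Allₚ.++⁻ˡ ((a , b) ∷ Q) adjs) adj-R)))

      compl : ∀ {t} → t ∈ y ∷ x ∷ z ∷ [] → Compl c t
      compl t∈ i refl = ++-disjoint (y ∷ x ∷ z ∷ []) unique-W t∈ (c∈ i)

      quasi : QuasiPerfectMatching (Compl c)
      quasi with unique-W
      ... | (y≢x ∷ y≢z ∷ _) ∷ (x≢z ∷ _) ∷ _ =
        x , y , z , compl (there (here refl)) , compl (here refl) , compl (there (there (here refl))) ,
        ≢-sym y≢x , y≢z , x≢z , adj-flip yx , yz ,
        list-matching W _ whole (Allₚ.++⁻ʳ ((a , b) ∷ Q) adjs) out in′
        where
        out : ∀ {t} → Compl c t × t ≢ x × t ≢ y × t ≢ z → t ∉ W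
        out (_ , _ , p , _) (here e) = p e
        out (_ , p , _ , _) (there (here e)) = p e
        out (_ , _ , _ , p) (there (there (here e))) = p e
        out {t} (p , _) (there (there (there q))) =
          let i , e = ∈-tabulate⁻ {f = c} (subst (t ∈_) (sym c≡) q) in p i (sym e)
        in′ : ∀ {t} → t ∉ W → Compl c t × t ≢ x × t ≢ y × t ≢ z
        in′ t∉ = (λ { i refl → t∉ (there (there (there (c∈ i)))) }) ,
          (λ e → t∉ (there (here e))) , (λ e → t∉ (here e)) , (λ e → t∉ (there (there (here e))))

      conclusion = cond-A k c is-cycle quasi

    cycle-agrees : All Agree (links a (b ∷ flat Q) a)
    cycle-agrees = subst (All Agree) (trans (tabulate-links c) links≡)
      (Allₚ.tabulate⁺ {f = λ i → c i , c (csuc i)} (λ i → agree⁻ {c i} {c (csuc i)} (proj₁ conclusion i)))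

    cycle-odd : backs u ((a , b) ∷ Q) xor backs u (rematch b Q a) ≡ true
    cycle-odd = trans (sym (odd-forward-rematch u a b Q)) (trans (cong (arrows u) (sym links≡))
      (trans (sym (odd-forward u c)) (bit-injective (trans (sym (%2-odd (forwardCount ω u c))) (proj₂ conclusion)))))

  -- This is (a) for the cycle of length two through `a` and `b`; the path and the remaining edges
  -- match its complement.
  agree-edge : ∀ {x y z es a b} → Config x y z es → (a , b) ∈ es → back u a b ≡ back v a b
  agree-edge {a = a} {b} c e∈ =
    let fs , p = to-front e∈
        c′ = config-≃ c (↭⇒≃ p)
    in All.head (cycle-agrees {Q = []} c′ (adj-flip (All.head (Config.adjs c′)) ∷ []))

  val≡uval : ∀ {x y z} us vs → Config x y z (us ++ vs) → val x y z us vs ≡ uval x y z (us ++ vs)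
  val≡uval {x} {y} {z} us vs c = cong₂ _xor_ (cong (λ l → inv (y ∷ x ∷ z ∷ l)) (sym (flat-++ us vs)))
    (cong (λ b → back u y x xor (back v y z xor b)) (trans (cong (backs u us xor_)
      (backs-agree vs (All.tabulate (λ e∈ → agree-edge c (∈-++⁺ʳ us e∈))))) (sym (backs-++ u us vs))))
    where
    backs-agree : ∀ es → All Agree es → backs v es ≡ backs u es
    backs-agree [] [] = refl
    backs-agree ((x , y) ∷ es) (p ∷ ps) = cong₂ _xor_ (sym p) (backs-agree es ps)

  uval-≃ : ∀ {x y z es fs} → Config x y z es → es ≃ fs → uval x y z es ≡ uval x y z fs
  uval-≃ {x} {y} {z} {es} {fs} c p with ≃-backs p (Config.adjs c)
  ... | b , q , r = sym (trans (cong₂ (λ i e → i xor (back u y x xor (back v y z xor e)))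
      (inv-~ (config-unique c) (~prep y (~prep x (~prep z q)))) (r u))
    (solve 5 (λ b i p q e → (b :+ i) :+ (p :+ (q :+ (b :+ e))) := i :+ (p :+ (q :+ e))) refl
      b (inv (y ∷ x ∷ z ∷ flat es)) (back u y x) (back v y z) (backs u es)))

  opposed : Fin N → Fin N → Bool
  opposed x y = back u x y xor back v x y

  opposed-sym : ∀ {x y} → adj G x y ≡ true → opposed y x ≡ opposed x y
  opposed-sym {x} {y} xy = trans (cong₂ _xor_ (back-flip u xy) (back-flip v xy))
    (solve 2 (λ a b → (con true :+ a) :+ (con true :+ b) := a :+ b) refl (back u x y) (back v x y))

  one-opposed : ∀ {x y z es} → Config x y z es → opposed y x xor opposed y z ≡ true
  one-opposed {x} {y} {z} {es} c = trans (cong (_xor opposed y z) (sym (opposed-sym (Config.yx c))))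
    (bits (cond-B p (p-inj , λ { zero → adj-flip (Config.yx c) ; (suc zero) → Config.yz c })
      (list-matching (x ∷ y ∷ z ∷ []) (Compl p) word (Config.adjs c)
        (λ { h (here e) → h zero (sym e) ; h (there (here e)) → h (suc zero) (sym e)
           ; h (there (there (here e))) → h (suc (suc zero)) (sym e) })
        (λ { h zero e → h (here (sym e)) ; h (suc zero) e → h (there (here (sym e)))
           ; h (suc (suc zero)) e → h (there (there (here (sym e)))) }))))
    where
    p : Fin 3 → Fin N
    p = lookup (x ∷ y ∷ z ∷ [])
    word : x ∷ y ∷ z ∷ flat es ↭ allFin N
    word = ↭-trans (swap x y ↭-refl) (Config.word c)
    p-inj : ∀ {k l} → p k ≡ p l → k ≡ l
    p-inj = lookup-injective (Unique-++ˡ (x ∷ y ∷ z ∷ []) (Unique-resp-↭ (↭-sym word) (Uniqueₚ.allFin⁺ N)))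
    distinct : ∀ {a b} → a ≢ b → a xor b ≡ true
    distinct {true} {true} ne = ⊥-elim (ne refl)
    distinct {true} {false} ne = refl
    distinct {false} {true} ne = refl
    distinct {false} {false} ne = ⊥-elim (ne refl)
    bits : (Agreeing ω x y × Opposite ω y z) ⊎ (Opposite ω x y × Agreeing ω y z) →
      opposed x y xor opposed y z ≡ true
    bits (inj₁ (e , ne)) = cong₂ _xor_ (≡⇒xor (agree⁻ {x} {y} e)) (distinct (ne ∘ agree {y} {z}))
    bits (inj₂ (ne , e)) = cong₂ _xor_ (distinct (ne ∘ agree {x} {y})) (≡⇒xor (agree⁻ {y} {z} e))

  config-sym : ∀ {x y z es} → Config x y z es → Config z y x es
  config-sym {x} {y} {z} (mkConfig word yx yz adjs) =
    mkConfig (↭-trans (prep y (swap z x ↭-refl)) word) yz yx adjs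

  -- Reversing the path swaps `x` and `z` in the word and changes the apex of both path edges. By
  -- (b) exactly one of the two bits changes, which makes up for the swap.
  uval-sym : ∀ {x y z es} → Config x y z es → uval x y z es ≡ uval z y x es
  uval-sym {x} {y} {z} {es} c = sym (trans
    (cong (_xor (back u y z xor (back v y x xor backs u es))) (inv-~ (config-unique c) (~prep y (~swap x z))))
    (xor⇒≡ (trans
      (solve 6 (λ i a b c d e → ((con true :+ i) :+ (c :+ (b :+ e))) :+ (i :+ (a :+ (d :+ e))) :=
        con true :+ ((a :+ b) :+ (c :+ d))) refl
        (inv (y ∷ x ∷ z ∷ flat es)) (back u y x) (back v y x) (back u y z) (back v y z) (backs u es))
      (cong not (one-opposed c)))))

  -- By (b), of any two edges of the triangle exactly one would be agreeing.
  no-triangle : ∀ {x y z es} → Config x y z es → adj G x z ≡ true → ⊥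
  no-triangle {x} {y} {z} {es} c@(mkConfig word yx yz adjs) xz =
    odd-sum (opposed y x) (opposed y z) (opposed x z) (one-opposed c)
      (trans (cong (_xor opposed x z) (sym (opposed-sym yx)))
        (one-opposed (mkConfig (↭-trans (swap x y ↭-refl) word) (adj-flip yx) xz adjs)))
      (trans (cong₂ _xor_ (sym (opposed-sym xz)) (sym (opposed-sym yz)))
        (one-opposed (mkConfig
          (↭-trans (↭-trans (prep z (swap x y ↭-refl)) (↭-trans (swap z y ↭-refl) (prep y (swap z x ↭-refl)))) word)
          (adj-flip xz) (adj-flip yz) adjs)))
    where
    odd-sum : ∀ a b c → a xor b ≡ true → a xor c ≡ true → c xor b ≡ true → ⊥
    odd-sum true false true _ () _
    odd-sum true false false _ _ ()
    odd-sum false true true _ _ ()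
    odd-sum false true false _ () _
    odd-sum true true _ () _ _
    odd-sum false false _ () _ _

  ⇔⇒≡ : ∀ {a b} → (a ≡ true) ⇔ (b ≡ true) → a ≡ b
  ⇔⇒≡ {true} {b} h = sym (Equivalence.to h refl)
  ⇔⇒≡ {false} {true} h = Equivalence.from h refl
  ⇔⇒≡ {false} {false} h = refl

  slide-config : ∀ {x₁ x₂ x₃ x₄ x₅ es} → Config x₃ x₄ x₅ ((x₁ , x₂) ∷ es) → adj G x₂ x₃ ≡ true →
    Config x₃ x₂ x₁ ((x₄ , x₅) ∷ es)
  slide-config {x₁} {x₂} {x₃} {x₄} {x₅} {es} (mkConfig word x₄x₃ x₄x₅ (x₁x₂ ∷ adjs)) x₂x₃ =
    mkConfig (↭-trans (~⇒↭ (~sym (path-word x₁ x₂ x₃ x₄ x₅ (flat es)))) word) x₂x₃ (adj-flip x₁x₂) (x₄x₅ ∷ adjs)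

  -- The word changes by an odd permutation and `x₁ x₂` is reversed, so these two signs cancel; the
  -- bits at `x₃` are equal by (c). The edges `x₁ x₂` and `x₄ x₅` do change their apices, but each
  -- is a single edge before or after the slide and hence agrees.
  slide : ∀ {x₁ x₂ x₃ x₄ x₅ es} → Config x₃ x₄ x₅ ((x₁ , x₂) ∷ es) → adj G x₂ x₃ ≡ true →
    uval x₃ x₄ x₅ ((x₁ , x₂) ∷ es) ≡ uval x₃ x₂ x₁ ((x₄ , x₅) ∷ es)
  slide {x₁} {x₂} {x₃} {x₄} {x₅} {es} c@(mkConfig word x₄x₃ x₄x₅ (x₁x₂ ∷ adjs)) x₂x₃ = sym (trans
    (cong₂ (λ i b → i xor (b xor (back v x₂ x₁ xor (back u x₄ x₅ xor backs u es))))
      (inv-~ (config-unique c) (path-word x₁ x₂ x₃ x₄ x₅ (flat es))) same-back)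
    (trans (cong₂ (λ p q → not I xor (back u x₄ x₃ xor (p xor (q xor backs u es))))
        (trans (back-flip v x₁x₂) (cong not (sym (agree-edge c (here refl)))))
        (agree-edge (slide-config c x₂x₃) (here refl)))
      (solve 5 (λ i a p q e → (con true :+ i) :+ (a :+ ((con true :+ p) :+ (q :+ e))) :=
          i :+ (a :+ (q :+ (p :+ e)))) refl
        I (back u x₄ x₃) (back u x₁ x₂) (back v x₄ x₅) (backs u es))))
    where
    I = inv (x₄ ∷ x₃ ∷ x₅ ∷ x₁ ∷ x₂ ∷ flat es)
    p : Fin 5 → Fin N
    p = lookup (x₁ ∷ x₂ ∷ x₃ ∷ x₄ ∷ x₅ ∷ [])
    path : x₁ ∷ x₂ ∷ x₃ ∷ x₄ ∷ x₅ ∷ flat es ↭ allFin N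
    path = ↭-trans (swap x₁ x₂ ↭-refl) (↭-trans (prep x₂ (swap x₁ x₃ ↭-refl))
      (Config.word (slide-config c x₂x₃)))
    p-inj : ∀ {k l} → p k ≡ p l → k ≡ l
    p-inj = lookup-injective (Unique-++ˡ (x₁ ∷ x₂ ∷ x₃ ∷ x₄ ∷ x₅ ∷ [])
      (Unique-resp-↭ (↭-sym path) (Uniqueₚ.allFin⁺ N)))
    same-back : back u x₂ x₃ ≡ back u x₄ x₃
    same-back = cong not (⇔⇒≡ (proj₁ (cond-C p
      (p-inj , λ { zero → x₁x₂ ; (suc zero) → x₂x₃ ; (suc (suc zero)) → adj-flip x₄x₃
                 ; (suc (suc (suc zero))) → x₄x₅ })
      (list-matching (x₁ ∷ x₂ ∷ x₃ ∷ x₄ ∷ x₅ ∷ []) (Compl p) path adjs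
        (λ { h (here e) → h zero (sym e) ; h (there (here e)) → h (suc zero) (sym e)
           ; h (there (there (here e))) → h (suc (suc zero)) (sym e)
           ; h (there (there (there (here e)))) → h (suc (suc (suc zero))) (sym e)
           ; h (there (there (there (there (here e))))) → h (suc (suc (suc (suc zero)))) (sym e) })
        (λ { h zero e → h (here (sym e)) ; h (suc zero) e → h (there (here (sym e)))
           ; h (suc (suc zero)) e → h (there (there (here (sym e))))
           ; h (suc (suc (suc zero))) e → h (there (there (there (here (sym e)))))
           ; h (suc (suc (suc (suc zero)))) e → h (there (there (there (there (here (sym e)))))) })))))

  -- The odd rotation of the word is compensated by `cycle-odd`.
  rotate : ∀ {x y z a b Q es} → Config x y z (((a , b) ∷ Q) ++ es) → All Adj (rematch b Q a) →
    uval x y z (((a , b) ∷ Q) ++ es) ≡ uval x y z (rematch b Q a ++ es)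
  rotate {x} {y} {z} {a} {b} {Q} {es} c adj-R = sym (trans
    (cong₂ (λ i e → i xor (back u y x xor (back v y z xor e))) (inv-~ (config-unique c) P~R) (backs-++ u R es))
    (trans (xor⇒≡ (trans
        (solve 6 (λ i a b p r e → ((con true :+ i) :+ (a :+ (b :+ (r :+ e)))) :+ (i :+ (a :+ (b :+ (p :+ e)))) :=
          con true :+ (p :+ r)) refl
          (inv (y ∷ x ∷ z ∷ flat (P ++ es))) (back u y x) (back v y z) (backs u P) (backs u R) (backs u es))
        (cong not (cycle-odd {Q = Q} c adj-R))))
      (cong (λ e → inv (y ∷ x ∷ z ∷ flat (P ++ es)) xor (back u y x xor (back v y z xor e))) (sym (backs-++ u P es)))))
    where
    P R : List (Fin N × Fin N)
    P = (a , b) ∷ Q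
    R = rematch b Q a
    P~R : (y ∷ x ∷ z ∷ flat (P ++ es)) ~[ true ] (y ∷ x ∷ z ∷ flat (R ++ es))
    P~R = ~prep y (~prep x (~prep z (~trans (~reflexive (flat-++ P es))
      (~trans (~++ʳ (flat es) (rematch-~ a b Q)) (~reflexive (sym (flat-++ R es)))))))

  -- `K` collects the edges already in place. Each round closes one alternating cycle through
  -- `(a , b)`, rotates along it and adds its new edges to `K`. A common edge counts as an
  -- alternating cycle of length two, so it needs no separate case.
  rematch-invariant : ∀ n {x y z} K es fs → length es ≤ n → flat es ↭ flat fs →
    Config x y z (K ++ es) → Config x y z (K ++ fs) → uval x y z (K ++ es) ≡ uval x y z (K ++ fs)
  rematch-invariant n K [] [] len p c c′ = refl
  rematch-invariant n K [] (_ ∷ _) len p c c′ with ↭-length p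
  ... | ()
  rematch-invariant (suc n) {x} {y} {z} K ((a , b) ∷ es) fs (s≤s len) p c c′
    with alternating-walk n a b es fs len (↭-sym p)
  ... | Q , es₁ , fs₁ , es≃ , fs≃ , q =
    trans (uval-≃ c to-P)
    (trans (rotate {Q = Q} config-P (Allₚ.++⁻ˡ R adj-R))
    (trans (cong (uval x y z) (sym (++-assoc R K es₁)))
    (trans (rematch-invariant n (R ++ K) es₁ fs₁
        (ℕₚ.≤-trans (ℕₚ.m≤n+m (length es₁) (length Q)) (ℕₚ.≤-trans (ℕₚ.≤-reflexive
          (trans (sym (length-++ Q)) (sym (≃-length es≃)))) len)) q
        (subst (Config x y z) (sym (++-assoc R K es₁)) config-R) (config-≃ c′ to-R))
      (sym (uval-≃ c′ to-R)))))
    where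
    P R : List (Fin N × Fin N)
    P = (a , b) ∷ Q
    R = rematch b Q a
    shifts≃ : ∀ ps rs qs → ps ++ rs ++ qs ≃ rs ++ ps ++ qs
    shifts≃ ps rs qs = ↭⇒≃ (shifts ps rs)
    to-P : K ++ (a , b) ∷ es ≃ P ++ (K ++ es₁)
    to-P = ≃trans (≃-++ˡ K (≃prep (a , b) es≃)) (shifts≃ K P es₁)
    to-R : K ++ fs ≃ (R ++ K) ++ fs₁
    to-R = subst (K ++ fs ≃_) (sym (++-assoc R K fs₁)) (≃trans (≃-++ˡ K fs≃) (shifts≃ K R fs₁))
    adj-R : All Adj (R ++ fs₁)
    adj-R = ≃-All adj-flip fs≃ (Allₚ.++⁻ʳ K (Config.adjs c′))
    config-P : Config x y z (P ++ (K ++ es₁))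
    config-P = config-≃ c to-P
    P↭R : flat (P ++ (K ++ es₁)) ↭ flat (R ++ (K ++ es₁))
    P↭R = ↭-trans (↭-reflexive (flat-++ P (K ++ es₁))) (↭-trans (++⁺ʳ (flat (K ++ es₁)) (~⇒↭ (rematch-~ a b Q)))
      (↭-reflexive (sym (flat-++ R (K ++ es₁)))))
    config-R : Config x y z (R ++ (K ++ es₁))
    config-R = mkConfig (↭-trans (prep y (prep x (prep z (↭-sym P↭R)))) (Config.word config-P))
      (Config.yx c) (Config.yz c)
      (Allₚ.++⁺ (Allₚ.++⁻ˡ R adj-R) (Allₚ.++⁻ʳ P (Config.adjs config-P)))

  -- Descent to a fixed target matching

  module _ {x′ y′ z′ es′} (target : Config x′ y′ z′ es′) where

    private
      target-edges : List (Fin N × Fin N)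
      target-edges = (x′ , y′) ∷ (y′ , z′) ∷ es′

      unique-target : Unique (y′ ∷ x′ ∷ z′ ∷ flat es′)
      unique-target = config-unique target

      tail₁ = AllPairs.tail unique-target
      tail₂ = AllPairs.tail tail₁

    open DecMembership (≡-dec (_≟_ {N}) (_≟_ {N})) using ()
      renaming (_∈?_ to _∈ₑ?_)

    E : Fin N → Fin N → Set
    E a b = (a , b) ∈ target-edges ⊎ (b , a) ∈ target-edges

    abstract
      E? : ∀ a b → Dec (E a b)
      E? a b = ((a , b) ∈ₑ? target-edges) ⊎-dec ((b , a) ∈ₑ? target-edges)

    E-sym : ∀ {a b} → E a b → E b a
    E-sym (inj₁ p) = inj₂ p
    E-sym (inj₂ p) = inj₁ p

    E-adj : ∀ {a b} → E a b → adj G a b ≡ true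
    E-adj = λ { (inj₁ p) → All.lookup adjs p ; (inj₂ p) → adj-flip (All.lookup adjs p) }
      where
      adjs : All Adj target-edges
      adjs = adj-flip (Config.yx target) ∷ Config.yz target ∷ Config.adjs target

    flat-edge : ∀ {a es} → a ∈ flat es → ∃ λ (b : Fin N) → (a , b) ∈ es ⊎ (b , a) ∈ es
    flat-edge {es = (a , b) ∷ es} (here refl) = b , inj₁ (here refl)
    flat-edge {es = (a , b) ∷ es} (there (here refl)) = a , inj₂ (here refl)
    flat-edge {es = _ ∷ es} (there (there p)) with flat-edge p
    ... | b , inj₁ q = b , inj₁ (there q)
    ... | b , inj₂ q = b , inj₂ (there q)

    E-neighbour : ∀ a → ∃ λ b → E a b
    E-neighbour a with ∈-resp-↭ (↭-sym (Config.word target)) (∈-allFin a)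
    ... | here refl = x′ , inj₂ (here refl)
    ... | there (here refl) = y′ , inj₁ (here refl)
    ... | there (there (here refl)) = y′ , inj₂ (there (here refl))
    ... | there (there (there p)) with flat-edge p
    ... | b , inj₁ q = b , inj₁ (there (there q))
    ... | b , inj₂ q = b , inj₂ (there (there q))

    edge-flat : ∀ {a b : Fin N} {es} → (a , b) ∈ es → a ∈ flat es × b ∈ flat es
    edge-flat (here refl) = here refl , there (here refl)
    edge-flat {es = _ ∷ _} (there p) = let q , r = edge-flat p in there (there q) , there (there r)

    partner-edge : ∀ {a b es} → Unique (flat es) → (a , b) ∈ es → partner es a ≡ b × partner es b ≡ a
    partner-edge {a} {b} {_ ∷ es} ((a≢b ∷ _) ∷ _) (here refl) = partner-fst a b es , partner-snd a b es a≢b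
    partner-edge {a} {b} {(c , d) ∷ es} uniq@(_ ∷ _ ∷ uniq′) (there p) =
      let a∈ , b∈ = edge-flat p ; e , f = partner-edge uniq′ p in
      trans (skip a∈) e , trans (skip b∈) f
      where
      skip : ∀ {a} → a ∈ flat es → partner ((c , d) ∷ es) a ≡ partner es a
      skip a∈ = partner-skip es (++-apart (c ∷ d ∷ []) uniq (here refl) a∈)
        (++-apart (c ∷ d ∷ []) uniq (there (here refl)) a∈)

    -- Away from `y′` every vertex lies on one target edge, so its neighbour is a function. Both
    -- path edges are listed with `y′` second, so that `partner` returns `y′` at `x′` as well as at
    -- `z′`.
    mate : Fin N → Fin N
    mate = partner ((x′ , y′) ∷ (z′ , y′) ∷ es′)

    mate-skip : ∀ {a} → a ∈ flat es′ → mate a ≡ partner es′ a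
    mate-skip {a} a∈ = trans
      (partner-skip {a} {x′} {y′} ((z′ , y′) ∷ es′) (λ { refl → Unique[x∷xs]⇒x∉xs tail₁ (there a∈) }) a≢y′)
      (partner-skip {a} {z′} {y′} es′ (λ { refl → Unique[x∷xs]⇒x∉xs tail₂ a∈ }) a≢y′)
      where
      a≢y′ : a ≢ y′
      a≢y′ refl = Unique[x∷xs]⇒x∉xs unique-target (there (there a∈))

    E-mate : ∀ {a b} → a ≢ y′ → E a b → b ≡ mate a
    E-mate a≢ (inj₁ (here refl)) = sym (partner-fst x′ y′ ((z′ , y′) ∷ es′))
    E-mate a≢ (inj₂ (here refl)) = ⊥-elim (a≢ refl)
    E-mate a≢ (inj₁ (there (here refl))) = ⊥-elim (a≢ refl)
    E-mate a≢ (inj₂ (there (here refl))) = sym (trans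
      (partner-skip ((z′ , y′) ∷ es′) (λ { refl → Unique[x∷xs]⇒x∉xs tail₁ (here refl) }) a≢) (partner-fst z′ y′ es′))
    E-mate a≢ (inj₁ (there (there p))) =
      sym (trans (mate-skip (proj₁ (edge-flat p))) (proj₁ (partner-edge (AllPairs.tail tail₂) p)))
    E-mate a≢ (inj₂ (there (there p))) =
      sym (trans (mate-skip (proj₂ (edge-flat p))) (proj₂ (partner-edge (AllPairs.tail tail₂) p)))

    E-middle : ∀ {b} → E y′ b → b ≡ x′ ⊎ b ≡ z′
    E-middle (inj₁ (here e)) = ⊥-elim (Unique[x∷xs]⇒x∉xs unique-target (here (cong proj₁ e)))
    E-middle (inj₂ (here e)) = inj₁ (cong proj₁ e)
    E-middle (inj₁ (there (here e))) = inj₂ (cong proj₂ e)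
    E-middle (inj₂ (there (here e))) = ⊥-elim (Unique[x∷xs]⇒x∉xs unique-target (there (here (cong proj₂ e))))
    E-middle (inj₁ (there (there p))) = ⊥-elim (Unique[x∷xs]⇒x∉xs unique-target (there (there (proj₁ (edge-flat p)))))
    E-middle (inj₂ (there (there p))) = ⊥-elim (Unique[x∷xs]⇒x∉xs unique-target (there (there (proj₂ (edge-flat p)))))

    weight : ∀ {P : Set} → Dec P → ℕ
    weight (yes _) = 0
    weight (no _) = 1

    weight-yes : ∀ {P : Set} (d : Dec P) → P → weight d ≡ 0
    weight-yes (yes _) _ = refl
    weight-yes (no ¬p) p = ⊥-elim (¬p p)

    weight-no : ∀ {P : Set} (d : Dec P) → ¬ P → weight d ≡ 1
    weight-no (yes p) ¬p = ⊥-elim (¬p p)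
    weight-no (no _) _ = refl

    weight-cong : ∀ {P Q : Set} (d : Dec P) (e : Dec Q) → (P → Q) → (Q → P) → weight d ≡ weight e
    weight-cong (yes p) e f g = sym (weight-yes e (f p))
    weight-cong (no ¬p) e f g = sym (weight-no e (¬p ∘ g))

    missing : Fin N → Fin N → ℕ
    missing a b = weight (E? a b)

    missing-yes : ∀ {a b} → E a b → missing a b ≡ 0
    missing-yes {a} {b} = weight-yes (E? a b)

    missing-no : ∀ {a b} → ¬ E a b → missing a b ≡ 1
    missing-no {a} {b} = weight-no (E? a b)

    missing-sym : ∀ a b → missing a b ≡ missing b a
    missing-sym a b = weight-cong (E? a b) (E? b a) E-sym E-sym

    distance : List (Fin N × Fin N) → ℕ
    distance [] = 0
    distance ((a , b) ∷ es) = missing a b + distance es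

    distance-≃ : ∀ {es fs} → es ≃ fs → distance es ≡ distance fs
    distance-≃ ≃refl = refl
    distance-≃ (≃prep (a , b) p) = cong (missing a b +_) (distance-≃ p)
    distance-≃ (≃swap (a , b) (c , d) {es}) = trans (sym (ℕₚ.+-assoc (missing a b) _ _))
      (trans (cong (_+ distance es) (ℕₚ.+-comm (missing a b) (missing c d))) (ℕₚ.+-assoc (missing c d) _ _))
    distance-≃ (≃flip a b {es}) = cong (_+ distance es) (missing-sym a b)
    distance-≃ (≃trans p q) = trans (distance-≃ p) (distance-≃ q)

    -- The measure of the descent. Path edges and single edges are counted alike, because sliding
    -- turns one kind into the other.
    Size : Fin N → Fin N → Fin N → List (Fin N × Fin N) → ℕ
    Size x y z es = distance ((x , y) ∷ (y , z) ∷ es)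

    size-sym : ∀ x y z es → Size x y z es ≡ Size z y x es
    size-sym x y z es =
      distance-≃ {(x , y) ∷ (y , z) ∷ es} (≃trans (≃swap _ _) (≃trans (≃flip y z) (≃prep _ (≃flip x y))))

    -- If `y` were not `y′`, then `x` and `z` would both be its only target neighbour. So the two
    -- paths coincide up to direction, and the single edges of the two matchings cover the same
    -- vertices.
    arrived : ∀ {x y z es} → Config x y z es → E x y → E y z → uval x y z es ≡ uval x′ y′ z′ es′
    arrived {x} {y} {z} {es} c xy yz with y ≟ y′
    ... | no y≢ = ⊥-elim (Unique[x∷xs]⇒x∉xs (AllPairs.tail (config-unique c))
            (here (trans (E-mate y≢ (E-sym xy)) (sym (E-mate y≢ yz)))))
    ... | yes refl with E-middle (E-sym xy) | E-middle yz
    ... | inj₁ refl | inj₁ refl = ⊥-elim (Unique[x∷xs]⇒x∉xs (AllPairs.tail (config-unique c)) (here refl))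
    ... | inj₂ refl | inj₂ refl = ⊥-elim (Unique[x∷xs]⇒x∉xs (AllPairs.tail (config-unique c)) (here refl))
    ... | inj₁ refl | inj₂ refl = rematch-invariant _ [] es es′ ℕₚ.≤-refl
            (drop-∷ (drop-∷ (drop-∷ (↭-trans (Config.word c) (↭-sym (Config.word target)))))) c target
    ... | inj₂ refl | inj₁ refl = trans (uval-sym c) (rematch-invariant _ [] es es′ ℕₚ.≤-refl
            (drop-∷ (drop-∷ (drop-∷ (↭-trans (Config.word (config-sym c)) (↭-sym (Config.word target))))))
            (config-sym c) target)

    -- The target edge at the leaf x leads off the path x y z, so sliding along it gains an edge.
    approach : ∀ {x y z es} → Config x y z es → ¬ E x y →
      ∃ λ x₂ → ∃ λ x₁ → ∃ λ fs → Config x x₂ x₁ fs × uval x y z es ≡ uval x x₂ x₁ fs ×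
        suc (Size x x₂ x₁ fs) ≡ Size x y z es
    approach {x} {y} {z} {es} c ne with E-neighbour x
    ... | x₂ , e with ∈-resp-↭ (↭-sym (Config.word c)) (∈-allFin x₂)
    ... | here refl = ⊥-elim (ne e)
    ... | there (here refl) = ⊥-elim (adjacent-≢ (E-adj e) refl)
    ... | there (there (here refl)) = ⊥-elim (no-triangle c (E-adj e))
    ... | there (there (there p)) with find-pair es p
    ... | x₁ , fs , q = x₂ , x₁ , (y , z) ∷ fs , slide-config c′ (adj-flip (E-adj e)) ,
      trans (uval-≃ c q′) (slide c′ (adj-flip (E-adj e))) ,
      closer
      where
      q′ : es ≃ (x₁ , x₂) ∷ fs
      q′ = ≃trans q (≃flip x₂ x₁)
      -- The edge `y z` becomes single and the edge `x₂ x₁` joins the path. Only `x y`, missing from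
      -- the target, is lost, and `x x₂`, which belongs to it, is gained.
      closer : suc (Size x x₂ x₁ ((y , z) ∷ fs)) ≡ Size x y z es
      closer = trans (cong (λ k → suc (k + distance ((x₂ , x₁) ∷ (y , z) ∷ fs))) (missing-yes e))
        (trans (cong (_+ distance ((x₂ , x₁) ∷ (y , z) ∷ fs)) (sym (missing-no ne)))
          (cong (missing x y +_) (distance-≃ {(x₂ , x₁) ∷ (y , z) ∷ fs} {(y , z) ∷ es}
            (≃trans (≃swap (x₂ , x₁) (y , z)) (≃prep (y , z) (≃-sym q))))))
      c′ : Config x y z ((x₁ , x₂) ∷ fs)
      c′ = config-≃ c q′

    both-edges : ∀ x y z → (E x y × E y z) ⊎ (¬ E x y ⊎ ¬ E y z)
    both-edges x y z with E? x y | E? y z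
    ... | yes p | yes q = inj₁ (p , q)
    ... | no ¬p | _ = inj₂ (inj₁ ¬p)
    ... | _ | no ¬q = inj₂ (inj₂ ¬q)

    progress : ∀ {x y z es} → Config x y z es → (E x y × E y z) ⊎
      ∃ λ a → ∃ λ b → ∃ λ c → ∃ λ fs → Config a b c fs × uval x y z es ≡ uval a b c fs ×
        suc (Size a b c fs) ≡ Size x y z es
    progress {x} {y} {z} {es} c with both-edges x y z
    ... | inj₁ both = inj₁ both
    ... | inj₂ (inj₁ ne) =
      let x₂ , x₁ , fs , c′ , e , s = approach c ne in inj₂ (x , x₂ , x₁ , fs , c′ , e , s)
    ... | inj₂ (inj₂ ne) =
      let x₂ , x₁ , fs , c′ , e , s = approach (config-sym c) (ne ∘ E-sym) in
      inj₂ (z , x₂ , x₁ , fs , c′ , trans (uval-sym c) e , trans s (size-sym z y x es))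

    descend : ∀ n {x y z es} → Config x y z es → Size x y z es ≤ n → uval x y z es ≡ uval x′ y′ z′ es′
    descend n c len with progress c
    ... | inj₁ (xy , yz) = arrived c xy yz
    descend zero c len | inj₂ (_ , _ , _ , _ , _ , _ , s) =
      ⊥-elim (ℕₚ.<⇒≱ (ℕₚ.≤-reflexive s) (ℕₚ.≤-trans len z≤n))
    descend (suc n) c len | inj₂ (_ , _ , _ , _ , c′ , e , s) =
      trans e (descend n c′ (ℕₚ.≤-pred (ℕₚ.≤-trans (ℕₚ.≤-reflexive s) len)))

  -- The second configuration itself is the target of the descent, so no reference matching has to
  -- be chosen.
  constant : Constant
  constant us vs us′ vs′ c c′ =
    trans (val≡uval us vs c) (trans (descend c′ _ c ℕₚ.≤-refl) (sym (val≡uval us′ vs′ c′)))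

theorem5p10 : (n : ℕ) (G : Graph (Nv n)) (ω : Susp.Orientation G) →
    Susp.ThreePfaffian G ω ⇔ Susp.CondII G ω
theorem5p10 n G ω = mk⇔
  (λ pfaffian → let const = Values.pfaffian⇒constant G ω pfaffian
                    open Necessity G ω const in cond-A , cond-B , cond-C)
  (λ cond → Values.constant⇒pfaffian G ω (Sufficiency.constant G ω cond))
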